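{- Fix an integer $\kappa\ge1$ and a real number $c>0$. Then, asymptotically almost surely, for all $1\le k\le\kappa$ the number of connected components of order $k$ (that is, with exactly $k$ vertices) in the random graph $\mathbb{G}(n,\lfloor cn\rfloor)$ is asymptotically equal to $$\frac{k^{k-2}}{k!}(2c)^{k-1}e^{ -2kc}\,n .$$
   Context: All asymptotics are as $n\to\infty$. $\mathbb{G}(n,m)$ denotes the Erdős–Rényi random graph: a graph chosen uniformly at random from all labeled graphs on $n$ vertices with exactly $m$ edges (defined for $n$ large enough that $m=\lfloor cn\rfloor\le\binom n2$). "Asymptotically almost surely, a random variable $X$ (depending on $n$) is asymptotically equal to $x$ (depending on $n$)" means that there is a sequence $\varepsilon_n=o(1)$ such that $$\lim_{n\to\infty}\Pr\left[(1-\varepsilon_n)x\le X\le(1+\varepsilon_n)x\right]=1 .$$ -}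

module Defs where

open import Data.Empty using (⊥)
open import Data.Fin.Base using (Fin; zero; suc)
open import Data.Fin.Properties using (any?; all?)
open import Data.Fin.Subset using (Subset; inside; outside; _∈_; Nonempty; ∣_∣)
open import Data.Fin.Subset.Properties using (_∈?_; nonempty?)
open import Data.Integer.Base using (+_)
import Data.Integer.Base as ℤ
import Data.Integer.Properties as ℤₚ
open import Data.List.Base using (List; []; _∷_; map; _++_; filter; length; cartesianProductWith)
open import Data.List.Relation.Binary.Sublist.Propositional using (_⊆_)
open import Data.List.Relation.Unary.All using (All)
open import Data.Nat.Base using (ℕ; zero; suc; z≤n; s≤s; _!; _∸_)
import Data.Nat.Base as ℕ
import Data.Nat.Properties as ℕₚ
open import Data.Product.Base using (∃-syntax; _×_; _,_)
open import Data.Rational.Base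
  using (ℚ; mkℚ; 0ℚ; 1ℚ; ½; _+_; _*_; _-_; -_; _/_; _≤_; _<_;
         positive; nonNegative; 1/_)
import Data.Rational.Base as ℚ
import Data.Rational.Unnormalised.Base as ℚᵘ
import Data.Rational.Unnormalised.Properties as ℚᵘₚ
open import Data.Rational.Properties hiding (_≟_)
open import Data.Rational.Solver using (module +-*-Solver)
open import Data.Sum.Base using (_⊎_; inj₁; inj₂)
open import Data.Unit.Base using (⊤; tt)
import Data.Vec.Base as Vec
open import Function.Bundles using (_⇔_; mk⇔; Equivalence)
open import Relation.Binary.Construct.Closure.ReflexiveTransitive using (Star; ε; _◅_; _◅◅_; gmap)
open import Relation.Binary.PropositionalEquality
open import Relation.Nullary using (Dec; yes; no)
open import Relation.Nullary.Decidable using (map′; _×-dec_; _⊎-dec_; _→-dec_)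

Eventually : (ℕ → Set) → Set
Eventually P = ∃[ N ] (∀ {n} → N ℕ.≤ n → P n)

Cauchy : (ℕ → ℚ) → Set
Cauchy s = ∀ {δ} → 0ℚ < δ → ∃[ N ] (∀ {i j} → N ℕ.≤ i → N ℕ.≤ j → ℚ.∣ s i - s j ∣ ≤ δ)

module _ where
  open +-*-Solver using (solve; _:=_; _:+_; _:*_; _:-_; :-_)

  neg-diff : ∀ p q → - (p - q) ≡ q - p
  neg-diff = solve 2 (λ p q → :- (p :- q) := q :- p) refl

  sum-diff : ∀ p q r s → (p + q) - (r + s) ≡ (p - r) + (q - s)
  sum-diff = solve 4 (λ p q r s → (p :+ q) :- (r :+ s) := (p :- r) :+ (q :- s)) refl

  diff-neg : ∀ p q → - p - (- q) ≡ q - p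
  diff-neg = solve 2 (λ p q → :- p :- (:- q) := q :- p) refl

  add-sub : ∀ p q → p ≡ (p - q) + q
  add-sub = solve 2 (λ p q → p := (p :- q) :+ q) refl

  mul-swap : ∀ p q r → p * (q * r) ≡ q * (p * r)
  mul-swap = solve 3 (λ p q r → p :* (q :* r) := q :* (p :* r)) refl

  prod-diff : ∀ p q r s → p * q - r * s ≡ p * (q - s) + s * (p - r)
  prod-diff = solve 4 (λ p q r s → p :* q :- r :* s := p :* (q :- s) :+ s :* (p :- r)) refl

  add-diff : ∀ p q r → (p + q) - r ≡ (p - r) + q
  add-diff = solve 3 (λ p q r → (p :+ q) :- r := (p :- r) :+ q) refl

  telescope₁ : ∀ p q r → (p - q) + r ≡ (r + r) + (p - q - r)
  telescope₁ = solve 3 (λ p q r → (p :- q) :+ r := (r :+ r) :+ (p :- q :- r)) refl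

  telescope₂ : ∀ p q r → q + (p - q - r) ≡ p - r
  telescope₂ = solve 3 (λ p q r → q :+ (p :- q :- r) := p :- r) refl

  halves : ∀ p q r s → p * (q * (r * s)) + p * (q * (r * s)) ≡ (p * q) * ((r + r) * s)
  halves = solve 4 (λ p q r s → p :* (q :* (r :* s)) :+ p :* (q :* (r :* s)) := (p :* q) :* ((r :+ r) :* s)) refl

  mul-rearrange : ∀ p q r s → (p * q) * (r * s) ≡ p * ((r * q) * s)
  mul-rearrange = solve 4 (λ p q r s → (p :* q) :* (r :* s) := p :* ((r :* q) :* s)) refl

  split₃ : ∀ p q r s → p - s ≡ (p - q) + ((q - r) + (r - s))
  split₃ = solve 4 (λ p q r s → p :- s := (p :- q) :+ ((q :- r) :+ (r :- s))) refl

  add-rearrange : ∀ p q → p + (q + p) ≡ (p + p) + q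
  add-rearrange = solve 2 (λ p q → p :+ (q :+ p) := (p :+ p) :+ q) refl

module _ where
  open ≤-Reasoning

  *-nonNeg : ∀ p q → 0ℚ ≤ p → 0ℚ ≤ q → 0ℚ ≤ p * q
  *-nonNeg p q 0≤p 0≤q =
    nonNegative⁻¹ (p * q) {{nonNeg*nonNeg⇒nonNeg p {{nonNegative 0≤p}} q {{nonNegative 0≤q}}}}

  half-pos : ∀ {δ} → 0ℚ < δ → 0ℚ < ½ * δ
  half-pos {δ} p = positive⁻¹ (½ * δ) {{pos*pos⇒pos ½ δ {{positive p}}}}

  half+half : ∀ δ → ½ * δ + ½ * δ ≡ δ
  half+half δ = trans (sym (*-distribʳ-+ δ ½ ½)) (*-identityˡ δ)

  ∣∣-swap : ∀ p q → ℚ.∣ p - q ∣ ≡ ℚ.∣ q - p ∣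
  ∣∣-swap p q = trans (sym (∣-p∣≡∣p∣ (p - q)))
    (cong ℚ.∣_∣ (neg-diff p q))

  +-cauchy : ∀ {s t} → Cauchy s → Cauchy t → Cauchy (λ i → s i + t i)
  +-cauchy {s} {t} cs ct {δ} 0<δ with cs (half-pos 0<δ) | ct (half-pos 0<δ)
  ... | M , p | N , q = M ℕ.⊔ N , λ {i} {j} hi hj → begin
    ℚ.∣ (s i + t i) - (s j + t j) ∣
      ≡⟨ cong ℚ.∣_∣ (sum-diff (s i) (t i) (s j) (t j)) ⟩
    ℚ.∣ (s i - s j) + (t i - t j) ∣
      ≤⟨ ∣p+q∣≤∣p∣+∣q∣ (s i - s j) (t i - t j) ⟩
    ℚ.∣ s i - s j ∣ + ℚ.∣ t i - t j ∣
      ≤⟨ +-mono-≤ (p (ℕₚ.m⊔n≤o⇒m≤o M N hi) (ℕₚ.m⊔n≤o⇒m≤o M N hj))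
                  (q (ℕₚ.m⊔n≤o⇒n≤o M N hi) (ℕₚ.m⊔n≤o⇒n≤o M N hj)) ⟩
    ½ * δ + ½ * δ ≡⟨ half+half δ ⟩
    δ ∎

  const-cauchy : ∀ q → Cauchy (λ _ → q)
  const-cauchy q {δ} 0<δ = 0 , λ _ _ → begin
    ℚ.∣ q - q ∣ ≡⟨ cong ℚ.∣_∣ (+-inverseʳ q) ⟩
    0ℚ          ≤⟨ <⇒≤ 0<δ ⟩
    δ           ∎

  neg-cauchy : ∀ {s} → Cauchy s → Cauchy (λ i → - s i)
  neg-cauchy {s} cs {δ} 0<δ with cs 0<δ
  ... | N , p = N , λ {i} {j} hi hj → begin
    ℚ.∣ - s i - (- s j) ∣
      ≡⟨ cong ℚ.∣_∣ (diff-neg (s i) (s j)) ⟩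
    ℚ.∣ s j - s i ∣ ≤⟨ p hj hi ⟩
    δ ∎

  eventually-bounded : ∀ {s} → Cauchy s → ∃[ B ] 0ℚ < B × Eventually (λ i → ℚ.∣ s i ∣ ≤ B)
  eventually-bounded {s} cs with cs (positive⁻¹ 1ℚ)
  ... | N , p = 1ℚ + ℚ.∣ s N ∣
              , positive⁻¹ _ {{pos+nonNeg⇒pos 1ℚ ℚ.∣ s N ∣ {{∣-∣-nonNeg (s N)}}}}
              , N , λ {i} hi → begin
    ℚ.∣ s i ∣ ≡⟨ cong ℚ.∣_∣ (add-sub (s i) (s N)) ⟩
    ℚ.∣ (s i - s N) + s N ∣ ≤⟨ ∣p+q∣≤∣p∣+∣q∣ (s i - s N) (s N) ⟩
    ℚ.∣ s i - s N ∣ + ℚ.∣ s N ∣ ≤⟨ +-monoˡ-≤ ℚ.∣ s N ∣ (p hi ℕₚ.≤-refl) ⟩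
    1ℚ + ℚ.∣ s N ∣ ∎

  mul-mono : ∀ {p q r s} → 0ℚ ≤ p → 0ℚ ≤ s → p ≤ q → r ≤ s → p * r ≤ q * s
  mul-mono {p} {q} {r} {s} 0≤p 0≤s p≤q r≤s = begin
    p * r ≤⟨ *-monoˡ-≤-nonNeg p {{nonNegative 0≤p}} r≤s ⟩
    p * s ≤⟨ *-monoʳ-≤-nonNeg s {{nonNegative 0≤s}} p≤q ⟩
    q * s ∎

  -- a positive amount by which any quantity bounded by B may be multiplied while staying below δ
  shrink : ∀ {B δ} → 0ℚ < B → 0ℚ < δ → ∃[ η ] 0ℚ < η × B * η ≡ δ
  shrink {B} {δ} 0<B 0<δ = δ * B⁻¹
    , positive⁻¹ _ {{pos*pos⇒pos δ {{positive 0<δ}} B⁻¹ {{1/pos⇒pos B {{positive 0<B}}}}}}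
    , trans (mul-swap B δ B⁻¹)
            (trans (cong (δ *_) (*-inverseʳ B {{B≢0}})) (*-identityʳ δ))
    where
    B≢0 = pos⇒nonZero B {{positive 0<B}}
    B⁻¹ = (1/ B) {{B≢0}}

  product-close : ∀ {a b c d A B α β δ} → 0ℚ < α → 0ℚ < β →
                  ℚ.∣ a ∣ ≤ A → ℚ.∣ d ∣ ≤ B → ℚ.∣ b - d ∣ ≤ α → ℚ.∣ a - c ∣ ≤ β →
                  A * α ≡ ½ * δ → B * β ≡ ½ * δ → ℚ.∣ a * b - c * d ∣ ≤ δ
  product-close {a} {b} {c} {d} {A} {B} {α} {β} {δ} 0<α 0<β a≤ d≤ bd ac Aα Bβ = begin
    ℚ.∣ a * b - c * d ∣
      ≡⟨ cong ℚ.∣_∣ (prod-diff a b c d) ⟩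
    ℚ.∣ a * (b - d) + d * (a - c) ∣
      ≤⟨ ∣p+q∣≤∣p∣+∣q∣ (a * (b - d)) (d * (a - c)) ⟩
    ℚ.∣ a * (b - d) ∣ + ℚ.∣ d * (a - c) ∣
      ≡⟨ cong₂ _+_ (∣p*q∣≡∣p∣*∣q∣ a (b - d)) (∣p*q∣≡∣p∣*∣q∣ d (a - c)) ⟩
    ℚ.∣ a ∣ * ℚ.∣ b - d ∣ + ℚ.∣ d ∣ * ℚ.∣ a - c ∣
      ≤⟨ +-mono-≤ (mul-mono (0≤∣p∣ a) (<⇒≤ 0<α) a≤ bd) (mul-mono (0≤∣p∣ d) (<⇒≤ 0<β) d≤ ac) ⟩
    A * α + B * β ≡⟨ cong₂ _+_ Aα Bβ ⟩
    ½ * δ + ½ * δ ≡⟨ half+half δ ⟩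
    δ ∎

  *-cauchy : ∀ {s t} → Cauchy s → Cauchy t → Cauchy (λ i → s i * t i)
  *-cauchy {s} {t} cs ct {δ} 0<δ =
    let A , 0<A , Ns , bs = eventually-bounded {s} cs
        B , 0<B , Nt , bt = eventually-bounded {t} ct
        α , 0<α , Aα = shrink 0<A (half-pos 0<δ)
        β , 0<β , Bβ = shrink 0<B (half-pos 0<δ)
        M , p = cs 0<β
        N , q = ct 0<α
        L₁ = Ns ℕ.⊔ Nt
        L₂ = M ℕ.⊔ N
        ≥Ns = λ {i} (h : L₁ ℕ.⊔ L₂ ℕ.≤ i) → ℕₚ.m⊔n≤o⇒m≤o Ns Nt (ℕₚ.m⊔n≤o⇒m≤o L₁ L₂ h)
        ≥Nt = λ {i} (h : L₁ ℕ.⊔ L₂ ℕ.≤ i) → ℕₚ.m⊔n≤o⇒n≤o Ns Nt (ℕₚ.m⊔n≤o⇒m≤o L₁ L₂ h)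
        ≥M  = λ {i} (h : L₁ ℕ.⊔ L₂ ℕ.≤ i) → ℕₚ.m⊔n≤o⇒m≤o M N (ℕₚ.m⊔n≤o⇒n≤o L₁ L₂ h)
        ≥N  = λ {i} (h : L₁ ℕ.⊔ L₂ ℕ.≤ i) → ℕₚ.m⊔n≤o⇒n≤o M N (ℕₚ.m⊔n≤o⇒n≤o L₁ L₂ h)
    in L₁ ℕ.⊔ L₂ , λ {i} {j} hi hj →
       product-close {s i} {t i} {s j} {t j} 0<α 0<β
         (bs (≥Ns hi)) (bt (≥Nt hj)) (q (≥N hi) (≥N hj)) (p (≥M hi) (≥M hj)) Aα Bβ

-- Real numbers are Cauchy sequences of rationals (with a modulus of convergence);
-- the order relations below compare limits, and equality of x and y is
-- x ≤ℝ y together with y ≤ℝ x.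
record ℝ : Set where
  constructor mkℝ
  field
    seq    : ℕ → ℚ
    cauchy : Cauchy seq
open ℝ public

infix  4 _≤ℝ_ _<ℝ_
infixl 6 _+ℝ_ _-ℝ_
infixl 7 _*ℝ_
infixr 8 -ℝ_ _^ℝ_

_≤ℝ_ : ℝ → ℝ → Set
x ≤ℝ y = ∀ {δ} → 0ℚ < δ → Eventually (λ i → seq x i ≤ seq y i + δ)

_<ℝ_ : ℝ → ℝ → Set
x <ℝ y = ∃[ δ ] 0ℚ < δ × Eventually (λ i → seq x i + δ ≤ seq y i)

fromℚ : ℚ → ℝ
fromℚ q = mkℝ (λ _ → q) (const-cauchy q)

fromℕ : ℕ → ℝ
fromℕ n = fromℚ (+ n / 1)

_+ℝ_ : ℝ → ℝ → ℝ
x +ℝ y = mkℝ (λ i → seq x i + seq y i) (+-cauchy {seq x} {seq y} (cauchy x) (cauchy y))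

-ℝ_ : ℝ → ℝ
-ℝ x = mkℝ (λ i → - seq x i) (neg-cauchy {seq x} (cauchy x))

_-ℝ_ : ℝ → ℝ → ℝ
x -ℝ y = x +ℝ (-ℝ y)

_*ℝ_ : ℝ → ℝ → ℝ
x *ℝ y = mkℝ (λ i → seq x i * seq y i) (*-cauchy {seq x} {seq y} (cauchy x) (cauchy y))

_^ℝ_ : ℝ → ℕ → ℝ
x ^ℝ zero  = fromℕ 1
x ^ℝ suc k = x *ℝ x ^ℝ k

-- expTerm q i = qⁱ / i!
expTerm : ℚ → ℕ → ℚ
expTerm q zero    = 1ℚ
expTerm q (suc i) = expTerm q i * (q * (+ 1 / suc i))

-- expSum q k = Σ_{i ≤ k} qⁱ / i!
expSum : ℚ → ℕ → ℚ
expSum q zero    = 1ℚ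
expSum q (suc k) = expSum q k + expTerm q (suc k)

module _ where
  open ≤-Reasoning

  ≤-numerator : ∀ p {i} → ℤ.∣ ℚ.↥ p ∣ ℕ.≤ i → p ≤ + suc i / 1
  ≤-numerator p@(mkℚ n d _) {i} h = toℚᵘ-cancel-≤ (ℚᵘₚ.≤-trans
    (ℚᵘ.*≤* (subst₂ ℤ._≤_ (sym (ℤₚ.*-identityʳ n)) (ℤₚ.pos-* (suc i) (suc d))
      (ℤₚ.≤-trans (i≤∣i∣ n) (ℤ.+≤+
        (ℕₚ.≤-trans h (ℕₚ.≤-trans (ℕₚ.n≤1+n i) (ℕₚ.m≤m*n (suc i) (suc d))))))))
    (ℚᵘₚ.≤-reflexive (ℚᵘₚ.≃-sym (toℚᵘ-fromℚᵘ (ℚᵘ.mkℚᵘ (+ suc i) 0)))))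
    where
    i≤∣i∣ : ∀ a → a ℤ.≤ + ℤ.∣ a ∣
    i≤∣i∣ (+ n) = ℤₚ.≤-refl
    i≤∣i∣ ℤ.-[1+ n ] = ℤ.-≤+

  suc*1/suc : ∀ i → (+ suc i / 1) * (+ 1 / suc i) ≡ 1ℚ
  suc*1/suc i = toℚᵘ-injective (ℚᵘₚ.≃-trans (toℚᵘ-homo-* (+ suc i / 1) (+ 1 / suc i))
    (ℚᵘₚ.≃-trans
      (ℚᵘₚ.*-cong (toℚᵘ-fromℚᵘ (ℚᵘ.mkℚᵘ (+ suc i) 0)) (toℚᵘ-fromℚᵘ (ℚᵘ.mkℚᵘ (+ 1) i)))
      (ℚᵘ.*≡* (trans (ℤₚ.*-identityʳ _)
        (trans (ℤₚ.*-identityʳ (+ suc i))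
          (sym (trans (ℤₚ.*-identityˡ _) (ℤₚ.*-identityˡ (+ suc i)))))))))

  archimedean : ∀ p → ∃[ b ] (∀ {i} → b ℕ.≤ i → p * (+ 1 / suc i) ≤ 1ℚ)
  archimedean p = ℤ.∣ ℚ.↥ p ∣ , λ {i} b≤i → begin
    p * (+ 1 / suc i)
      ≤⟨ *-monoʳ-≤-nonNeg (+ 1 / suc i) {{normalize-nonNeg 1 (suc i)}} (≤-numerator p b≤i) ⟩
    (+ suc i / 1) * (+ 1 / suc i) ≡⟨ suc*1/suc i ⟩
    1ℚ                            ∎

  1/suc>0 : ∀ i → 0ℚ < + 1 / suc i
  1/suc>0 i = positive⁻¹ (+ 1 / suc i) {{normalize-pos 1 (suc i)}}

  term-nonNeg : ∀ {B} → 0ℚ ≤ B → ∀ i → 0ℚ ≤ expTerm B i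
  term-nonNeg 0≤B zero    = nonNegative⁻¹ 1ℚ
  term-nonNeg {B} 0≤B (suc i) = *-nonNeg (expTerm B i) (B * (+ 1 / suc i))
    (term-nonNeg 0≤B i) (*-nonNeg B (+ 1 / suc i) 0≤B (<⇒≤ (1/suc>0 i)))

  term-bound : ∀ {q B} → ℚ.∣ q ∣ ≤ B → ∀ i → ℚ.∣ expTerm q i ∣ ≤ expTerm B i
  term-bound h zero = ≤-refl
  term-bound {q} {B} h (suc i) = begin
    ℚ.∣ expTerm q i * (q * r) ∣
      ≡⟨ trans (∣p*q∣≡∣p∣*∣q∣ (expTerm q i) (q * r)) (cong (ℚ.∣ expTerm q i ∣ *_) (∣p*q∣≡∣p∣*∣q∣ q r)) ⟩
    ℚ.∣ expTerm q i ∣ * (ℚ.∣ q ∣ * ℚ.∣ r ∣)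
      ≡⟨ cong (λ z → ℚ.∣ expTerm q i ∣ * (ℚ.∣ q ∣ * z)) (0≤p⇒∣p∣≡p (<⇒≤ (1/suc>0 i))) ⟩
    ℚ.∣ expTerm q i ∣ * (ℚ.∣ q ∣ * r)
      ≤⟨ mul-mono (0≤∣p∣ (expTerm q i))
           (*-nonNeg B r (≤-trans (0≤∣p∣ q) h) (<⇒≤ (1/suc>0 i)))
           (term-bound h i) (*-monoʳ-≤-nonNeg r {{nonNegative (<⇒≤ (1/suc>0 i))}} h) ⟩
    expTerm B i * (B * r) ∎
    where
    r = + 1 / suc i

  -- beyond K the terms at least halve, so the tail after i is at most the i-th term
  tail-bound : ∀ {q B K} → ℚ.∣ q ∣ ≤ B →
               (∀ {i} → K ℕ.≤ i → expTerm B (suc i) ≤ ½ * expTerm B i) →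
               ∀ {i} → K ℕ.≤ i → ∀ d →
               ℚ.∣ expSum q (d ℕ.+ i) - expSum q i ∣ ≤ expTerm B i - expTerm B (d ℕ.+ i)
  tail-bound {q} {B} h halve {i} K≤i zero = ≤-reflexive
    (trans (cong ℚ.∣_∣ (+-inverseʳ (expSum q i))) (sym (+-inverseʳ (expTerm B i))))
  tail-bound {q} {B} h halve {i} K≤i (suc d) = begin
    ℚ.∣ (S + t) - S₀ ∣
      ≡⟨ cong ℚ.∣_∣ (add-diff S t S₀) ⟩
    ℚ.∣ (S - S₀) + t ∣          ≤⟨ ∣p+q∣≤∣p∣+∣q∣ (S - S₀) t ⟩
    ℚ.∣ S - S₀ ∣ + ℚ.∣ t ∣      ≤⟨ +-mono-≤ (tail-bound h halve K≤i d) (term-bound h (suc n)) ⟩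
    (T₀ - T) + T′               ≡⟨ telescope₁ T₀ T T′ ⟩
    (T′ + T′) + (T₀ - T - T′)   ≤⟨ +-monoˡ-≤ (T₀ - T - T′) (+-mono-≤ T′≤ T′≤) ⟩
    (½ * T + ½ * T) + (T₀ - T - T′) ≡⟨ cong (_+ (T₀ - T - T′)) (half+half T) ⟩
    T + (T₀ - T - T′)           ≡⟨ telescope₂ T₀ T T′ ⟩
    T₀ - T′                     ∎
    where
    n = d ℕ.+ i
    S = expSum q n
    S₀ = expSum q i
    t = expTerm q (suc n)
    T₀ = expTerm B i
    T = expTerm B n
    T′ = expTerm B (suc n)
    T′≤ = halve (ℕₚ.≤-trans K≤i (ℕₚ.m≤n+m i d))

  halving : ∀ {B} → 0ℚ < B → ∃[ K ] (∀ {i} → K ℕ.≤ i → expTerm B (suc i) ≤ ½ * expTerm B i)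
  halving {B} 0<B with archimedean (B + B)
  ... | K , a = K , λ {i} h → let T = expTerm B i ; r = + 1 / suc i in begin
    T * (B * r)                ≡⟨ sym (half+half (T * (B * r))) ⟩
    ½ * (T * (B * r)) + ½ * (T * (B * r))
      ≡⟨ halves ½ T B r ⟩
    (½ * T) * ((B + B) * r)
      ≤⟨ *-monoˡ-≤-nonNeg (½ * T) {{nonNegative (*-nonNeg ½ T (nonNegative⁻¹ ½) (term-nonNeg (<⇒≤ 0<B) i))}} (a h) ⟩
    (½ * T) * 1ℚ               ≡⟨ *-identityʳ (½ * T) ⟩
    ½ * T                      ∎

  term-decreasing : ∀ {B K} → 0ℚ < B →
                    (∀ {i} → K ℕ.≤ i → expTerm B (suc i) ≤ ½ * expTerm B i) →
                    ∀ d → expTerm B (d ℕ.+ K) ≤ expTerm B K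
  term-decreasing 0<B halve zero = ≤-refl
  term-decreasing {B} {K} 0<B halve (suc d) = let T = expTerm B (d ℕ.+ K) in begin
    expTerm B (suc (d ℕ.+ K)) ≤⟨ halve (ℕₚ.m≤n+m K d) ⟩
    ½ * T                     ≡⟨ sym (+-identityʳ (½ * T)) ⟩
    ½ * T + 0ℚ                ≤⟨ +-monoʳ-≤ (½ * T) (*-nonNeg ½ T
                                   (nonNegative⁻¹ ½) (term-nonNeg (<⇒≤ 0<B) (d ℕ.+ K))) ⟩
    ½ * T + ½ * T             ≡⟨ half+half T ⟩
    T                         ≤⟨ term-decreasing 0<B halve d ⟩
    expTerm B K               ∎

  term-step : ∀ {B T t δ δ⁻¹ r} → 0ℚ < B → 0ℚ < r → 0ℚ < δ → t ≤ T → δ * δ⁻¹ ≡ 1ℚ →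
              ((T * B) * δ⁻¹) * r ≤ 1ℚ → t * (B * r) ≤ δ
  term-step {B} {T} {t} {δ} {δ⁻¹} {r} 0<B 0<r 0<δ t≤T inv small = begin
    t * (B * r)
      ≤⟨ *-monoʳ-≤-nonNeg (B * r) {{nonNegative (*-nonNeg B r (<⇒≤ 0<B) (<⇒≤ 0<r))}} t≤T ⟩
    T * (B * r)              ≡⟨ sym (*-assoc T B r) ⟩
    (T * B) * r              ≡⟨ sym (*-identityˡ ((T * B) * r)) ⟩
    1ℚ * ((T * B) * r)       ≡⟨ cong (_* ((T * B) * r)) (sym inv) ⟩
    (δ * δ⁻¹) * ((T * B) * r) ≡⟨ mul-rearrange δ δ⁻¹ (T * B) r ⟩
    δ * (((T * B) * δ⁻¹) * r) ≤⟨ *-monoˡ-≤-nonNeg δ {{nonNegative (<⇒≤ 0<δ)}} small ⟩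
    δ * 1ℚ                   ≡⟨ *-identityʳ δ ⟩
    δ                        ∎

  term-small : ∀ {B δ} → 0ℚ < B → 0ℚ < δ → Eventually (λ i → expTerm B i ≤ δ)
  term-small {B} {δ} 0<B 0<δ =
    let K , halve = halving 0<B
        δ⁻¹ , _ , inv = shrink 0<δ (positive⁻¹ 1ℚ)
        M , a = archimedean ((expTerm B K * B) * δ⁻¹)
    in suc (K ℕ.⊔ M) , λ { {suc i} (s≤s h) →
       term-step 0<B (1/suc>0 i) 0<δ
         (subst (λ j → expTerm B j ≤ expTerm B K) (ℕₚ.m∸n+n≡m (ℕₚ.m⊔n≤o⇒m≤o K M h))
           (term-decreasing 0<B halve (i ∸ K)))
         inv (a (ℕₚ.m⊔n≤o⇒n≤o K M h)) }

  expTerm-cauchy : ∀ {s} → Cauchy s → ∀ k → Cauchy (λ i → expTerm (s i) k)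
  expTerm-cauchy cs zero    = const-cauchy 1ℚ
  expTerm-cauchy {s} cs (suc k) =
    *-cauchy {λ i → expTerm (s i) k} {λ i → s i * (+ 1 / suc k)} (expTerm-cauchy {s} cs k)
      (*-cauchy {s} {λ _ → + 1 / suc k} cs (const-cauchy (+ 1 / suc k)))

  expSum-cauchy : ∀ {s} → Cauchy s → ∀ k → Cauchy (λ i → expSum (s i) k)
  expSum-cauchy cs zero    = const-cauchy 1ℚ
  expSum-cauchy {s} cs (suc k) =
    +-cauchy {λ i → expSum (s i) k} {λ i → expTerm (s i) (suc k)}
      (expSum-cauchy {s} cs k) (expTerm-cauchy {s} cs (suc k))

  three-way : ∀ {a b c d δ} → ℚ.∣ a - b ∣ ≤ ½ * (½ * δ) → ℚ.∣ b - c ∣ ≤ ½ * δ →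
              ℚ.∣ d - c ∣ ≤ ½ * (½ * δ) → ℚ.∣ a - d ∣ ≤ δ
  three-way {a} {b} {c} {d} {δ} ab bc dc = begin
    ℚ.∣ a - d ∣
      ≡⟨ cong ℚ.∣_∣ (split₃ a b c d) ⟩
    ℚ.∣ (a - b) + ((b - c) + (c - d)) ∣
      ≤⟨ ≤-trans (∣p+q∣≤∣p∣+∣q∣ (a - b) ((b - c) + (c - d)))
           (+-monoʳ-≤ ℚ.∣ a - b ∣ (∣p+q∣≤∣p∣+∣q∣ (b - c) (c - d))) ⟩
    ℚ.∣ a - b ∣ + (ℚ.∣ b - c ∣ + ℚ.∣ c - d ∣)
      ≤⟨ +-mono-≤ ab (+-mono-≤ bc (≤-trans (≤-reflexive (∣∣-swap c d)) dc)) ⟩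
    ½ * (½ * δ) + (½ * δ + ½ * (½ * δ)) ≡⟨ add-rearrange (½ * (½ * δ)) (½ * δ) ⟩
    (½ * (½ * δ) + ½ * (½ * δ)) + ½ * δ ≡⟨ cong (_+ ½ * δ) (half+half (½ * δ)) ⟩
    ½ * δ + ½ * δ                       ≡⟨ half+half δ ⟩
    δ ∎

  expSum-tail : ∀ {B δ} → 0ℚ < B → 0ℚ < δ →
                ∃[ K ] (∀ {q} → ℚ.∣ q ∣ ≤ B → ∀ {i} → K ℕ.≤ i → ℚ.∣ expSum q i - expSum q K ∣ ≤ δ)
  expSum-tail {B} {δ} 0<B 0<δ =
    let H , halve = halving 0<B
        L , small = term-small 0<B 0<δ
        K = H ℕ.⊔ L
    in K , λ {q} q≤B {i} K≤i → begin
      ℚ.∣ expSum q i - expSum q K ∣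
        ≤⟨ subst (λ n → ℚ.∣ expSum q n - expSum q K ∣ ≤ expTerm B K - expTerm B n)
             (ℕₚ.m∸n+n≡m K≤i) (tail-bound q≤B halve (ℕₚ.m≤m⊔n H L) (i ∸ K)) ⟩
      expTerm B K - expTerm B i
        ≤⟨ +-monoʳ-≤ (expTerm B K) (neg-antimono-≤ (term-nonNeg (<⇒≤ 0<B) i)) ⟩
      expTerm B K + 0ℚ ≡⟨ +-identityʳ (expTerm B K) ⟩
      expTerm B K      ≤⟨ small (ℕₚ.m≤n⊔m H L) ⟩
      δ                ∎

  exp-cauchy : ∀ {s} → Cauchy s → Cauchy (λ i → expSum (s i) i)
  exp-cauchy {s} cs {δ} 0<δ =
    let B , 0<B , N , bnd = eventually-bounded {s} cs
        K , tail = expSum-tail 0<B (half-pos (half-pos 0<δ))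
        M , close = expSum-cauchy {s} cs K (half-pos 0<δ)
        ≥N = λ {i} (h : N ℕ.⊔ (K ℕ.⊔ M) ℕ.≤ i) → ℕₚ.m⊔n≤o⇒m≤o N (K ℕ.⊔ M) h
        ≥K = λ {i} (h : N ℕ.⊔ (K ℕ.⊔ M) ℕ.≤ i) → ℕₚ.m⊔n≤o⇒m≤o K M (ℕₚ.m⊔n≤o⇒n≤o N (K ℕ.⊔ M) h)
        ≥M = λ {i} (h : N ℕ.⊔ (K ℕ.⊔ M) ℕ.≤ i) → ℕₚ.m⊔n≤o⇒n≤o K M (ℕₚ.m⊔n≤o⇒n≤o N (K ℕ.⊔ M) h)
    in N ℕ.⊔ (K ℕ.⊔ M) , λ {i} {j} hi hj →
       three-way {expSum (s i) i} {expSum (s i) K} {expSum (s j) K} {expSum (s j) j}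
         (tail (bnd (≥N hi)) (≥K hi)) (close (≥M hi) (≥M hj)) (tail (bnd (≥N hj)) (≥K hj))

exp : ℝ → ℝ
exp x = mkℝ (λ i → expSum (seq x i) i) (exp-cauchy {seq x} (cauchy x))

-- m = ⌊x⌋ for x ≥ 0; a relation, because the floor of a Cauchy real is not computable
IsFloor : ℝ → ℕ → Set
IsFloor x m = fromℕ m ≤ℝ x × x <ℝ fromℕ (suc m)

infix 4 _⟶0
_⟶0 : (ℕ → ℝ) → Set
u ⟶0 = ∀ {δ} → 0ℚ < δ → Eventually (λ n → fromℚ (- δ) ≤ℝ u n × u n ≤ℝ fromℚ δ)

-- A graph on Fin (suc n) is a graph on the vertices suc i together with the
-- neighbourhood of the vertex zero, so every labelled simple graph has exactly
-- one representation.
data Graph : ℕ → Set where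
  empty  : Graph zero
  extend : ∀ {n} → Subset n → Graph n → Graph (suc n)

Adj : ∀ {n} → Graph n → Fin n → Fin n → Set
Adj (extend N G) zero    zero    = ⊥
Adj (extend N G) zero    (suc j) = j ∈ N
Adj (extend N G) (suc i) zero    = i ∈ N
Adj (extend N G) (suc i) (suc j) = Adj G i j

edges : ∀ {n} → Graph n → ℕ
edges empty        = 0
edges (extend N G) = ∣ N ∣ ℕ.+ edges G

subsets : ∀ n → List (Subset n)
subsets zero    = Vec.[] ∷ []
subsets (suc n) = map (outside Vec.∷_) (subsets n) ++ map (inside Vec.∷_) (subsets n)

graphs : ∀ n → List (Graph n)
graphs zero    = empty ∷ []
graphs (suc n) = cartesianProductWith extend (subsets n) (graphs n)

-- The sample space of the uniform random graph; it lists each graph once.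
𝔾 : ∀ n → ℕ → List (Graph n)
𝔾 n m = filter (λ G → edges G ℕₚ.≟ m) (graphs n)

Reachable : ∀ {n} → Graph n → Fin n → Fin n → Set
Reachable G = Star (Adj G)

IsComponent : ∀ {n} → Graph n → Subset n → Set
IsComponent G S = Nonempty S × (∀ i → i ∈ S → ∀ j → j ∈ S ⇔ Reachable G i j)

-- Reachability in extend N G, in terms of reachability in G.
Via : ∀ {n} → Subset n → Graph n → Fin (suc n) → Fin (suc n) → Set
Via N G zero    zero    = ⊤
Via N G zero    (suc j) = ∃[ a ] (a ∈ N × Reachable G a j)
Via N G (suc i) zero    = ∃[ a ] (a ∈ N × Reachable G i a)
Via N G (suc i) (suc j) = Reachable G i j ⊎ (Via N G (suc i) zero × Via N G zero (suc j))

via-refl : ∀ {n} {N : Subset n} {G} i → Via N G i i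
via-refl zero    = tt
via-refl (suc i) = inj₁ ε

via-step : ∀ {n} {N : Subset n} {G} u w v → Adj (extend N G) u w → Via N G w v → Via N G u v
via-step zero    zero    v       () _
via-step zero    (suc b) zero    b∈N _ = tt
via-step zero    (suc b) (suc j) b∈N (inj₁ r) = b , b∈N , r
via-step zero    (suc b) (suc j) b∈N (inj₂ (_ , r)) = r
via-step (suc i) zero    zero    i∈N _ = i , i∈N , ε
via-step (suc i) zero    (suc j) i∈N r = inj₂ ((i , i∈N , ε) , r)
via-step (suc i) (suc b) zero    e (a , a∈N , r) = a , a∈N , e ◅ r
via-step (suc i) (suc b) (suc j) e (inj₁ r) = inj₁ (e ◅ r)
via-step (suc i) (suc b) (suc j) e (inj₂ ((a , a∈N , r) , r′)) = inj₂ ((a , a∈N , e ◅ r) , r′)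

reachable⇒via : ∀ {n} {N : Subset n} {G u v} → Reachable (extend N G) u v → Via N G u v
reachable⇒via ε       = via-refl _
reachable⇒via (e ◅ r) = via-step _ _ _ e (reachable⇒via r)

via⇒reachable : ∀ {n} {N : Subset n} {G} u v → Via N G u v → Reachable (extend N G) u v
via⇒reachable zero    zero    _ = ε
via⇒reachable zero    (suc j) (a , a∈N , r) = _◅_ {j = suc a} a∈N (gmap suc (λ e → e) r)
via⇒reachable (suc i) zero    (a , a∈N , r) = gmap suc (λ e → e) r ◅◅ (_◅_ {j = zero} a∈N ε)
via⇒reachable (suc i) (suc j) (inj₁ r) = gmap suc (λ e → e) r
via⇒reachable (suc i) (suc j) (inj₂ (p , q)) =
  via⇒reachable (suc i) zero p ◅◅ via⇒reachable zero (suc j) q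

reachable? : ∀ {n} (G : Graph n) i j → Dec (Reachable G i j)
reachable? (extend N G) u v = map′ (via⇒reachable u v) reachable⇒via (via? u v)
  where
  from0 : ∀ j → Dec (∃[ a ] (a ∈ N × Reachable G a j))
  from0 j = any? (λ a → a ∈? N ×-dec reachable? G a j)
  to0 : ∀ i → Dec (∃[ a ] (a ∈ N × Reachable G i a))
  to0 i = any? (λ a → a ∈? N ×-dec reachable? G i a)
  via? : ∀ u v → Dec (Via N G u v)
  via? zero    zero    = yes tt
  via? zero    (suc j) = from0 j
  via? (suc i) zero    = to0 i
  via? (suc i) (suc j) = reachable? G i j ⊎-dec (to0 i ×-dec from0 j)

isComponent? : ∀ {n} (G : Graph n) S → Dec (IsComponent G S)
isComponent? G S = nonempty? S ×-dec all? (λ i → i ∈? S →-dec all? (λ j →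
  map′ (λ (f , g) → mk⇔ f g) (λ e → Equivalence.to e , Equivalence.from e)
    ((j ∈? S →-dec reachable? G i j) ×-dec (reachable? G i j →-dec j ∈? S))))

componentsOfOrder : ∀ {n} → ℕ → Graph n → ℕ
componentsOfOrder {n} k G =
  length (filter (λ S → isComponent? G S ×-dec (∣ S ∣ ℕₚ.≟ k)) (subsets n))

-- Pr[ E ] ≥ p under the uniform distribution on Ω: a sub-event of E with at
-- least p · ∣Ω∣ outcomes is exhibited, so E itself need not be decidable.
Pr[_]from_≥_ : ∀ {A : Set} → (A → Set) → List A → ℚ → Set
Pr[ E ]from Ω ≥ p =
  ∃[ B ] B ⊆ Ω × All E B × p * (+ length Ω / 1) ≤ + length B / 1

-- Pr[ Eₙ ] → 1 (the probabilities never exceed 1)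
AlmostSurely : {A : ℕ → Set} → (∀ n → List (A n)) → (∀ n → A n → Set) → Set
AlmostSurely Ω E =
  ∀ {δ} → 0ℚ < δ → Eventually (λ n → Pr[ E n ]from Ω n ≥ (1ℚ - δ))

-- k^(k-2) / k! · (2c)^(k-1) · e^(-2kc) · n, for k ≥ 1; at k = 1 the truncated
-- exponent is harmless, since 1^(-1) = 1^0.
asymptoticCount : ℝ → ℕ → ℕ → ℝ
asymptoticCount c k n =
  fromℚ (_/_ (+ (k ℕ.^ (k ∸ 2))) (k !) {{ℕₚ._!≢0 k}})
    *ℝ (fromℕ 2 *ℝ c) ^ℝ (k ∸ 1)
    *ℝ exp (-ℝ (fromℕ (2 ℕ.* k) *ℝ c))
    *ℝ fromℕ n

{-# OPTIONS --safe #-}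
-- Chebyshev's inequality for the number X of components of order k. A set S of k vertices is a
-- component exactly when a connected graph sits on S and nothing joins S to the rest, so
-- Σ X = (n choose k) · Σ_H #{graphs on n - k vertices with m - e(H) edges}, over the connected graphs
-- H on k vertices, and Σ X(X - 1) is the same sum over pairs. Divided by n #Ω, the summand of H tends
-- to (2c)^(k-1) e^(-2kc) / k! if H is a tree and to 0 otherwise; Cayley's formula counts the trees.
-- Likewise the pairs, divided by n² #Ω, tend to the square of this limit, so the variance of X/n tends to 0.
module Submission where

open import Defs
open import Data.Product.Base using (∃-syntax; _×_; _,_; proj₁; proj₂)

-- Since c is only a Cauchy sequence, no limit below is a number: each quantity at size n is
-- compared with the n-th rational approximation of its limit, and the asserted constant, as a real,
-- is itself such a sequence. The exponential is given by partial sums, so it has to be reached as a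
-- limit of powers (1 + h)^D, where D is the number of vertex pairs lost when q vertices are
-- deleted: the deletion multiplies the number of graphs with M edges by D factors 1 - M/N with N
-- near n²/2, which two such powers enclose. The same limit yields e^(2y) = (e^y)² and a positive
-- lower bound for e^y, without which an absolute deviation could not be turned into a relative one.
-- Cayley's formula is proved for forests with an arbitrary set of roots, because deleting the root
-- of a tree leaves a forest rooted at its neighbours. The event of Chebyshev's inequality is a
-- decidable one, that the squared deviations of all orders up to κ have a small sum; it is used for
-- each fixed tolerance, and a diagonal choice of tolerances produces ε.

module GraphCounting where

  open import Data.Bool.Base using (true; false)
  import Data.Bool.Properties as Bool
  open import Data.Empty using (⊥-elim)
  open import Data.Fin.Base using (Fin; zero; suc)
  open import Data.Fin.Properties using (any?; all?)
  import Data.Fin.Properties as Fin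
  open import Data.Fin.Subset using (Subset; inside; outside; _∈_; _∉_; _⊆_; Nonempty; ∣_∣; _∪_; ∁; ⊥)
  open import Data.Fin.Subset.Properties using (_∈?_; nonempty?; x∈p∪q⁺; x∈p∪q⁻;
    ∣∁p∣≡n∸∣p∣; ∣p∣≤n; ⊆-antisym; x∈∁p⇒x∉p; x∉p⇒x∈∁p; drop-∷-⊆; ∣⊥∣≡0; ∉⊥)
  open import Data.List.Base using (List; []; _∷_; map; _++_; filter; length; cartesianProductWith)
  import Data.List.Relation.Unary.All as All
  open import Data.List.Relation.Unary.All using (All)
  import Data.List.Relation.Unary.All.Properties as All
  open import Data.Nat.Base hiding (_⊔_)
  open import Data.Nat.Properties
  open import Data.Nat.Tactic.RingSolver using (solve-∀)
  open import Data.Sum.Base using (inj₁; inj₂)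
  open import Data.Vec.Base using ([]; _∷_; here; there)
  open import Data.Vec.Properties using (≡-dec)
  open import Function.Base using (_∘_; id)
  open import Function.Bundles using (Equivalence; mk⇔)
  open import Relation.Binary.Construct.Closure.ReflexiveTransitive using (gmap; reverse; ε; _◅_; _◅◅_)
  open import Relation.Binary.PropositionalEquality
  open import Relation.Nullary using (Dec; yes; no; ¬_)
  open import Relation.Nullary.Decidable using (_×-dec_; ¬?)

  -- Sums over subsets and graphs

  private variable
    A C : Set
    P Q : Set

  ∑ : List A → (A → ℕ) → ℕ
  ∑ []       f = 0
  ∑ (x ∷ xs) f = f x + ∑ xs f

  𝟙 : Dec P → ℕ
  𝟙 (yes _) = 1
  𝟙 (no _)  = 0

  𝟙-yes : (p? : Dec P) → P → 𝟙 p? ≡ 1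
  𝟙-yes (yes _) _ = refl
  𝟙-yes (no ¬p) p = ⊥-elim (¬p p)

  𝟙-no : (p? : Dec P) → ¬ P → 𝟙 p? ≡ 0
  𝟙-no (yes p) ¬p = ⊥-elim (¬p p)
  𝟙-no (no _)  _  = refl

  𝟙-mono : (p? : Dec P) (q? : Dec Q) → (P → Q) → 𝟙 p? ≤ 𝟙 q?
  𝟙-mono (yes p) q? f = ≤-reflexive (sym (𝟙-yes q? (f p)))
  𝟙-mono (no _)  q? f = z≤n

  𝟙-cong : (p? : Dec P) (q? : Dec Q) → (P → Q) → (Q → P) → 𝟙 p? ≡ 𝟙 q?
  𝟙-cong p? q? f g = ≤-antisym (𝟙-mono p? q? f) (𝟙-mono q? p? g)

  𝟙-× : (p? : Dec P) (q? : Dec Q) → 𝟙 (p? ×-dec q?) ≡ 𝟙 p? * 𝟙 q?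
  𝟙-× (yes p) (yes q) = refl
  𝟙-× (yes p) (no ¬q) = refl
  𝟙-× (no ¬p) q?      = refl

  𝟙-*-cong : (p? : Dec P) {x y : ℕ} → (P → x ≡ y) → 𝟙 p? * x ≡ 𝟙 p? * y
  𝟙-*-cong (yes p) h = cong (1 *_) (h p)
  𝟙-*-cong (no _)  h = refl

  𝟙-*-mono : (p? : Dec P) {x y : ℕ} → (P → x ≤ y) → 𝟙 p? * x ≤ 𝟙 p? * y
  𝟙-*-mono (yes p) h = *-monoʳ-≤ 1 (h p)
  𝟙-*-mono (no _)  h = z≤n

  ∑-cong : (xs : List A) {f g : A → ℕ} → (∀ x → f x ≡ g x) → ∑ xs f ≡ ∑ xs g
  ∑-cong []       h = refl
  ∑-cong (x ∷ xs) h = cong₂ _+_ (h x) (∑-cong xs h)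

  ∑-mono : (xs : List A) {f g : A → ℕ} → (∀ x → f x ≤ g x) → ∑ xs f ≤ ∑ xs g
  ∑-mono []       h = z≤n
  ∑-mono (x ∷ xs) h = +-mono-≤ (h x) (∑-mono xs h)

  ∑-zero : (xs : List A) {f : A → ℕ} → (∀ x → f x ≡ 0) → ∑ xs f ≡ 0
  ∑-zero []       h = refl
  ∑-zero (x ∷ xs) h = cong₂ _+_ (h x) (∑-zero xs h)

  ∑-++ : (xs ys : List A) (f : A → ℕ) → ∑ (xs ++ ys) f ≡ ∑ xs f + ∑ ys f
  ∑-++ []       ys f = refl
  ∑-++ (x ∷ xs) ys f = trans (cong (f x +_) (∑-++ xs ys f)) (sym (+-assoc (f x) _ _))

  ∑-map : (g : A → C) (xs : List A) (f : C → ℕ) → ∑ (map g xs) f ≡ ∑ xs (f ∘ g)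
  ∑-map g []       f = refl
  ∑-map g (x ∷ xs) f = cong (f (g x) +_) (∑-map g xs f)

  ∑-+ : (xs : List A) (f g : A → ℕ) → ∑ xs (λ x → f x + g x) ≡ ∑ xs f + ∑ xs g
  ∑-+ []       f g = refl
  ∑-+ (x ∷ xs) f g = trans (cong (f x + g x +_) (∑-+ xs f g)) (swap (f x) (g x) _ _)
    where
    swap : ∀ a b c d → a + b + (c + d) ≡ a + c + (b + d)
    swap = solve-∀

  ∑-*ˡ : (xs : List A) (c : ℕ) (f : A → ℕ) → ∑ xs (λ x → c * f x) ≡ c * ∑ xs f
  ∑-*ˡ []       c f = sym (*-zeroʳ c)
  ∑-*ˡ (x ∷ xs) c f = trans (cong (c * f x +_) (∑-*ˡ xs c f)) (sym (*-distribˡ-+ c (f x) _))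

  ∑-*ʳ : (xs : List A) (c : ℕ) (f : A → ℕ) → ∑ xs (λ x → f x * c) ≡ ∑ xs f * c
  ∑-*ʳ xs c f = trans (∑-cong xs (λ x → *-comm (f x) c)) (trans (∑-*ˡ xs c f) (*-comm c _))

  ∑-swap : (xs : List A) (ys : List C) (f : A → C → ℕ) →
           ∑ xs (λ x → ∑ ys (f x)) ≡ ∑ ys (λ y → ∑ xs (λ x → f x y))
  ∑-swap []       ys f = sym (∑-zero ys (λ _ → refl))
  ∑-swap (x ∷ xs) ys f = trans (cong (∑ ys (f x) +_) (∑-swap xs ys f)) (sym (∑-+ ys (f x) _))

  ∑-filter : {P : A → Set} (P? : ∀ x → Dec (P x)) (xs : List A) (f : A → ℕ) →
             ∑ (filter P? xs) f ≡ ∑ xs (λ x → 𝟙 (P? x) * f x)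
  ∑-filter P? []       f = refl
  ∑-filter P? (x ∷ xs) f with P? x
  ... | yes _ = cong₂ _+_ (sym (+-identityʳ (f x))) (∑-filter P? xs f)
  ... | no _  = ∑-filter P? xs f

  length≡∑ : (xs : List A) → length xs ≡ ∑ xs (λ _ → 1)
  length≡∑ []       = refl
  length≡∑ (x ∷ xs) = cong suc (length≡∑ xs)

  length-filter≡∑ : {P : A → Set} (P? : ∀ x → Dec (P x)) (xs : List A) →
                    length (filter P? xs) ≡ ∑ xs (λ x → 𝟙 (P? x))
  length-filter≡∑ P? xs = trans (length≡∑ (filter P? xs))
    (trans (∑-filter P? xs _) (∑-cong xs (λ x → *-identityʳ _)))

  ∑-subsets : ∀ n (f : Subset (suc n) → ℕ) →
              ∑ (subsets (suc n)) f ≡ ∑ (subsets n) (f ∘ (outside ∷_)) + ∑ (subsets n) (f ∘ (inside ∷_))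
  ∑-subsets n f = trans (∑-++ (map (outside ∷_) (subsets n)) _ f)
    (cong₂ _+_ (∑-map _ (subsets n) f) (∑-map _ (subsets n) f))

  ∑-cartesianProductWith : {D : Set} (g : A → C → D) (xs : List A) (ys : List C) (f : D → ℕ) →
                           ∑ (cartesianProductWith g xs ys) f ≡ ∑ xs (λ x → ∑ ys (λ y → f (g x y)))
  ∑-cartesianProductWith g []       ys f = refl
  ∑-cartesianProductWith g (x ∷ xs) ys f = trans (∑-++ (map (g x) ys) _ f)
    (cong₂ _+_ (∑-map (g x) ys f) (∑-cartesianProductWith g xs ys f))

  ∑-graphs : ∀ n (f : Graph (suc n) → ℕ) →
             ∑ (graphs (suc n)) f ≡ ∑ (subsets n) (λ N → ∑ (graphs n) (λ G → f (extend N G)))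
  ∑-graphs n f = ∑-cartesianProductWith extend (subsets n) (graphs n) f

  -- Σ_{i ≤ r} (r choose i) f i
  binomialSum : ℕ → (ℕ → ℕ) → ℕ
  binomialSum zero    f = f 0
  binomialSum (suc r) f = binomialSum r f + binomialSum r (f ∘ suc)

  binomialSum-cong : ∀ r {f g} → (∀ {i} → i ≤ r → f i ≡ g i) → binomialSum r f ≡ binomialSum r g
  binomialSum-cong zero    h = h z≤n
  binomialSum-cong (suc r) h =
    cong₂ _+_ (binomialSum-cong r (λ i≤r → h (≤-trans i≤r (n≤1+n r)))) (binomialSum-cong r (h ∘ s≤s))

  binomialSum-*ˡ : ∀ r c f → binomialSum r (λ i → c * f i) ≡ c * binomialSum r f
  binomialSum-*ˡ zero    c f = refl
  binomialSum-*ˡ (suc r) c f =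
    trans (cong₂ _+_ (binomialSum-*ˡ r c f) (binomialSum-*ˡ r c (f ∘ suc))) (sym (*-distribˡ-+ c _ _))

  -- Vandermonde's convolution. In `∑-edges` it merges the pairs at vertex zero with the pairs of
  -- the remaining graph into one pool.
  binomialSum-+ : ∀ a b f → binomialSum (a + b) f ≡ binomialSum a (λ i → binomialSum b (λ j → f (i + j)))
  binomialSum-+ zero    b f = refl
  binomialSum-+ (suc a) b f = cong₂ _+_ (binomialSum-+ a b f) (binomialSum-+ a b (f ∘ suc))

  ∑-size : ∀ n (f : ℕ → ℕ) → ∑ (subsets n) (λ S → f ∣ S ∣) ≡ binomialSum n f
  ∑-size zero    f = +-identityʳ (f 0)
  ∑-size (suc n) f = trans (∑-subsets n (λ S → f ∣ S ∣)) (cong₂ _+_ (∑-size n f) (∑-size n (f ∘ suc)))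

  -- n(n - 1)/2, the number of pairs of vertices; the recursion follows `extend`, whose new vertex
  -- has n possible neighbours.
  tri : ℕ → ℕ
  tri zero    = 0
  tri (suc n) = n + tri n

  ∑-edges : ∀ n (f : ℕ → ℕ) → ∑ (graphs n) (f ∘ edges) ≡ binomialSum (tri n) f
  ∑-edges zero    f = +-identityʳ (f 0)
  ∑-edges (suc n) f = begin
    ∑ (graphs (suc n)) (f ∘ edges)
      ≡⟨ ∑-graphs n (f ∘ edges) ⟩
    ∑ (subsets n) (λ N → ∑ (graphs n) (λ G → f (∣ N ∣ + edges G)))
      ≡⟨ ∑-cong (subsets n) (λ N → ∑-edges n (λ j → f (∣ N ∣ + j))) ⟩
    ∑ (subsets n) (λ N → binomialSum (tri n) (λ j → f (∣ N ∣ + j)))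
      ≡⟨ ∑-size n (λ i → binomialSum (tri n) (λ j → f (i + j))) ⟩
    binomialSum n (λ i → binomialSum (tri n) (λ j → f (i + j)))
      ≡⟨ sym (binomialSum-+ n (tri n) f) ⟩
    binomialSum (n + tri n) f ∎
    where open ≡-Reasoning

  -- Binomial coefficients

  choose : ℕ → ℕ → ℕ
  choose n       zero    = 1
  choose zero    (suc k) = 0
  choose (suc n) (suc k) = choose n k + choose n (suc k)

  binomialSum-≟ : ∀ n m → binomialSum n (λ i → 𝟙 (i ≟ m)) ≡ choose n m
  binomialSum-≟ zero    zero    = refl
  binomialSum-≟ zero    (suc m) = refl
  binomialSum-≟ (suc n) zero    =
    cong₂ _+_ (binomialSum-≟ n 0) (trans (binomialSum-cong n (λ {i} _ → 𝟙-no (suc i ≟ 0) (λ ()))) (const-0 n))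
    where
    const-0 : ∀ n → binomialSum n (λ _ → 0) ≡ 0
    const-0 zero    = refl
    const-0 (suc n) = cong₂ _+_ (const-0 n) (const-0 n)
  binomialSum-≟ (suc n) (suc m) = trans (+-comm (binomialSum n (λ i → 𝟙 (i ≟ suc m))) _) (cong₂ _+_
    (trans (binomialSum-cong n (λ {i} _ → 𝟙-cong (suc i ≟ suc m) (i ≟ m) suc-injective (cong suc))) (binomialSum-≟ n m))
    (binomialSum-≟ n (suc m)))

  choose-> : ∀ {n k} → n < k → choose n k ≡ 0
  choose-> {zero}  {suc k} _       = refl
  choose-> {suc n} {suc k} (s≤s h) = cong₂ _+_ (choose-> h) (choose-> (≤-trans h (n≤1+n k)))

  choose>0 : ∀ {n k} → k ≤ n → 0 < choose n k
  choose>0 {n}     {zero}  _       = s≤s z≤n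
  choose>0 {suc n} {suc k} (s≤s h) = ≤-trans (choose>0 h) (m≤m+n _ _)

  choose-absorb : ∀ n k → suc k * choose (suc n) (suc k) ≡ suc n * choose n k
  choose-absorb zero    zero    = refl
  choose-absorb zero    (suc k) = *-zeroʳ (suc (suc k))
  choose-absorb (suc n) zero    = trans (lem₁ (choose (suc n) 1)) (trans (cong suc (choose-absorb n zero)) (lem₂ n))
    where
    lem₁ : ∀ x → 1 * (1 + x) ≡ suc (1 * x)
    lem₁ = solve-∀
    lem₂ : ∀ n → suc (suc n * 1) ≡ suc (suc n) * 1
    lem₂ = solve-∀
  choose-absorb (suc n) (suc k) = begin
    suc (suc k) * (choose (suc n) (suc k) + choose (suc n) (suc (suc k)))
      ≡⟨ lem₁ k (choose (suc n) (suc k)) (choose (suc n) (suc (suc k))) ⟩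
    choose (suc n) (suc k) + suc k * choose (suc n) (suc k) + suc (suc k) * choose (suc n) (suc (suc k))
      ≡⟨ cong₂ (λ x y → choose (suc n) (suc k) + x + y) (choose-absorb n k) (choose-absorb n (suc k)) ⟩
    choose (suc n) (suc k) + suc n * choose n k + suc n * choose n (suc k)
      ≡⟨ lem₂ n (choose n k) (choose n (suc k)) ⟩
    suc (suc n) * choose (suc n) (suc k) ∎
    where
    open ≡-Reasoning
    lem₁ : ∀ k x y → suc (suc k) * (x + y) ≡ x + suc k * x + suc (suc k) * y
    lem₁ = solve-∀
    lem₂ : ∀ n x y → x + y + suc n * x + suc n * y ≡ suc (suc n) * (x + y)
    lem₂ = solve-∀

  -- This is (n + 1 - k) C(n+1, k) = (n + 1) C(n, k) with the subtraction moved across. It relates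
  -- consecutive upper arguments, as the deletion of vertices demands.
  choose-upper : ∀ n k → suc n * choose (suc n) k ≡ suc n * choose n k + k * choose (suc n) k
  choose-upper n zero    = sym (+-identityʳ (suc n * 1))
  choose-upper n (suc k) = begin
    suc n * (choose n k + choose n (suc k))
      ≡⟨ lem n (choose n k) (choose n (suc k)) ⟩
    suc n * choose n (suc k) + suc n * choose n k
      ≡⟨ cong (suc n * choose n (suc k) +_) (sym (choose-absorb n k)) ⟩
    suc n * choose n (suc k) + suc k * choose (suc n) (suc k) ∎
    where
    open ≡-Reasoning
    lem : ∀ n x y → suc n * (x + y) ≡ suc n * y + suc n * x
    lem = solve-∀

  -- Pascal's rule and `choose-absorb`, after cancelling `suc k * choose n k`. Truncated subtraction
  -- is harmless, since both sides vanish for k > n.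
  choose-step : ∀ n k → suc k * choose n (suc k) ≡ (n ∸ k) * choose n k
  choose-step n k with k ≤? n
  ... | yes k≤n = +-cancelˡ-≡ (suc k * choose n k) _ _ (begin
    suc k * choose n k + suc k * choose n (suc k)
      ≡⟨ sym (*-distribˡ-+ (suc k) (choose n k) (choose n (suc k))) ⟩
    suc k * choose (suc n) (suc k)
      ≡⟨ choose-absorb n k ⟩
    suc n * choose n k
      ≡⟨ cong (λ z → suc z * choose n k) (sym (m+[n∸m]≡n k≤n)) ⟩
    suc (k + (n ∸ k)) * choose n k
      ≡⟨ *-distribʳ-+ (choose n k) (suc k) (n ∸ k) ⟩
    suc k * choose n k + (n ∸ k) * choose n k ∎)
    where open ≡-Reasoning
  ... | no k≰n = trans (cong (suc k *_) (choose-> (≤-trans (≰⇒> k≰n) (n≤1+n k))))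
          (trans (*-zeroʳ (suc k)) (sym (cong (_* choose n k) (m≤n⇒m∸n≡0 (<⇒≤ (≰⇒> k≰n))))))

  -- Relabelling the vertices

  -- The encoding of `Graph` singles out vertex zero, so symmetry under permutations has to be
  -- established. Each relabelling carries the invariance of sums as a field: in this form it passes
  -- through compositions and lifts without any bijection between lists.
  record Relabelling (n : ℕ) : Set where
    field
      σ τ       : Fin n → Fin n
      σ∘τ       : ∀ i → σ (τ i) ≡ i
      τ∘σ       : ∀ i → τ (σ i) ≡ i
      onSubset  : Subset n → Subset n
      onGraph   : Graph n → Graph n
      ∈⁺        : ∀ {i S} → i ∈ S → τ i ∈ onSubset S
      ∈⁻        : ∀ {i S} → i ∈ onSubset S → σ i ∈ S
      adj⁺      : ∀ {G} i j → Adj G i j → Adj (onGraph G) (τ i) (τ j)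
      adj⁻      : ∀ {G} i j → Adj (onGraph G) i j → Adj G (σ i) (σ j)
      size      : ∀ S → ∣ onSubset S ∣ ≡ ∣ S ∣
      edges-≡   : ∀ G → edges (onGraph G) ≡ edges G
      ∑-subset  : ∀ f → ∑ (subsets n) (f ∘ onSubset) ≡ ∑ (subsets n) f
      ∑-graph   : ∀ f → ∑ (graphs n) (f ∘ onGraph) ≡ ∑ (graphs n) f

  identity : ∀ {n} → Relabelling n
  identity = record
    { σ = id ; τ = id ; σ∘τ = λ _ → refl ; τ∘σ = λ _ → refl ; onSubset = id ; onGraph = id
    ; ∈⁺ = id ; ∈⁻ = id ; adj⁺ = λ _ _ → id ; adj⁻ = λ _ _ → id
    ; size = λ _ → refl ; edges-≡ = λ _ → refl ; ∑-subset = λ _ → refl ; ∑-graph = λ _ → refl }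

  _then_ : ∀ {n} → Relabelling n → Relabelling n → Relabelling n
  R then R′ = record
    { σ = R.σ ∘ R′.σ ; τ = R′.τ ∘ R.τ
    ; σ∘τ = λ i → trans (cong R.σ (R′.σ∘τ (R.τ i))) (R.σ∘τ i)
    ; τ∘σ = λ i → trans (cong R′.τ (R.τ∘σ (R′.σ i))) (R′.τ∘σ i)
    ; onSubset = R′.onSubset ∘ R.onSubset ; onGraph = R′.onGraph ∘ R.onGraph
    ; ∈⁺ = R′.∈⁺ ∘ R.∈⁺ ; ∈⁻ = R.∈⁻ ∘ R′.∈⁻
    ; adj⁺ = λ i j e → R′.adj⁺ _ _ (R.adj⁺ i j e) ; adj⁻ = λ i j e → R.adj⁻ _ _ (R′.adj⁻ i j e)
    ; size = λ S → trans (R′.size _) (R.size S) ; edges-≡ = λ G → trans (R′.edges-≡ _) (R.edges-≡ G)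
    ; ∑-subset = λ f → trans (R.∑-subset (f ∘ R′.onSubset)) (R′.∑-subset f)
    ; ∑-graph = λ f → trans (R.∑-graph (f ∘ R′.onGraph)) (R′.∑-graph f) }
    where
    module R = Relabelling R
    module R′ = Relabelling R′

  lift : ∀ {n} → Relabelling n → Relabelling (suc n)
  lift {n} R = record
    { σ = ⇑ R.σ ; τ = ⇑ R.τ ; σ∘τ = ⇑-inverse R.σ∘τ ; τ∘σ = ⇑-inverse R.τ∘σ
    ; onSubset = s ; onGraph = g
    ; ∈⁺ = λ {i} {S} → ∈⁺′ i S ; ∈⁻ = λ {i} {S} → ∈⁻′ i S
    ; adj⁺ = λ {G} → a⁺ G ; adj⁻ = λ {G} → a⁻ G
    ; size = size′ ; edges-≡ = edges′ ; ∑-subset = ∑s ; ∑-graph = ∑g }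
    where
    module R = Relabelling R
    ⇑ : (Fin n → Fin n) → Fin (suc n) → Fin (suc n)
    ⇑ f zero    = zero
    ⇑ f (suc i) = suc (f i)
    ⇑-inverse : ∀ {f h} → (∀ i → f (h i) ≡ i) → ∀ i → ⇑ f (⇑ h i) ≡ i
    ⇑-inverse p zero    = refl
    ⇑-inverse p (suc i) = cong suc (p i)
    s : Subset (suc n) → Subset (suc n)
    s (b ∷ S) = b ∷ R.onSubset S
    g : Graph (suc n) → Graph (suc n)
    g (extend N G) = extend (R.onSubset N) (R.onGraph G)
    ∈⁺′ : ∀ i S → i ∈ S → ⇑ R.τ i ∈ s S
    ∈⁺′ zero    (_ ∷ S) here      = here
    ∈⁺′ (suc i) (_ ∷ S) (there h) = there (R.∈⁺ h)
    ∈⁻′ : ∀ i S → i ∈ s S → ⇑ R.σ i ∈ S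
    ∈⁻′ zero    (_ ∷ S) here      = here
    ∈⁻′ (suc i) (_ ∷ S) (there h) = there (R.∈⁻ h)
    a⁺ : ∀ G i j → Adj G i j → Adj (g G) (⇑ R.τ i) (⇑ R.τ j)
    a⁺ (extend N G) zero    (suc j) h = R.∈⁺ h
    a⁺ (extend N G) (suc i) zero    h = R.∈⁺ h
    a⁺ (extend N G) (suc i) (suc j) h = R.adj⁺ i j h
    a⁻ : ∀ G i j → Adj (g G) i j → Adj G (⇑ R.σ i) (⇑ R.σ j)
    a⁻ (extend N G) zero    (suc j) h = R.∈⁻ h
    a⁻ (extend N G) (suc i) zero    h = R.∈⁻ h
    a⁻ (extend N G) (suc i) (suc j) h = R.adj⁻ i j h
    size′ : ∀ S → ∣ s S ∣ ≡ ∣ S ∣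
    size′ (true ∷ S)  = cong suc (R.size S)
    size′ (false ∷ S) = R.size S
    edges′ : ∀ G → edges (g G) ≡ edges G
    edges′ (extend N G) = cong₂ _+_ (R.size N) (R.edges-≡ G)
    ∑s : ∀ f → ∑ (subsets (suc n)) (f ∘ s) ≡ ∑ (subsets (suc n)) f
    ∑s f = trans (∑-subsets n (f ∘ s)) (trans
      (cong₂ _+_ (R.∑-subset (f ∘ (outside ∷_))) (R.∑-subset (f ∘ (inside ∷_)))) (sym (∑-subsets n f)))
    ∑g : ∀ f → ∑ (graphs (suc n)) (f ∘ g) ≡ ∑ (graphs (suc n)) f
    ∑g f = trans (∑-graphs n (f ∘ g)) (trans
      (trans (∑-cong (subsets n) (λ N → R.∑-graph (f ∘ extend (R.onSubset N))))
             (R.∑-subset (λ N → ∑ (graphs n) (f ∘ extend N))))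
      (sym (∑-graphs n f)))

  -- In `extend (b ∷ N) (extend M G)` the bit b is the edge between the first two vertices and
  -- stays; N and M, their neighbourhoods among the others, change places.
  swap₀₁ : ∀ {n} → Relabelling (suc (suc n))
  swap₀₁ {n} = record
    { σ = π ; τ = π ; σ∘τ = invol ; τ∘σ = invol ; onSubset = s ; onGraph = g
    ; ∈⁺ = λ {i} {S} → ∈⁺′ i S ; ∈⁻ = λ {i} {S} → ∈⁻′ i S
    ; adj⁺ = λ {G} → a⁺ G ; adj⁻ = λ {G} → a⁻ G
    ; size = size′ ; edges-≡ = edges′ ; ∑-subset = ∑s ; ∑-graph = ∑g }
    where
    π : Fin (suc (suc n)) → Fin (suc (suc n))
    π zero          = suc zero
    π (suc zero)    = zero
    π (suc (suc i)) = suc (suc i)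
    invol : ∀ i → π (π i) ≡ i
    invol zero          = refl
    invol (suc zero)    = refl
    invol (suc (suc i)) = refl
    s : Subset (suc (suc n)) → Subset (suc (suc n))
    s (a ∷ b ∷ S) = b ∷ a ∷ S
    g : Graph (suc (suc n)) → Graph (suc (suc n))
    g (extend (b ∷ N) (extend M G)) = extend (b ∷ M) (extend N G)
    ∈⁺′ : ∀ i S → i ∈ S → π i ∈ s S
    ∈⁺′ zero          (_ ∷ _ ∷ S) here              = there here
    ∈⁺′ (suc zero)    (_ ∷ _ ∷ S) (there here)      = here
    ∈⁺′ (suc (suc i)) (_ ∷ _ ∷ S) (there (there h)) = there (there h)
    ∈⁻′ : ∀ i S → i ∈ s S → π i ∈ S
    ∈⁻′ zero          (_ ∷ _ ∷ S) here              = there here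
    ∈⁻′ (suc zero)    (_ ∷ _ ∷ S) (there here)      = here
    ∈⁻′ (suc (suc i)) (_ ∷ _ ∷ S) (there (there h)) = there (there h)
    a⁺ : ∀ G i j → Adj G i j → Adj (g G) (π i) (π j)
    a⁺ (extend (_ ∷ N) (extend M G)) zero          (suc zero)    here      = here
    a⁺ (extend (_ ∷ N) (extend M G)) zero          (suc (suc j)) (there h) = h
    a⁺ (extend (_ ∷ N) (extend M G)) (suc zero)    zero          here      = here
    a⁺ (extend (_ ∷ N) (extend M G)) (suc zero)    (suc (suc j)) h         = there h
    a⁺ (extend (_ ∷ N) (extend M G)) (suc (suc i)) zero          (there h) = h
    a⁺ (extend (_ ∷ N) (extend M G)) (suc (suc i)) (suc zero)    h         = there h
    a⁺ (extend (_ ∷ N) (extend M G)) (suc (suc i)) (suc (suc j)) h         = h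
    a⁻ : ∀ G i j → Adj (g G) i j → Adj G (π i) (π j)
    a⁻ (extend (_ ∷ N) (extend M G)) zero          (suc zero)    here      = here
    a⁻ (extend (_ ∷ N) (extend M G)) zero          (suc (suc j)) (there h) = h
    a⁻ (extend (_ ∷ N) (extend M G)) (suc zero)    zero          here      = here
    a⁻ (extend (_ ∷ N) (extend M G)) (suc zero)    (suc (suc j)) h         = there h
    a⁻ (extend (_ ∷ N) (extend M G)) (suc (suc i)) zero          (there h) = h
    a⁻ (extend (_ ∷ N) (extend M G)) (suc (suc i)) (suc zero)    h         = there h
    a⁻ (extend (_ ∷ N) (extend M G)) (suc (suc i)) (suc (suc j)) h         = h
    size′ : ∀ S → ∣ s S ∣ ≡ ∣ S ∣
    size′ (true  ∷ true  ∷ S) = refl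
    size′ (true  ∷ false ∷ S) = refl
    size′ (false ∷ true  ∷ S) = refl
    size′ (false ∷ false ∷ S) = refl
    exchange : ∀ a b c → a + (b + c) ≡ b + (a + c)
    exchange = solve-∀
    edges′ : ∀ G → edges (g G) ≡ edges G
    edges′ (extend (true  ∷ N) (extend M G)) = cong suc (exchange ∣ M ∣ ∣ N ∣ (edges G))
    edges′ (extend (false ∷ N) (extend M G)) = exchange ∣ M ∣ ∣ N ∣ (edges G)
    ∑ss : ∀ f → ∑ (subsets (suc (suc n))) f ≡
          ∑ (subsets n) (λ S → f (outside ∷ outside ∷ S)) + ∑ (subsets n) (λ S → f (outside ∷ inside ∷ S))
          + (∑ (subsets n) (λ S → f (inside ∷ outside ∷ S)) + ∑ (subsets n) (λ S → f (inside ∷ inside ∷ S)))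
    ∑ss f = trans (∑-subsets (suc n) f)
      (cong₂ _+_ (∑-subsets n (f ∘ (outside ∷_))) (∑-subsets n (f ∘ (inside ∷_))))
    shuffle : ∀ a b c d → a + b + (c + d) ≡ a + c + (b + d)
    shuffle = solve-∀
    ∑s : ∀ f → ∑ (subsets (suc (suc n))) (f ∘ s) ≡ ∑ (subsets (suc (suc n))) f
    ∑s f = trans (∑ss (f ∘ s)) (trans (shuffle (∑ (subsets n) (λ S → f (outside ∷ outside ∷ S))) _ _ _) (sym (∑ss f)))
    ∑gg : ∀ f → ∑ (graphs (suc (suc n))) f ≡
          ∑ (subsets n) (λ N → ∑ (subsets n) (λ M → ∑ (graphs n) (λ G → f (extend (outside ∷ N) (extend M G)))))
          + ∑ (subsets n) (λ N → ∑ (subsets n) (λ M → ∑ (graphs n) (λ G → f (extend (inside ∷ N) (extend M G)))))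
    ∑gg f = trans (∑-graphs (suc n) f) (trans (∑-subsets n _)
      (cong₂ _+_ (∑-cong (subsets n) (λ N → ∑-graphs n _)) (∑-cong (subsets n) (λ N → ∑-graphs n _))))
    ∑g : ∀ f → ∑ (graphs (suc (suc n))) (f ∘ g) ≡ ∑ (graphs (suc (suc n))) f
    ∑g f = trans (∑gg (f ∘ g)) (trans
      (cong₂ _+_ (∑-swap (subsets n) (subsets n) _) (∑-swap (subsets n) (subsets n) _)) (sym (∑gg f)))

  module _ {n} (R : Relabelling n) where
    open Relabelling R

    relabel-reachable : ∀ {G i j} → Reachable G i j → Reachable (onGraph G) (τ i) (τ j)
    relabel-reachable = gmap τ (adj⁺ _ _)

    unrelabel-reachable : ∀ {G i j} → Reachable (onGraph G) i j → Reachable G (σ i) (σ j)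
    unrelabel-reachable = gmap σ (adj⁻ _ _)

  -- An element found in the tail is moved to the front of the tail by a lifted relabelling and then
  -- exchanged with vertex zero, so transpositions of the first two positions and their lifts
  -- suffice.
  bring-to-front : ∀ {n} (S : Subset (suc n)) → Nonempty S →
                   ∃[ R ] ∃[ S′ ] Relabelling.onSubset R S ≡ inside ∷ S′
  bring-to-front (true ∷ S) _ = identity , S , refl
  bring-to-front {suc n} (false ∷ S) (suc i , there i∈S) with bring-to-front S (i , i∈S)
  ... | R , S′ , eq = (lift R then swap₀₁) , (outside ∷ S′) ,
        cong (Relabelling.onSubset swap₀₁ ∘ (outside ∷_)) eq
  bring-to-front {zero} (false ∷ []) (suc () , _)

  -- Rooted forests

  Covers : ∀ {n} → Subset n → Graph n → Set
  Covers S G = ∀ v → ∃[ u ] (u ∈ S × Reachable G u v)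

  covers? : ∀ {n} (S : Subset n) (G : Graph n) → Dec (Covers S G)
  covers? S G = all? (λ v → any? (λ u → u ∈? S ×-dec reachable? G u v))

  module _ {n} (R : Relabelling n) where
    open Relabelling R

    relabel-covers : ∀ {S G} → Covers S G → Covers (onSubset S) (onGraph G)
    relabel-covers {S} {G} c v with c (σ v)
    ... | u , u∈S , r = τ u , ∈⁺ u∈S , subst (Reachable (onGraph G) (τ u)) (τ∘σ v) (relabel-reachable R r)

    unrelabel-covers : ∀ {S G} → Covers (onSubset S) (onGraph G) → Covers S G
    unrelabel-covers {S} {G} c v with c (τ v)
    ... | u , u∈S , r = σ u , ∈⁻ u∈S , subst (Reachable G (σ u)) (σ∘τ v) (unrelabel-reachable R r)

  -- A path through vertex zero goes on from some neighbour a in N, which therefore serves as a root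
  -- once vertex zero is gone; `reachable⇒via` supplies the case distinction.
  covers-extend⁻ : ∀ {n} {S N : Subset n} {G} → Covers (inside ∷ S) (extend N G) → Covers (S ∪ N) G
  covers-extend⁻ c v with c (suc v)
  ... | zero , _ , r with reachable⇒via r
  ...   | a , a∈N , r′ = a , x∈p∪q⁺ (inj₂ a∈N) , r′
  covers-extend⁻ c v | suc u , there u∈S , r with reachable⇒via r
  ...   | inj₁ r′                 = u , x∈p∪q⁺ (inj₁ u∈S) , r′
  ...   | inj₂ (_ , a , a∈N , r′) = a , x∈p∪q⁺ (inj₂ a∈N) , r′

  covers-extend⁺ : ∀ {n} {S N : Subset n} {G} → Covers (S ∪ N) G → Covers (inside ∷ S) (extend N G)
  covers-extend⁺ c zero = zero , here , ε
  covers-extend⁺ {S = S} {N} c (suc v) with c v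
  ... | u , u∈S∪N , r with x∈p∪q⁻ S N u∈S∪N
  ...   | inj₁ u∈S = suc u , there u∈S , gmap suc id r
  ...   | inj₂ u∈N = zero , here , (_◅_ {j = suc u} u∈N (gmap suc id r))

  ∣p∪q∣≤∣p∣+∣q∣ : ∀ {n} (p q : Subset n) → ∣ p ∪ q ∣ ≤ ∣ p ∣ + ∣ q ∣
  ∣p∪q∣≤∣p∣+∣q∣ []          []          = z≤n
  ∣p∪q∣≤∣p∣+∣q∣ (true  ∷ p) (true  ∷ q) = s≤s (≤-trans (∣p∪q∣≤∣p∣+∣q∣ p q) (+-monoʳ-≤ ∣ p ∣ (n≤1+n ∣ q ∣)))
  ∣p∪q∣≤∣p∣+∣q∣ (true  ∷ p) (false ∷ q) = s≤s (∣p∪q∣≤∣p∣+∣q∣ p q)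
  ∣p∪q∣≤∣p∣+∣q∣ (false ∷ p) (true  ∷ q) =
    ≤-trans (s≤s (∣p∪q∣≤∣p∣+∣q∣ p q)) (≤-reflexive (sym (+-suc ∣ p ∣ ∣ q ∣)))
  ∣p∪q∣≤∣p∣+∣q∣ (false ∷ p) (false ∷ q) = ∣p∪q∣≤∣p∣+∣q∣ p q

  -- Induction by deleting a root that has been moved to vertex zero. It takes its edges along and
  -- leaves the roots S′ ∪ N, so the sum of edges and roots drops by at least one together with the
  -- number of vertices.
  covers⇒≤ : ∀ {n} (S : Subset n) (G : Graph n) → Covers S G → n ≤ edges G + ∣ S ∣
  covers⇒≤ {zero}  S G c = z≤n
  covers⇒≤ {suc n} S G c with bring-to-front S (proj₁ (c zero) , proj₁ (proj₂ (c zero)))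
  ... | R , S′ , eq = subst₂ (λ x y → suc n ≤ x + y) (Relabelling.edges-≡ R G)
          (trans (cong ∣_∣ (sym eq)) (Relabelling.size R S))
          (step (Relabelling.onGraph R G) (subst (λ T → Covers T (Relabelling.onGraph R G)) eq (relabel-covers R {S} {G} c)))
    where
    open ≤-Reasoning
    rearrange : ∀ a b c → suc (a + (b + c)) ≡ c + a + suc b
    rearrange = solve-∀
    step : ∀ G′ → Covers (inside ∷ S′) G′ → suc n ≤ edges G′ + suc ∣ S′ ∣
    step (extend N G′) c′ = begin
      suc n                           ≤⟨ s≤s (covers⇒≤ (S′ ∪ N) G′ (covers-extend⁻ c′)) ⟩
      suc (edges G′ + ∣ S′ ∪ N ∣)       ≤⟨ s≤s (+-monoʳ-≤ (edges G′) (∣p∪q∣≤∣p∣+∣q∣ S′ N)) ⟩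
      suc (edges G′ + (∣ S′ ∣ + ∣ N ∣)) ≡⟨ rearrange (edges G′) ∣ S′ ∣ ∣ N ∣ ⟩
      ∣ N ∣ + edges G′ + suc ∣ S′ ∣     ∎

  -- By covers⇒≤ a covering graph with this few edges is a forest with one root in S per component.
  rootedForests : ∀ {n} → Subset n → ℕ
  rootedForests {n} S = ∑ (graphs n) (λ G → 𝟙 (covers? S G ×-dec (edges G + ∣ S ∣ ≟ n)))

  relabel-rootedForests : ∀ {n} (R : Relabelling n) S → rootedForests (Relabelling.onSubset R S) ≡ rootedForests S
  relabel-rootedForests {n} R S = trans (sym (∑-graph _)) (∑-cong (graphs n) (λ G → 𝟙-cong
      (covers? (onSubset S) (onGraph G) ×-dec (edges (onGraph G) + ∣ onSubset S ∣ ≟ n))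
      (covers? S G ×-dec (edges G + ∣ S ∣ ≟ n))
      (λ (c , e) → unrelabel-covers R c , trans (sym (cong₂ _+_ (edges-≡ G) (size S))) e)
      (λ (c , e) → relabel-covers R c , trans (cong₂ _+_ (edges-≡ G) (size S)) e)))
    where open Relabelling R

  -- The indicator says that N avoids S. This is forced: if the neighbours of the deleted root
  -- included another root, the remaining graph would have too few edges and roots for `covers⇒≤`.
  rootedForests-extend : ∀ {n} (S : Subset n) → rootedForests (inside ∷ S) ≡
    ∑ (subsets n) (λ N → 𝟙 (∣ S ∪ N ∣ ≟ ∣ S ∣ + ∣ N ∣) * rootedForests (S ∪ N))
  rootedForests-extend {n} S = trans (∑-graphs n _) (∑-cong (subsets n) (λ N →
    trans (∑-cong (graphs n) (λ G → trans
      (𝟙-cong (covers? (inside ∷ S) (extend N G) ×-dec (∣ N ∣ + edges G + suc ∣ S ∣ ≟ suc n))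
        ((∣ S ∪ N ∣ ≟ ∣ S ∣ + ∣ N ∣) ×-dec (covers? (S ∪ N) G ×-dec (edges G + ∣ S ∪ N ∣ ≟ n)))
        (to N G) (from N G))
      (𝟙-× (∣ S ∪ N ∣ ≟ ∣ S ∣ + ∣ N ∣) _)))
    (∑-*ˡ (graphs n) (𝟙 (∣ S ∪ N ∣ ≟ ∣ S ∣ + ∣ N ∣)) _)))
    where
    rearrange : ∀ a b c → c + a + suc b ≡ suc (a + (b + c))
    rearrange = solve-∀
    to : ∀ N G → Covers (inside ∷ S) (extend N G) × ∣ N ∣ + edges G + suc ∣ S ∣ ≡ suc n →
         ∣ S ∪ N ∣ ≡ ∣ S ∣ + ∣ N ∣ × Covers (S ∪ N) G × edges G + ∣ S ∪ N ∣ ≡ n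
    to N G (c , e) = disjoint , covers-extend⁻ c , trans (cong (edges G +_) disjoint) e′
      where
      e′ : edges G + (∣ S ∣ + ∣ N ∣) ≡ n
      e′ = suc-injective (trans (sym (rearrange (edges G) ∣ S ∣ ∣ N ∣)) e)
      disjoint = ≤-antisym (∣p∪q∣≤∣p∣+∣q∣ S N) (+-cancelˡ-≤ (edges G) _ _
        (≤-trans (≤-reflexive e′) (covers⇒≤ (S ∪ N) G (covers-extend⁻ c))))
    from : ∀ N G → ∣ S ∪ N ∣ ≡ ∣ S ∣ + ∣ N ∣ × Covers (S ∪ N) G × edges G + ∣ S ∪ N ∣ ≡ n →
           Covers (inside ∷ S) (extend N G) × ∣ N ∣ + edges G + suc ∣ S ∣ ≡ suc n
    from N G (d , c , e) = covers-extend⁺ c ,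
      trans (rearrange (edges G) ∣ S ∣ ∣ N ∣) (cong suc (trans (cong (edges G +_) (sym d)) e))

  -- The numerical condition expresses disjointness, so N ranges over the subsets of the complement
  -- of S, grouped by size.
  ∑-disjoint : ∀ {n} (S : Subset n) (f : ℕ → ℕ) →
               ∑ (subsets n) (λ N → 𝟙 (∣ S ∪ N ∣ ≟ ∣ S ∣ + ∣ N ∣) * f ∣ N ∣) ≡ binomialSum ∣ ∁ S ∣ f
  ∑-disjoint []          f = trans (+-identityʳ (f 0 + 0)) (+-identityʳ (f 0))
  ∑-disjoint {suc n} (true ∷ S) f = trans (∑-subsets n _) (trans
    (cong₂ _+_
      (trans (∑-cong (subsets n) (λ N → cong (_* f ∣ N ∣)
        (𝟙-cong (suc ∣ S ∪ N ∣ ≟ suc (∣ S ∣ + ∣ N ∣)) (∣ S ∪ N ∣ ≟ ∣ S ∣ + ∣ N ∣) suc-injective (cong suc))))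
        (∑-disjoint S f))
      (∑-zero (subsets n) (λ N → cong (_* f (suc ∣ N ∣))
        (𝟙-no (suc ∣ S ∪ N ∣ ≟ suc (∣ S ∣ + suc ∣ N ∣)) (not-disjoint N)))))
    (+-identityʳ _))
    where
    not-disjoint : ∀ N → ¬ (suc ∣ S ∪ N ∣ ≡ suc (∣ S ∣ + suc ∣ N ∣))
    not-disjoint N e = <-irrefl (sym (trans (sym (+-suc ∣ S ∣ ∣ N ∣)) (sym (suc-injective e)))) (s≤s (∣p∪q∣≤∣p∣+∣q∣ S N))
  ∑-disjoint {suc n} (false ∷ S) f = trans (∑-subsets n _) (cong₂ _+_ (∑-disjoint S f)
    (trans (∑-cong (subsets n) (λ N → cong (_* f (suc ∣ N ∣))
        (𝟙-cong (suc ∣ S ∪ N ∣ ≟ ∣ S ∣ + suc ∣ N ∣) (∣ S ∪ N ∣ ≟ ∣ S ∣ + ∣ N ∣)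
          (λ e → suc-injective (trans e (+-suc ∣ S ∣ ∣ N ∣)))
          (λ e → trans (cong suc e) (sym (+-suc ∣ S ∣ ∣ N ∣))))))
      (∑-disjoint S (f ∘ suc))))

  -- The binomial theorem together with its derivative, Σ C(r, i) i a^(r-i) = r (a+1)^(r-1); the
  -- factor a + 1 avoids the exponent r - 1. The variable x is general because Pascal's rule shifts
  -- it to x + 1.
  binomialSum-forest : ∀ r x a → suc a * binomialSum r (λ i → (x + i) * a ^ (r ∸ i)) ≡ suc a ^ r * (x * suc a + r)
  binomialSum-forest zero    x a = base x a
    where
    base : ∀ x a → suc a * ((x + 0) * 1) ≡ 1 * (x * suc a + 0)
    base = solve-∀
  binomialSum-forest (suc r) x a = begin
    suc a * (binomialSum r (λ i → (x + i) * a ^ (suc r ∸ i)) + binomialSum r (λ i → (x + suc i) * a ^ (r ∸ i)))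
      ≡⟨ cong₂ (λ y z → suc a * (y + z))
           (trans (binomialSum-cong r (λ {i} i≤r → trans (cong (λ e → (x + i) * a ^ e) (+-∸-assoc 1 i≤r))
             (exchange (x + i) a (a ^ (r ∸ i))))) (binomialSum-*ˡ r a _))
           (binomialSum-cong r (λ {i} _ → cong (_* a ^ (r ∸ i)) (+-suc x i))) ⟩
    suc a * (a * binomialSum r (λ i → (x + i) * a ^ (r ∸ i)) + binomialSum r (λ i → (suc x + i) * a ^ (r ∸ i)))
      ≡⟨ distribute a (binomialSum r (λ i → (x + i) * a ^ (r ∸ i))) _ ⟩
    a * (suc a * binomialSum r (λ i → (x + i) * a ^ (r ∸ i))) + suc a * binomialSum r (λ i → (suc x + i) * a ^ (r ∸ i))
      ≡⟨ cong₂ (λ y z → a * y + z) (binomialSum-forest r x a) (binomialSum-forest r (suc x) a) ⟩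
    a * (suc a ^ r * (x * suc a + r)) + suc a ^ r * (suc x * suc a + r)
      ≡⟨ collect a (suc a ^ r) x r ⟩
    suc a * suc a ^ r * (x * suc a + suc r) ∎
    where
    open ≡-Reasoning
    exchange : ∀ p a q → p * (a * q) ≡ a * (p * q)
    exchange = solve-∀
    distribute : ∀ a p q → suc a * (a * p + q) ≡ a * (suc a * p) + suc a * q
    distribute = solve-∀
    collect : ∀ a p x r → a * (p * (x * suc a + r)) + p * (suc x * suc a + r) ≡ suc a * p * (x * suc a + suc r)
    collect = solve-∀

  -- Deleting a root and making its neighbours roots gives the recursion.
  cayley-rooted : ∀ {n} (S : Subset n) → n * rootedForests S ≡ ∣ S ∣ * n ^ (n ∸ ∣ S ∣)
  cayley-rooted {zero}  []  = refl
  cayley-rooted {suc n} S with nonempty? S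
  ... | no empty-S = trans (cong (suc n *_) (∑-zero (graphs (suc n)) (λ G →
          𝟙-no (covers? S G ×-dec (edges G + ∣ S ∣ ≟ suc n)) (λ (c , _) → empty-S (_ , proj₁ (proj₂ (c zero)))))))
          (trans (*-zeroʳ (suc n)) (cong (λ s → s * suc n ^ (suc n ∸ s)) (sym (empty⇒0 S empty-S))))
    where
    empty⇒0 : ∀ {n} (S : Subset n) → ¬ Nonempty S → ∣ S ∣ ≡ 0
    empty⇒0 []          _ = refl
    empty⇒0 (true  ∷ S) h = ⊥-elim (h (zero , here))
    empty⇒0 (false ∷ S) h = empty⇒0 S (λ (i , i∈S) → h (suc i , there i∈S))
  ... | yes S≢∅ with bring-to-front S S≢∅
  ...   | R , S′ , eq = subst₂ (λ t s → suc n * t ≡ s * suc n ^ (suc n ∸ s))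
            (trans (cong rootedForests (sym eq)) (relabel-rootedForests R S))
            (trans (cong ∣_∣ (sym eq)) (Relabelling.size R S))
            (step n S′ refl)
    where
    -- The induction hypothesis fixes n times a count on n vertices, so the claim is proved after
    -- multiplication by n. Cancelling n requires n ≥ 1; the equation `n′ ≡ n` allows the case of a
    -- lone root to be split off.
    step : ∀ n′ (S′ : Subset n) → n′ ≡ n → suc n * rootedForests (inside ∷ S′) ≡ suc ∣ S′ ∣ * suc n ^ (n ∸ ∣ S′ ∣)
    step zero     []  refl = refl
    step (suc n′) S′ refl = *-cancelˡ-≡ _ _ n (begin
      n * (suc n * rootedForests (inside ∷ S′))
        ≡⟨ exchange n (suc n) (rootedForests (inside ∷ S′)) ⟩
      suc n * (n * rootedForests (inside ∷ S′))
        ≡⟨ cong (suc n *_) (trans (cong (n *_) (rootedForests-extend S′)) (sym (∑-*ˡ (subsets n) n _))) ⟩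
      suc n * ∑ (subsets n) (λ N → n * (𝟙 (∣ S′ ∪ N ∣ ≟ ∣ S′ ∣ + ∣ N ∣) * rootedForests (S′ ∪ N)))
        ≡⟨ cong (suc n *_) (∑-cong (subsets n) (λ N → trans
             (exchange n (𝟙 (∣ S′ ∪ N ∣ ≟ ∣ S′ ∣ + ∣ N ∣)) (rootedForests (S′ ∪ N)))
             (𝟙-*-cong (∣ S′ ∪ N ∣ ≟ ∣ S′ ∣ + ∣ N ∣) (λ d → trans (cayley-rooted (S′ ∪ N))
               (cong₂ (λ s e → s * n ^ e) d (trans (cong (n ∸_) d) (sym (∸-+-assoc n ∣ S′ ∣ ∣ N ∣)))))))) ⟩
      suc n * ∑ (subsets n) (λ N → 𝟙 (∣ S′ ∪ N ∣ ≟ ∣ S′ ∣ + ∣ N ∣) * ((∣ S′ ∣ + ∣ N ∣) * n ^ (n ∸ ∣ S′ ∣ ∸ ∣ N ∣)))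
        ≡⟨ cong (suc n *_) (∑-disjoint S′ (λ i → (∣ S′ ∣ + i) * n ^ (n ∸ ∣ S′ ∣ ∸ i))) ⟩
      suc n * binomialSum ∣ ∁ S′ ∣ (λ i → (∣ S′ ∣ + i) * n ^ (n ∸ ∣ S′ ∣ ∸ i))
        ≡⟨ cong (λ r → suc n * binomialSum r (λ i → (∣ S′ ∣ + i) * n ^ (n ∸ ∣ S′ ∣ ∸ i))) (∣∁p∣≡n∸∣p∣ S′) ⟩
      suc n * binomialSum (n ∸ ∣ S′ ∣) (λ i → (∣ S′ ∣ + i) * n ^ (n ∸ ∣ S′ ∣ ∸ i))
        ≡⟨ binomialSum-forest (n ∸ ∣ S′ ∣) ∣ S′ ∣ n ⟩
      suc n ^ (n ∸ ∣ S′ ∣) * (∣ S′ ∣ * suc n + (n ∸ ∣ S′ ∣))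
        ≡⟨ cong (suc n ^ (n ∸ ∣ S′ ∣) *_) (trans (split ∣ S′ ∣ n (n ∸ ∣ S′ ∣))
             (cong (∣ S′ ∣ * n +_) (m+[n∸m]≡n (∣p∣≤n S′)))) ⟩
      suc n ^ (n ∸ ∣ S′ ∣) * (∣ S′ ∣ * n + n)
        ≡⟨ collect (suc n ^ (n ∸ ∣ S′ ∣)) ∣ S′ ∣ n ⟩
      n * (suc ∣ S′ ∣ * suc n ^ (n ∸ ∣ S′ ∣)) ∎)
      where
      open ≡-Reasoning
      exchange : ∀ p a q → p * (a * q) ≡ a * (p * q)
      exchange = solve-∀
      split : ∀ x n r → x * suc n + r ≡ x * n + (x + r)
      split = solve-∀
      collect : ∀ p x n → p * (x * n + n) ≡ n * (suc x * p)
      collect = solve-∀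

  -- Splitting a graph along a component

  embed : ∀ {n} (S : Subset n) → Fin ∣ S ∣ → Fin n
  embed (true  ∷ S) zero    = zero
  embed (true  ∷ S) (suc i) = suc (embed S i)
  embed (false ∷ S) i       = suc (embed S i)

  embed-∈ : ∀ {n} (S : Subset n) i → embed S i ∈ S
  embed-∈ (true  ∷ S) zero    = here
  embed-∈ (true  ∷ S) (suc i) = there (embed-∈ S i)
  embed-∈ (false ∷ S) i       = there (embed-∈ S i)

  embed-onto : ∀ {n} (S : Subset n) {v} → v ∈ S → ∃[ i ] v ≡ embed S i
  embed-onto (true  ∷ S) here      = zero , refl
  embed-onto (true  ∷ S) (there h) = let i , e = embed-onto S h in suc i , cong suc e
  embed-onto (false ∷ S) (there h) = let i , e = embed-onto S h in i , cong suc e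

  embedSubset : ∀ {n} (S : Subset n) → Subset ∣ S ∣ → Subset n
  embedSubset []          []      = []
  embedSubset (true  ∷ S) (b ∷ N) = b ∷ embedSubset S N
  embedSubset (false ∷ S) N       = outside ∷ embedSubset S N

  embedSubset-∈⁺ : ∀ {n} (S : Subset n) {N i} → i ∈ N → embed S i ∈ embedSubset S N
  embedSubset-∈⁺ (true  ∷ S) {_ ∷ N} here      = here
  embedSubset-∈⁺ (true  ∷ S) {_ ∷ N} (there h) = there (embedSubset-∈⁺ S h)
  embedSubset-∈⁺ (false ∷ S)         h         = there (embedSubset-∈⁺ S h)

  embedSubset-∈⁻ : ∀ {n} (S : Subset n) {N} i → embed S i ∈ embedSubset S N → i ∈ N
  embedSubset-∈⁻ (true  ∷ S) {_ ∷ N} zero    here      = here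
  embedSubset-∈⁻ (true  ∷ S) {_ ∷ N} (suc i) (there h) = there (embedSubset-∈⁻ S i h)
  embedSubset-∈⁻ (false ∷ S)         i       (there h) = embedSubset-∈⁻ S i h

  embedSubset-⊆ : ∀ {n} (S : Subset n) N → embedSubset S N ⊆ S
  embedSubset-⊆ (true  ∷ S) (_ ∷ N) here      = here
  embedSubset-⊆ (true  ∷ S) (_ ∷ N) (there h) = there (embedSubset-⊆ S N h)
  embedSubset-⊆ (false ∷ S) N       (there h) = there (embedSubset-⊆ S N h)

  ∣embedSubset∣ : ∀ {n} (S : Subset n) N → ∣ embedSubset S N ∣ ≡ ∣ N ∣
  ∣embedSubset∣ []          []          = refl
  ∣embedSubset∣ (true  ∷ S) (true  ∷ N) = cong suc (∣embedSubset∣ S N)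
  ∣embedSubset∣ (true  ∷ S) (false ∷ N) = ∣embedSubset∣ S N
  ∣embedSubset∣ (false ∷ S) N           = ∣embedSubset∣ S N

  ∑-embedSubset : ∀ {n} (S : Subset n) (f : Subset n → ℕ) → (∀ N → ¬ N ⊆ S → f N ≡ 0) →
                  ∑ (subsets n) f ≡ ∑ (subsets ∣ S ∣) (f ∘ embedSubset S)
  ∑-embedSubset []                  f h = refl
  ∑-embedSubset {suc n} (true  ∷ S) f h = trans (∑-subsets n f) (trans
    (cong₂ _+_ (∑-embedSubset S (f ∘ (outside ∷_)) (λ N N⊈S → h (outside ∷ N) (N⊈S ∘ drop-∷-⊆)))
               (∑-embedSubset S (f ∘ (inside ∷_)) (λ N N⊈S → h (inside ∷ N) (N⊈S ∘ drop-∷-⊆))))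
    (sym (∑-subsets ∣ S ∣ _)))
  ∑-embedSubset {suc n} (false ∷ S) f h = trans (∑-subsets n f) (trans
    (cong₂ _+_ (∑-embedSubset S (f ∘ (outside ∷_)) (λ N N⊈S → h (outside ∷ N) (N⊈S ∘ drop-∷-⊆)))
               (∑-zero (subsets n) (λ N → h (inside ∷ N) (λ ⊆S → zero∉ (⊆S here)))))
    (+-identityʳ _))
    where
    zero∉ : zero ∉ outside ∷ S
    zero∉ ()

  -- Reading the bits of S decides from which of the two graphs the next vertex comes, so H and K
  -- are interleaved within the encoding and S need not be moved to the front.
  glue : ∀ {n} (S : Subset n) → Graph ∣ S ∣ → Graph ∣ ∁ S ∣ → Graph n
  glue []          empty        empty        = empty
  glue (true  ∷ S) (extend N H) K            = extend (embedSubset S N) (glue S H K)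
  glue (false ∷ S) H            (extend N K) = extend (embedSubset (∁ S) N) (glue S H K)

  edges-glue : ∀ {n} (S : Subset n) H K → edges (glue S H K) ≡ edges H + edges K
  edges-glue []          empty        empty        = refl
  edges-glue (true  ∷ S) (extend N H) K            =
    trans (cong₂ _+_ (∣embedSubset∣ S N) (edges-glue S H K)) (sym (+-assoc ∣ N ∣ _ _))
  edges-glue (false ∷ S) H            (extend N K) =
    trans (cong₂ _+_ (∣embedSubset∣ (∁ S) N) (edges-glue S H K)) (exchange ∣ N ∣ (edges H) (edges K))
    where
    exchange : ∀ a b c → a + (b + c) ≡ b + (a + c)
    exchange = solve-∀

  -- Adjacency being symmetric, this excludes every edge between S and its complement.
  Closed : ∀ {n} → Subset n → Graph n → Set
  Closed S G = ∀ i j → Adj G i j → i ∈ S → j ∈ S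

  -- A neighbourhood of vertex zero that crosses between S and its complement violates closedness,
  -- so the summand vanishes and N may be restricted to the side on which vertex zero lies. The rest
  -- is induction.
  ∑-glue : ∀ {n} (S : Subset n) (f : Graph n → ℕ) → (∀ G → ¬ Closed S G → f G ≡ 0) →
           ∑ (graphs n) f ≡ ∑ (graphs ∣ S ∣) (λ H → ∑ (graphs ∣ ∁ S ∣) (λ K → f (glue S H K)))
  ∑-glue []                  f h = sym (+-identityʳ _)
  ∑-glue {suc n} (true  ∷ S) f h = begin
    ∑ (graphs (suc n)) f
      ≡⟨ ∑-graphs n f ⟩
    ∑ (subsets n) (λ N → ∑ (graphs n) (λ G → f (extend N G)))
      ≡⟨ ∑-embedSubset S _ (λ N N⊈S → ∑-zero (graphs n) (λ G → h (extend N G)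
           (λ c → N⊈S (λ {j} j∈N → drop (c zero (suc j) j∈N here))))) ⟩
    ∑ (subsets ∣ S ∣) (λ N → ∑ (graphs n) (λ G → f (extend (embedSubset S N) G)))
      ≡⟨ ∑-cong (subsets ∣ S ∣) (λ N → ∑-glue S _ (λ G ¬c → h (extend (embedSubset S N) G)
           (λ c → ¬c (λ i j a i∈S → drop (c (suc i) (suc j) a (there i∈S)))))) ⟩
    ∑ (subsets ∣ S ∣) (λ N → ∑ (graphs ∣ S ∣) (λ H → ∑ (graphs ∣ ∁ S ∣) (λ K → f (extend (embedSubset S N) (glue S H K)))))
      ≡⟨ sym (∑-graphs ∣ S ∣ _) ⟩
    ∑ (graphs (suc ∣ S ∣)) (λ H → ∑ (graphs ∣ ∁ S ∣) (λ K → f (glue (true ∷ S) H K))) ∎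
    where
    open ≡-Reasoning
    drop : ∀ {b j} → suc j ∈ b ∷ S → j ∈ S
    drop (there j∈S) = j∈S
  ∑-glue {suc n} (false ∷ S) f h = begin
    ∑ (graphs (suc n)) f
      ≡⟨ ∑-graphs n f ⟩
    ∑ (subsets n) (λ N → ∑ (graphs n) (λ G → f (extend N G)))
      ≡⟨ ∑-embedSubset (∁ S) _ (λ N N⊈∁S → ∑-zero (graphs n) (λ G → h (extend N G)
           (λ c → N⊈∁S (λ {j} j∈N → x∉p⇒x∈∁p (λ j∈S → zero∉ (c (suc j) zero j∈N (there j∈S))))))) ⟩
    ∑ (subsets ∣ ∁ S ∣) (λ N → ∑ (graphs n) (λ G → f (extend (embedSubset (∁ S) N) G)))
      ≡⟨ ∑-cong (subsets ∣ ∁ S ∣) (λ N → ∑-glue S _ (λ G ¬c → h (extend (embedSubset (∁ S) N) G)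
           (λ c → ¬c (λ i j a i∈S → drop (c (suc i) (suc j) a (there i∈S)))))) ⟩
    ∑ (subsets ∣ ∁ S ∣) (λ N → ∑ (graphs ∣ S ∣) (λ H → ∑ (graphs ∣ ∁ S ∣) (λ K → f (extend (embedSubset (∁ S) N) (glue S H K)))))
      ≡⟨ ∑-swap (subsets ∣ ∁ S ∣) (graphs ∣ S ∣) _ ⟩
    ∑ (graphs ∣ S ∣) (λ H → ∑ (subsets ∣ ∁ S ∣) (λ N → ∑ (graphs ∣ ∁ S ∣) (λ K → f (extend (embedSubset (∁ S) N) (glue S H K)))))
      ≡⟨ ∑-cong (graphs ∣ S ∣) (λ H → sym (∑-graphs ∣ ∁ S ∣ _)) ⟩
    ∑ (graphs ∣ S ∣) (λ H → ∑ (graphs (suc ∣ ∁ S ∣)) (λ K → f (glue (false ∷ S) H K))) ∎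
    where
    open ≡-Reasoning
    drop : ∀ {b j} → suc j ∈ b ∷ S → j ∈ S
    drop (there j∈S) = j∈S
    zero∉ : zero ∉ outside ∷ S
    zero∉ ()

  adj-sym : ∀ {n} (G : Graph n) i j → Adj G i j → Adj G j i
  adj-sym (extend N G) zero    (suc j) a = a
  adj-sym (extend N G) (suc i) zero    a = a
  adj-sym (extend N G) (suc i) (suc j) a = adj-sym G i j a

  glue-adj⁺ : ∀ {n} (S : Subset n) H K i j → Adj H i j → Adj (glue S H K) (embed S i) (embed S j)
  glue-adj⁺ (true  ∷ S) (extend N H) K zero    (suc j) a = embedSubset-∈⁺ S a
  glue-adj⁺ (true  ∷ S) (extend N H) K (suc i) zero    a = embedSubset-∈⁺ S a
  glue-adj⁺ (true  ∷ S) (extend N H) K (suc i) (suc j) a = glue-adj⁺ S H K i j a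
  glue-adj⁺ (false ∷ S) H (extend N K) i       j       a = glue-adj⁺ S H K i j a

  glue-adj⁻ : ∀ {n} (S : Subset n) H K i j → Adj (glue S H K) (embed S i) (embed S j) → Adj H i j
  glue-adj⁻ (true  ∷ S) (extend N H) K zero    (suc j) a = embedSubset-∈⁻ S j a
  glue-adj⁻ (true  ∷ S) (extend N H) K (suc i) zero    a = embedSubset-∈⁻ S i a
  glue-adj⁻ (true  ∷ S) (extend N H) K (suc i) (suc j) a = glue-adj⁻ S H K i j a
  glue-adj⁻ (false ∷ S) H (extend N K) i       j       a = glue-adj⁻ S H K i j a

  glue-∁-adj⁺ : ∀ {n} (S : Subset n) H K i j → Adj K i j → Adj (glue S H K) (embed (∁ S) i) (embed (∁ S) j)
  glue-∁-adj⁺ (true  ∷ S) (extend N H) K i       j       a = glue-∁-adj⁺ S H K i j a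
  glue-∁-adj⁺ (false ∷ S) H (extend N K) zero    (suc j) a = embedSubset-∈⁺ (∁ S) a
  glue-∁-adj⁺ (false ∷ S) H (extend N K) (suc i) zero    a = embedSubset-∈⁺ (∁ S) a
  glue-∁-adj⁺ (false ∷ S) H (extend N K) (suc i) (suc j) a = glue-∁-adj⁺ S H K i j a

  glue-∁-adj⁻ : ∀ {n} (S : Subset n) H K i j → Adj (glue S H K) (embed (∁ S) i) (embed (∁ S) j) → Adj K i j
  glue-∁-adj⁻ (true  ∷ S) (extend N H) K i       j       a = glue-∁-adj⁻ S H K i j a
  glue-∁-adj⁻ (false ∷ S) H (extend N K) zero    (suc j) a = embedSubset-∈⁻ (∁ S) j a
  glue-∁-adj⁻ (false ∷ S) H (extend N K) (suc i) zero    a = embedSubset-∈⁻ (∁ S) i a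
  glue-∁-adj⁻ (false ∷ S) H (extend N K) (suc i) (suc j) a = glue-∁-adj⁻ S H K i j a

  glue-closed : ∀ {n} (S : Subset n) H K → Closed S (glue S H K)
  glue-closed (true  ∷ S) (extend N H) K zero    (suc j) a i∈S         = there (embedSubset-⊆ S N a)
  glue-closed (true  ∷ S) (extend N H) K (suc i) zero    a i∈S         = here
  glue-closed (true  ∷ S) (extend N H) K (suc i) (suc j) a (there i∈S) = there (glue-closed S H K i j a i∈S)
  glue-closed (false ∷ S) H (extend N K) (suc i) zero    a (there i∈S) =
    ⊥-elim (x∈∁p⇒x∉p (embedSubset-⊆ (∁ S) N a) i∈S)
  glue-closed (false ∷ S) H (extend N K) (suc i) (suc j) a (there i∈S) = there (glue-closed S H K i j a i∈S)

  closed-reachable : ∀ {n} {S : Subset n} {G i j} → Closed S G → Reachable G i j → i ∈ S → j ∈ S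
  closed-reachable c ε       i∈S = i∈S
  closed-reachable {S = S} {G} c (a ◅ r) i∈S = closed-reachable {S = S} {G} c r (c _ _ a i∈S)

  module _ {n} (S : Subset n) (H : Graph ∣ S ∣) (K : Graph ∣ ∁ S ∣) where

    ∁-closed : Closed (∁ S) (glue S H K)
    ∁-closed i j a i∉S = x∉p⇒x∈∁p (λ j∈S → x∈∁p⇒x∉p i∉S (glue-closed S H K j i (adj-sym (glue S H K) i j a) j∈S))

    glue-reachable⁺ : ∀ {i j} → Reachable H i j → Reachable (glue S H K) (embed S i) (embed S j)
    glue-reachable⁺ = gmap (embed S) (glue-adj⁺ S H K _ _)

    -- The endpoint is arbitrary because the intermediate vertices of a path are not given in the
    -- form `embed S j`; closedness brings each next vertex into that form.
    glue-reachable⁻ : ∀ {i v} → Reachable (glue S H K) (embed S i) v → ∃[ j ] v ≡ embed S j × Reachable H i j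
    glue-reachable⁻ {i} ε = i , refl , ε
    glue-reachable⁻ {i} (a ◅ r) with embed-onto S (glue-closed S H K _ _ a (embed-∈ S i))
    ... | i′ , refl = let j , e , r′ = glue-reachable⁻ r in j , e , (glue-adj⁻ S H K i i′ a ◅ r′)

    glue-∁-reachable⁺ : ∀ {i j} → Reachable K i j → Reachable (glue S H K) (embed (∁ S) i) (embed (∁ S) j)
    glue-∁-reachable⁺ = gmap (embed (∁ S)) (glue-∁-adj⁺ S H K _ _)

    glue-∁-reachable⁻ : ∀ {i v} → Reachable (glue S H K) (embed (∁ S) i) v →
                        ∃[ j ] v ≡ embed (∁ S) j × Reachable K i j
    glue-∁-reachable⁻ {i} ε = i , refl , ε
    glue-∁-reachable⁻ {i} (a ◅ r) with embed-onto (∁ S) (∁-closed _ _ a (embed-∈ (∁ S) i))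
    ... | i′ , refl = let j , e , r′ = glue-∁-reachable⁻ r in j , e , (glue-∁-adj⁻ S H K i i′ a ◅ r′)

  embed-injective : ∀ {n} (S : Subset n) {i j} → embed S i ≡ embed S j → i ≡ j
  embed-injective (true  ∷ S) {zero}  {zero}  e = refl
  embed-injective (true  ∷ S) {suc i} {suc j} e = cong suc (embed-injective S (Fin.suc-injective e))
  embed-injective (false ∷ S) {i}     {j}     e = embed-injective S (Fin.suc-injective e)

  -- Components of a glued graph

  Connected : ∀ {n} → Graph n → Set
  Connected G = ∀ i j → Reachable G i j

  connected? : ∀ {n} (G : Graph n) → Dec (Connected G)
  connected? G = all? (λ i → all? (reachable? G i))

  component-closed : ∀ {n} {S : Subset n} {G} → IsComponent G S → Closed S G
  component-closed (_ , comp) i j a i∈S = Equivalence.from (comp i i∈S j) (a ◅ ε)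

  module _ {n} {S : Subset n} {H : Graph ∣ S ∣} {K : Graph ∣ ∁ S ∣} where

    component⇒connected : IsComponent (glue S H K) S → Connected H
    component⇒connected (_ , comp) i j
      with glue-reachable⁻ S H K (Equivalence.to (comp (embed S i) (embed-∈ S i) (embed S j)) (embed-∈ S j))
    ... | j′ , e , r = subst (Reachable H i) (sym (embed-injective S e)) r

    connected⇒component : Nonempty S → Connected H → IsComponent (glue S H K) S
    connected⇒component S≢∅ conn = S≢∅ , λ v v∈S w → mk⇔ (to v∈S) (λ r → closed-reachable {G = glue S H K} (glue-closed S H K) r v∈S)
      where
      to : ∀ {v w} → v ∈ S → w ∈ S → Reachable (glue S H K) v w
      to v∈S w∈S with embed-onto S v∈S | embed-onto S w∈S
      ... | i , refl | j , refl = glue-reachable⁺ S H K (conn i j)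

    component-∁ : ∀ {T} → IsComponent (glue S H K) (embedSubset (∁ S) T) → IsComponent K T
    component-∁ {T} ((v , v∈T) , comp) = nonempty , λ i i∈T j → mk⇔ (to i∈T) (from i∈T)
      where
      nonempty : Nonempty T
      nonempty with embed-onto (∁ S) (embedSubset-⊆ (∁ S) T v∈T)
      ... | i , refl = i , embedSubset-∈⁻ (∁ S) i v∈T
      to : ∀ {i j} → i ∈ T → j ∈ T → Reachable K i j
      to {i} {j} i∈T j∈T with glue-∁-reachable⁻ S H K
          (Equivalence.to (comp (embed (∁ S) i) (embedSubset-∈⁺ (∁ S) i∈T) (embed (∁ S) j)) (embedSubset-∈⁺ (∁ S) j∈T))
      ... | j′ , e , r = subst (Reachable K i) (sym (embed-injective (∁ S) e)) r
      from : ∀ {i j} → i ∈ T → Reachable K i j → j ∈ T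
      from {i} {j} i∈T r = embedSubset-∈⁻ (∁ S) j (Equivalence.from
        (comp (embed (∁ S) i) (embedSubset-∈⁺ (∁ S) i∈T) (embed (∁ S) j)) (glue-∁-reachable⁺ S H K r))

  components-meet : ∀ {n} {G : Graph n} {S T v} → IsComponent G S → IsComponent G T → v ∈ S → v ∈ T → S ⊆ T
  components-meet (_ , compS) (_ , compT) v∈S v∈T {w} w∈S =
    Equivalence.from (compT _ v∈T w) (Equivalence.to (compS _ v∈S w) w∈S)

  _≟ˢ_ : ∀ {n} (S T : Subset n) → Dec (S ≡ T)
  _≟ˢ_ = ≡-dec Bool._≟_

  ∑-≟ : ∀ {n} (S : Subset n) → ∑ (subsets n) (λ T → 𝟙 (T ≟ˢ S)) ≡ 1
  ∑-≟ []                  = refl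
  ∑-≟ {suc n} (true  ∷ S) = trans (∑-subsets n _) (cong₂ _+_
    (∑-zero (subsets n) (λ T → 𝟙-no ((false ∷ T) ≟ˢ (true ∷ S)) (λ ())))
    (trans (∑-cong (subsets n) (λ T → 𝟙-cong ((true ∷ T) ≟ˢ (true ∷ S)) (T ≟ˢ S) (λ { refl → refl }) (cong (true ∷_)))) (∑-≟ S)))
  ∑-≟ {suc n} (false ∷ S) = trans (∑-subsets n _) (cong₂ _+_
    (trans (∑-cong (subsets n) (λ T → 𝟙-cong ((false ∷ T) ≟ˢ (false ∷ S)) (T ≟ˢ S) (λ { refl → refl }) (cong (false ∷_)))) (∑-≟ S))
    (∑-zero (subsets n) (λ T → 𝟙-no ((true ∷ T) ≟ˢ (false ∷ S)) (λ ()))))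

  componentsOfOrder≡∑ : ∀ {n} k (G : Graph n) →
    componentsOfOrder k G ≡ ∑ (subsets n) (λ S → 𝟙 (isComponent? G S ×-dec (∣ S ∣ ≟ k)))
  componentsOfOrder≡∑ {n} k G = length-filter≡∑ (λ S → isComponent? G S ×-dec (∣ S ∣ ≟ k)) (subsets n)

  -- S itself counts at most once. Any other component misses S by `components-meet`, hence lies in
  -- the complement and is a component of K. An inequality is enough because the second moment is
  -- only bounded from above.
  componentsOfOrder-glue : ∀ {n} (S : Subset n) H K k → Nonempty S → Connected H →
                           componentsOfOrder k (glue S H K) ≤ suc (componentsOfOrder k K)
  componentsOfOrder-glue {n} S H K k S≢∅ conn = begin
    componentsOfOrder k G
      ≡⟨ componentsOfOrder≡∑ k G ⟩
    ∑ (subsets n) (λ T → 𝟙 (P? T))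
      ≤⟨ ∑-mono (subsets n) (λ T → split (P? T) (T ≟ˢ S)) ⟩
    ∑ (subsets n) (λ T → 𝟙 (T ≟ˢ S) + 𝟙 (P? T ×-dec ¬? (T ≟ˢ S)))
      ≡⟨ ∑-+ (subsets n) _ _ ⟩
    ∑ (subsets n) (λ T → 𝟙 (T ≟ˢ S)) + ∑ (subsets n) (λ T → 𝟙 (P? T ×-dec ¬? (T ≟ˢ S)))
      ≡⟨ cong₂ _+_ (∑-≟ S) (∑-embedSubset (∁ S) _ (λ T T⊈∁S → 𝟙-no (P? T ×-dec ¬? (T ≟ˢ S))
           (λ ((comp , _) , T≢S) → T⊈∁S (λ v∈T → x∉p⇒x∈∁p (λ v∈S → T≢S
             (⊆-antisym (components-meet {G = G} comp S-comp v∈T v∈S) (components-meet {G = G} S-comp comp v∈S v∈T))))))) ⟩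
    1 + ∑ (subsets ∣ ∁ S ∣) (λ T → 𝟙 (P? (embedSubset (∁ S) T) ×-dec ¬? (embedSubset (∁ S) T ≟ˢ S)))
      ≤⟨ +-monoʳ-≤ 1 (∑-mono (subsets ∣ ∁ S ∣) (λ T → 𝟙-mono
           (P? (embedSubset (∁ S) T) ×-dec ¬? (embedSubset (∁ S) T ≟ˢ S))
           (isComponent? K T ×-dec (∣ T ∣ ≟ k))
           (λ ((comp , size) , _) → component-∁ comp , trans (sym (∣embedSubset∣ (∁ S) T)) size))) ⟩
    1 + ∑ (subsets ∣ ∁ S ∣) (λ T → 𝟙 (isComponent? K T ×-dec (∣ T ∣ ≟ k)))
      ≡⟨ cong suc (sym (componentsOfOrder≡∑ k K)) ⟩
    suc (componentsOfOrder k K) ∎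
    where
    open ≤-Reasoning
    G = glue S H K
    S-comp = connected⇒component {H = H} {K} S≢∅ conn
    P? : ∀ T → Dec (IsComponent G T × ∣ T ∣ ≡ k)
    P? T = isComponent? G T ×-dec (∣ T ∣ ≟ k)
    split : {P Q : Set} (p? : Dec P) (q? : Dec Q) → 𝟙 p? ≤ 𝟙 q? + 𝟙 (p? ×-dec ¬? q?)
    split (yes p) (yes q) = s≤s z≤n
    split (yes p) (no ¬q) = s≤s z≤n
    split (no ¬p) q?      = z≤n

  -- Moments of the number of components

  -- A connected graph on the vertex set of a component enters the moments only through its number
  -- of edges, so the list records these numbers with multiplicity.
  connectedEdges : ℕ → List ℕ
  connectedEdges k = map edges (filter connected? (graphs k))

  ∑-connected : ∀ k (f : ℕ → ℕ) → ∑ (graphs k) (λ H → 𝟙 (connected? H) * f (edges H)) ≡ ∑ (connectedEdges k) f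
  ∑-connected k f = sym (trans (∑-map edges (filter connected? (graphs k)) f)
    (∑-filter connected? (graphs k) (f ∘ edges)))

  reachable-sym : ∀ {n} (G : Graph n) {i j} → Reachable G i j → Reachable G j i
  reachable-sym G = reverse (λ {i} {j} → adj-sym G i j)

  connected⇒covers : ∀ {k} (H : Graph (suc k)) → Connected H → Covers (inside ∷ ⊥) H
  connected⇒covers H conn v = zero , here , conn zero v

  covers⇒connected : ∀ {k} (H : Graph (suc k)) → Covers (inside ∷ ⊥) H → Connected H
  covers⇒connected H c i j = reachable-sym H (from-zero i) ◅◅ from-zero j
    where
    from-zero : ∀ v → Reachable H zero v
    from-zero v with c v
    ... | zero  , _         , r = r
    ... | suc u , there u∈⊥ , _ = ⊥-elim (∉⊥ u∈⊥)

  -- The bound for forests applied to the single root zero. It ensures that no connected graph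
  -- outweighs the trees by a power of n.
  connectedEdges-≥ : ∀ k → All (λ e → k ≤ suc e) (connectedEdges k)
  connectedEdges-≥ k = All.map⁺ (All.map (λ {H} → bound k H) (All.all-filter connected? (graphs k)))
    where
    bound : ∀ k (H : Graph k) → Connected H → k ≤ suc (edges H)
    bound zero    H conn = z≤n
    bound (suc k) H conn = ≤-trans (covers⇒≤ (inside ∷ ⊥) H (connected⇒covers H conn))
      (≤-reflexive (trans (cong (λ s → edges H + suc s) (∣⊥∣≡0 k)) (+-comm (edges H) 1)))

  -- A tree is a graph with k - 1 edges in which vertex zero reaches everything, that is, a forest
  -- with the one root zero; `cayley-rooted` then gives k t = k^(k-1).
  cayley : ∀ {k} → 1 ≤ k → ∑ (connectedEdges k) (λ e → 𝟙 (suc e ≟ k)) ≡ k ^ (k ∸ 2)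
  cayley {suc k} _ = trans (sym (∑-connected (suc k) _)) (trans
    (∑-cong (graphs (suc k)) (λ H → trans (sym (𝟙-× (connected? H) (suc (edges H) ≟ suc k)))
      (𝟙-cong (connected? H ×-dec (suc (edges H) ≟ suc k))
        (covers? (inside ∷ ⊥) H ×-dec (edges H + ∣ inside ∷ ⊥ {k} ∣ ≟ suc k))
        (λ (conn , e) → connected⇒covers H conn , trans (shift H) e)
        (λ (cov , e) → covers⇒connected H cov , trans (sym (shift H)) e))))
    (trees k (subst (λ s → suc k * rootedForests (inside ∷ ⊥ {k}) ≡ suc s * suc k ^ (k ∸ s)) (∣⊥∣≡0 k)
      (cayley-rooted (inside ∷ ⊥ {k})))))
    where
    shift : ∀ (H : Graph (suc k)) → edges H + ∣ inside ∷ ⊥ {k} ∣ ≡ suc (edges H)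
    shift H = trans (cong (λ s → edges H + suc s) (∣⊥∣≡0 k)) (+-comm (edges H) 1)
    -- This k is one less than the number of vertices. For k = 0 the exponent `k ∸ 1` is truncated,
    -- and the count is 1.
    trees : ∀ k {t} → suc k * t ≡ 1 * suc k ^ k → t ≡ suc k ^ (k ∸ 1)
    trees zero    {t} h = trans (sym (*-identityˡ t)) h
    trees (suc k) {t} h = *-cancelˡ-≡ t _ (suc (suc k)) (trans h (*-identityˡ _))

  -- The condition `e + edges G ≟ m` makes the count zero for e > m, where m ∸ e would wrongly admit
  -- the empty graph.
  graphCount : ℕ → ℕ → ℕ → ℕ
  graphCount n e m = ∑ (graphs n) (λ G → 𝟙 (e + edges G ≟ m))

  graphCount≡choose : ∀ n {e m} → e ≤ m → graphCount n e m ≡ choose (tri n) (m ∸ e)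
  graphCount≡choose n {e} {m} e≤m = trans (∑-edges n (λ j → 𝟙 (e + j ≟ m))) (trans
    (binomialSum-cong (tri n) (λ {j} _ → 𝟙-cong (e + j ≟ m) (j ≟ m ∸ e)
      (λ h → +-cancelˡ-≡ e j _ (trans h (sym (m+[n∸m]≡n e≤m))))
      (λ h → trans (cong (e +_) h) (m+[n∸m]≡n e≤m))))
    (binomialSum-≟ (tri n) (m ∸ e)))

  length-𝔾 : ∀ n m → length (𝔾 n m) ≡ choose (tri n) m
  length-𝔾 n m = trans (length-filter≡∑ (λ G → edges G ≟ m) (graphs n)) (graphCount≡choose n {0} z≤n)

  1≤∣S∣⇒nonempty : ∀ {n} (S : Subset n) → 1 ≤ ∣ S ∣ → Nonempty S
  1≤∣S∣⇒nonempty (true  ∷ S) _ = zero , here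
  1≤∣S∣⇒nonempty (false ∷ S) h = let i , i∈S = 1≤∣S∣⇒nonempty S h in suc i , there i∈S

  ∑-component : ∀ {n k} (S : Subset n) (w : Graph n → ℕ) → ∣ S ∣ ≡ k → 1 ≤ k →
    ∑ (graphs n) (λ G → 𝟙 (isComponent? G S) * w G) ≡
    ∑ (graphs ∣ S ∣) (λ H → 𝟙 (connected? H) * ∑ (graphs ∣ ∁ S ∣) (λ K → w (glue S H K)))
  ∑-component {n} S w refl 1≤ = trans
    (∑-glue S _ (λ G ¬closed → cong (_* w G) (𝟙-no (isComponent? G S) (¬closed ∘ component-closed {G = G}))))
    (∑-cong (graphs ∣ S ∣) (λ H → trans
      (∑-cong (graphs ∣ ∁ S ∣) (λ K → cong (_* w (glue S H K))
        (𝟙-cong (isComponent? (glue S H K) S) (connected? H) (component⇒connected {H = H} {K}) (connected⇒component (1≤∣S∣⇒nonempty S 1≤)))))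
      (∑-*ˡ (graphs ∣ ∁ S ∣) (𝟙 (connected? H)) _)))

  ∑-componentsOfOrder : ∀ n k (w : Graph n → ℕ) →
    ∑ (graphs n) (λ G → w G * componentsOfOrder k G) ≡
    ∑ (subsets n) (λ S → 𝟙 (∣ S ∣ ≟ k) * ∑ (graphs n) (λ G → 𝟙 (isComponent? G S) * w G))
  ∑-componentsOfOrder n k w = begin
    ∑ (graphs n) (λ G → w G * componentsOfOrder k G)
      ≡⟨ ∑-cong (graphs n) (λ G → trans (cong (w G *_) (componentsOfOrder≡∑ k G)) (sym (∑-*ˡ (subsets n) (w G) _))) ⟩
    ∑ (graphs n) (λ G → ∑ (subsets n) (λ S → w G * 𝟙 (isComponent? G S ×-dec (∣ S ∣ ≟ k))))
      ≡⟨ ∑-swap (graphs n) (subsets n) _ ⟩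
    ∑ (subsets n) (λ S → ∑ (graphs n) (λ G → w G * 𝟙 (isComponent? G S ×-dec (∣ S ∣ ≟ k))))
      ≡⟨ ∑-cong (subsets n) (λ S → trans
           (∑-cong (graphs n) (λ G → trans (cong (w G *_) (𝟙-× (isComponent? G S) (∣ S ∣ ≟ k)))
             (rearrange (w G) (𝟙 (isComponent? G S)) (𝟙 (∣ S ∣ ≟ k)))))
           (∑-*ˡ (graphs n) (𝟙 (∣ S ∣ ≟ k)) _)) ⟩
    ∑ (subsets n) (λ S → 𝟙 (∣ S ∣ ≟ k) * ∑ (graphs n) (λ G → 𝟙 (isComponent? G S) * w G)) ∎
    where
    open ≡-Reasoning
    rearrange : ∀ a b c → a * (b * c) ≡ c * (b * a)
    rearrange = solve-∀

  ∑-∣S∣≟ : ∀ n k c → ∑ (subsets n) (λ S → 𝟙 (∣ S ∣ ≟ k) * c) ≡ choose n k * c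
  ∑-∣S∣≟ n k c = trans (∑-*ʳ (subsets n) c _) (cong (_* c) (trans (∑-size n (λ s → 𝟙 (s ≟ k))) (binomialSum-≟ n k)))

  -- The offset e holds the edges of a component that has been split off already: e = 0 gives the
  -- sum of X itself, and other values arise in the count of pairs.
  firstMoment : ℕ → ℕ → ℕ → ℕ → ℕ
  firstMoment k n e m = ∑ (graphs n) (λ G → 𝟙 (e + edges G ≟ m) * componentsOfOrder k G)

  firstMoment≡ : ∀ {k} n e m → 1 ≤ k →
    firstMoment k n e m ≡ choose n k * ∑ (connectedEdges k) (λ a → graphCount (n ∸ k) (e + a) m)
  firstMoment≡ {k} n e m 1≤k = trans (∑-componentsOfOrder n k (λ G → 𝟙 (e + edges G ≟ m))) (trans
    (∑-cong (subsets n) (λ S → 𝟙-*-cong (∣ S ∣ ≟ k) (λ size → trans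
      (∑-component S (λ G → 𝟙 (e + edges G ≟ m)) size 1≤k) (trans
      (∑-cong (graphs ∣ S ∣) (λ H → cong (𝟙 (connected? H) *_)
        (∑-cong (graphs ∣ ∁ S ∣) (λ K → cong (λ z → 𝟙 (z ≟ m))
          (trans (cong (e +_) (edges-glue S H K)) (sym (+-assoc e (edges H) (edges K))))))))
      (trans (cong₂ (λ i j → ∑ (graphs i) (λ H → 𝟙 (connected? H) * graphCount j (e + edges H) m))
                size (trans (∣∁p∣≡n∸∣p∣ S) (cong (n ∸_) size)))
             (∑-connected k _))))))
    (∑-∣S∣≟ n k _))

  -- One factor X is unfolded into a sum over components S, while the other joins the weight and is
  -- at most 1 + X(K) for the remaining graph K. The 1 accounts for the diagonal of the double sum,
  -- and X(K) for the ordered pairs of distinct components.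
  secondMoment-≤ : ∀ {k} n m → 1 ≤ k →
    ∑ (graphs n) (λ G → 𝟙 (edges G ≟ m) * (componentsOfOrder k G * componentsOfOrder k G)) ≤
    choose n k * ∑ (connectedEdges k) (λ a → graphCount (n ∸ k) a m + firstMoment k (n ∸ k) a m)
  secondMoment-≤ {k} n m 1≤k = begin
    ∑ (graphs n) (λ G → 𝟙 (edges G ≟ m) * (X G * X G))
      ≡⟨ ∑-cong (graphs n) (λ G → sym (*-assoc (𝟙 (edges G ≟ m)) (X G) (X G))) ⟩
    ∑ (graphs n) (λ G → w G * X G)
      ≡⟨ ∑-componentsOfOrder n k w ⟩
    ∑ (subsets n) (λ S → 𝟙 (∣ S ∣ ≟ k) * ∑ (graphs n) (λ G → 𝟙 (isComponent? G S) * w G))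
      ≤⟨ ∑-mono (subsets n) (λ S → 𝟙-*-mono (∣ S ∣ ≟ k) (step S)) ⟩
    ∑ (subsets n) (λ S → 𝟙 (∣ S ∣ ≟ k) * ∑ (connectedEdges k) (λ a → graphCount (n ∸ k) a m + firstMoment k (n ∸ k) a m))
      ≡⟨ ∑-∣S∣≟ n k _ ⟩
    choose n k * ∑ (connectedEdges k) (λ a → graphCount (n ∸ k) a m + firstMoment k (n ∸ k) a m) ∎
    where
    open ≤-Reasoning
    X : ∀ {n} → Graph n → ℕ
    X = componentsOfOrder k
    w : Graph n → ℕ
    w G = 𝟙 (edges G ≟ m) * X G
    step : ∀ S → ∣ S ∣ ≡ k → ∑ (graphs n) (λ G → 𝟙 (isComponent? G S) * w G) ≤
           ∑ (connectedEdges k) (λ a → graphCount (n ∸ k) a m + firstMoment k (n ∸ k) a m)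
    step S size = begin
      ∑ (graphs n) (λ G → 𝟙 (isComponent? G S) * w G)
        ≡⟨ ∑-component S w size 1≤k ⟩
      ∑ (graphs ∣ S ∣) (λ H → 𝟙 (connected? H) * ∑ (graphs ∣ ∁ S ∣) (λ K → w (glue S H K)))
        ≤⟨ ∑-mono (graphs ∣ S ∣) (λ H → 𝟙-*-mono (connected? H) (λ conn → ∑-mono (graphs ∣ ∁ S ∣) (λ K → begin
             𝟙 (edges (glue S H K) ≟ m) * X (glue S H K)
               ≡⟨ cong (λ z → 𝟙 (z ≟ m) * X (glue S H K)) (edges-glue S H K) ⟩
             𝟙 (edges H + edges K ≟ m) * X (glue S H K)
               ≤⟨ *-monoʳ-≤ (𝟙 (edges H + edges K ≟ m)) (componentsOfOrder-glue S H K k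
                    (1≤∣S∣⇒nonempty S (subst (1 ≤_) (sym size) 1≤k)) conn) ⟩
             𝟙 (edges H + edges K ≟ m) * suc (X K)
               ≡⟨ *-suc (𝟙 (edges H + edges K ≟ m)) (X K) ⟩
             𝟙 (edges H + edges K ≟ m) + 𝟙 (edges H + edges K ≟ m) * X K ∎))) ⟩
      ∑ (graphs ∣ S ∣) (λ H → 𝟙 (connected? H) * ∑ (graphs ∣ ∁ S ∣) (λ K →
          𝟙 (edges H + edges K ≟ m) + 𝟙 (edges H + edges K ≟ m) * X K))
        ≡⟨ ∑-cong (graphs ∣ S ∣) (λ H → cong (𝟙 (connected? H) *_) (∑-+ (graphs ∣ ∁ S ∣) _ _)) ⟩
      ∑ (graphs ∣ S ∣) (λ H → 𝟙 (connected? H) *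
          (graphCount (∣ ∁ S ∣) (edges H) m + firstMoment k (∣ ∁ S ∣) (edges H) m))
        ≡⟨ cong₂ (λ i j → ∑ (graphs i) (λ H → 𝟙 (connected? H) * (graphCount j (edges H) m + firstMoment k j (edges H) m)))
             size (trans (∣∁p∣≡n∸∣p∣ S) (cong (n ∸_) size)) ⟩
      ∑ (graphs k) (λ H → 𝟙 (connected? H) * (graphCount (n ∸ k) (edges H) m + firstMoment k (n ∸ k) (edges H) m))
        ≡⟨ ∑-connected k _ ⟩
      ∑ (connectedEdges k) (λ a → graphCount (n ∸ k) a m + firstMoment k (n ∸ k) a m) ∎

module Limits where

  open import Data.Empty using (⊥-elim)
  open import Data.Integer.Base using (+_)
  import Data.Integer.Base as ℤ
  import Data.Integer.Properties as ℤₚ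
  open import Data.List.Base using (List; []; _∷_; length; filter)
  open import Data.List.Relation.Binary.Sublist.Propositional.Properties using (filter-⊆)
  import Data.List.Relation.Unary.All as All
  open import Data.List.Relation.Unary.All using (All; []; _∷_)
  open import Data.List.Relation.Unary.All.Properties using (all-filter)
  open import Data.Maybe.Base using (just; nothing)
  open import Data.Nat.Base using (ℕ; zero; suc; z≤n; s≤s; _!)
  import Data.Nat.Base as ℕ
  import Data.Nat.Properties as ℕₚ
  import Data.Nat.Tactic.RingSolver as ℕ-Solver
  open import Data.Rational.Base using (ℚ; 0ℚ; 1ℚ; ½; _+_; _*_; _-_; -_; _/_; _≤_; _<_; ∣_∣; positive; nonNegative)
  import Data.Rational.Base as ℚ
  open import Data.Rational.Properties
  import Data.Rational.Unnormalised.Base as ℚᵘ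
  import Data.Rational.Unnormalised.Properties as ℚᵘₚ
  open import Data.Sum.Base using (_⊎_; inj₁; inj₂)
  open import Function.Base using (_∘_; id)
  open import Level using (0ℓ)
  open import Relation.Binary.PropositionalEquality
  open import Relation.Nullary using (Dec; yes; no; ¬_)
  open import Tactic.RingSolver using (solve-∀)
  open import Tactic.RingSolver.Core.AlmostCommutativeRing using (AlmostCommutativeRing; fromCommutativeRing)
  open GraphCounting using (∑; 𝟙; 𝟙-yes; 𝟙-no; ∑-+; ∑-filter; tri; choose; choose->; choose>0; choose-upper; choose-step;
    connectedEdges; connectedEdges-≥; cayley; graphCount; graphCount≡choose; length-𝔾; firstMoment; firstMoment≡; secondMoment-≤)

  -- Sequences of rationals

  ℚ-ring : AlmostCommutativeRing 0ℓ 0ℓ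
  ℚ-ring = fromCommutativeRing +-*-commutativeRing isZero
    where
    isZero : ∀ x → _
    isZero x with 0ℚ ≟ x
    ... | yes 0≡x = just 0≡x
    ... | no  _   = nothing

  -- ι is abstract because the numerals + n / 1 would otherwise unfold to gcd computations.
  abstract
    ι : ℕ → ℚ
    ι n = + n / 1

    ι≡ : ∀ n → ι n ≡ + n / 1
    ι≡ n = refl

    toℚᵘ-ι : ∀ n → ℚ.toℚᵘ (ι n) ℚᵘ.≃ ℚᵘ.mkℚᵘ (+ n) 0
    toℚᵘ-ι n = toℚᵘ-fromℚᵘ (ℚᵘ.mkℚᵘ (+ n) 0)

  ι-0 : ι 0 ≡ 0ℚ
  ι-0 = ι≡ 0

  ι-1 : ι 1 ≡ 1ℚ
  ι-1 = ι≡ 1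

  ι-+ : ∀ a b → ι (a ℕ.+ b) ≡ ι a + ι b
  ι-+ a b = toℚᵘ-injective (ℚᵘₚ.≃-trans (toℚᵘ-ι (a ℕ.+ b)) (ℚᵘₚ.≃-sym
    (ℚᵘₚ.≃-trans (toℚᵘ-homo-+ (ι a) (ι b)) (ℚᵘₚ.≃-trans (ℚᵘₚ.+-cong (toℚᵘ-ι a) (toℚᵘ-ι b))
      (ℚᵘ.*≡* (cong (ℤ._* + 1) (cong₂ ℤ._+_ (ℤₚ.*-identityʳ (+ a)) (ℤₚ.*-identityʳ (+ b)))))))))

  ι-* : ∀ a b → ι (a ℕ.* b) ≡ ι a * ι b
  ι-* a b = toℚᵘ-injective (ℚᵘₚ.≃-trans (toℚᵘ-ι (a ℕ.* b)) (ℚᵘₚ.≃-sym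
    (ℚᵘₚ.≃-trans (toℚᵘ-homo-* (ι a) (ι b)) (ℚᵘₚ.≃-trans (ℚᵘₚ.*-cong (toℚᵘ-ι a) (toℚᵘ-ι b))
      (ℚᵘ.*≡* (cong (ℤ._* + 1) (sym (ℤₚ.pos-* a b))))))))

  ι-mono : ∀ {a b} → a ℕ.≤ b → ι a ≤ ι b
  ι-mono {a} {b} a≤b = toℚᵘ-cancel-≤ (ℚᵘₚ.≤-trans (ℚᵘₚ.≤-reflexive (toℚᵘ-ι a)) (ℚᵘₚ.≤-trans
    (ℚᵘ.*≤* (ℤₚ.*-monoʳ-≤-nonNeg (+ 1) (ℤ.+≤+ a≤b))) (ℚᵘₚ.≤-reflexive (ℚᵘₚ.≃-sym (toℚᵘ-ι b)))))

  ι≥0 : ∀ n → 0ℚ ≤ ι n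
  ι≥0 n = ≤-trans (≤-reflexive (sym ι-0)) (ι-mono z≤n)

  ι>0 : ∀ {n} → 1 ℕ.≤ n → 0ℚ < ι n
  ι>0 1≤n = <-≤-trans (positive⁻¹ 1ℚ) (≤-trans (≤-reflexive (sym ι-1)) (ι-mono 1≤n))

  ι-suc : ∀ n → ι (suc n) ≡ 1ℚ + ι n
  ι-suc n = trans (ι-+ 1 n) (cong (_+ ι n) ι-1)

  ι-∸-≤ : ∀ a b → ι a - ι b ≤ ι (a ℕ.∸ b)
  ι-∸-≤ a b = begin
    ι a - ι b                       ≤⟨ +-monoˡ-≤ (- ι b) (ι-mono (ℕₚ.m≤n+m∸n a b)) ⟩
    ι (b ℕ.+ (a ℕ.∸ b)) - ι b       ≡⟨ cong (_- ι b) (ι-+ b (a ℕ.∸ b)) ⟩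
    ι b + ι (a ℕ.∸ b) - ι b         ≡⟨ cancel (ι b) (ι (a ℕ.∸ b)) ⟩
    ι (a ℕ.∸ b)                     ∎
    where
    open ≤-Reasoning
    cancel : ∀ p q → p + q - p ≡ q
    cancel = solve-∀ ℚ-ring

  -- 1/n, with the junk value 0 at n = 0
  recip : ℕ → ℚ
  recip zero    = 0ℚ
  recip (suc n) = + 1 / suc n

  ι*recip : ∀ {n} → 1 ℕ.≤ n → ι n * recip n ≡ 1ℚ
  ι*recip {suc n} _ = trans (cong (_* (+ 1 / suc n)) (ι≡ (suc n))) (suc*1/suc n)

  recip≥0 : ∀ n → 0ℚ ≤ recip n
  recip≥0 zero    = ≤-refl
  recip≥0 (suc n) = <⇒≤ (1/suc>0 n)

  *-monoʳ : ∀ {p q r} → 0ℚ ≤ r → p ≤ q → p * r ≤ q * r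
  *-monoʳ {r = r} 0≤r = *-monoʳ-≤-nonNeg r {{nonNegative 0≤r}}

  *-monoˡ : ∀ {p q r} → 0ℚ ≤ r → p ≤ q → r * p ≤ r * q
  *-monoˡ {r = r} 0≤r = *-monoˡ-≤-nonNeg r {{nonNegative 0≤r}}

  *-pos : ∀ {p q} → 0ℚ < p → 0ℚ < q → 0ℚ < p * q
  *-pos {p} {q} 0<p 0<q = positive⁻¹ (p * q) {{pos*pos⇒pos p {{positive 0<p}} q {{positive 0<q}}}}

  *-cancelʳ-≤ : ∀ {p q r} → 0ℚ < r → p * r ≤ q * r → p ≤ q
  *-cancelʳ-≤ {r = r} 0<r = *-cancelʳ-≤-pos r {{positive 0<r}}

  ∣p∣≤-intro : ∀ {p δ} → p ≤ δ → - p ≤ δ → ∣ p ∣ ≤ δ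
  ∣p∣≤-intro {p} h₁ h₂ with ∣p∣≡p∨∣p∣≡-p p
  ... | inj₁ e = ≤-trans (≤-reflexive e) h₁
  ... | inj₂ e = ≤-trans (≤-reflexive e) h₂

  square≥0 : ∀ p → 0ℚ ≤ p * p
  square≥0 p with ≤-total 0ℚ p
  ... | inj₁ 0≤p = *-nonNeg p p 0≤p 0≤p
  ... | inj₂ p≤0 = ≤-trans (*-nonNeg (- p) (- p) (neg-antimono-≤ p≤0) (neg-antimono-≤ p≤0)) (≤-reflexive (neg² p))
    where
    neg² : ∀ p → - p * - p ≡ p * p
    neg² = solve-∀ ℚ-ring

  half-diff : ∀ a → a - ½ * a ≡ ½ * a
  half-diff = solve-∀ ℚ-ring

  p≤∣p∣ : ∀ p → p ≤ ∣ p ∣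
  p≤∣p∣ p with ≤-total 0ℚ p
  ... | inj₁ 0≤p = ≤-reflexive (sym (0≤p⇒∣p∣≡p 0≤p))
  ... | inj₂ p≤0 = ≤-trans p≤0 (0≤∣p∣ p)

  -p≤∣p∣ : ∀ p → - p ≤ ∣ p ∣
  -p≤∣p∣ p = ≤-trans (p≤∣p∣ (- p)) (≤-reflexive (∣-p∣≡∣p∣ p))

  ∣-∣-triangle : ∀ p q r → ∣ p - r ∣ ≤ ∣ p - q ∣ + ∣ q - r ∣
  ∣-∣-triangle p q r = ≤-trans (≤-reflexive (cong ∣_∣ (split p q r))) (∣p+q∣≤∣p∣+∣q∣ (p - q) (q - r))
    where
    split : ∀ p q r → p - r ≡ (p - q) + (q - r)
    split = solve-∀ ℚ-ring

  p≤q+∣p-q∣ : ∀ p q → p ≤ q + ∣ p - q ∣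
  p≤q+∣p-q∣ p q = ≤-trans (≤-reflexive (split p q)) (+-monoʳ-≤ q (p≤∣p∣ (p - q)))
    where
    split : ∀ p q → p ≡ q + (p - q)
    split = solve-∀ ℚ-ring

  p≤∣p-q∣+q : ∀ p q → p - ∣ p - q ∣ ≤ q
  p≤∣p-q∣+q p q = ≤-trans (+-monoʳ-≤ p (neg-antimono-≤ (p≤∣p∣ (p - q)))) (≤-reflexive (split p q))
    where
    split : ∀ p q → p - (p - q) ≡ q
    split = solve-∀ ℚ-ring

  always : ∀ {P : ℕ → Set} → (∀ n → P n) → Eventually P
  always h = 0 , λ _ → h _

  ev-map : ∀ {P Q : ℕ → Set} → (∀ {n} → P n → Q n) → Eventually P → Eventually Q
  ev-map f (N , p) = N , f ∘ p

  ev-zip : ∀ {P Q R : ℕ → Set} → (∀ {n} → P n → Q n → R n) → Eventually P → Eventually Q → Eventually R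
  ev-zip f (N , p) (M , q) = N ℕ.⊔ M , λ h → f (p (ℕₚ.m⊔n≤o⇒m≤o N M h)) (q (ℕₚ.m⊔n≤o⇒n≤o N M h))

  ev-≥ : ∀ N → Eventually (N ℕ.≤_)
  ev-≥ N = N , id

  infix 4 _≈_

  -- Two sequences with the same limit, compared index by index: this lets a limit be named by a
  -- Cauchy sequence instead of a number.
  record _≈_ (u v : ℕ → ℚ) : Set where
    constructor mk≈
    field
      close : ∀ {δ} → 0ℚ < δ → Eventually (λ n → ∣ u n - v n ∣ ≤ δ)
  open _≈_ public

  -- Limits are sequences rather than numbers, so the boundedness that makes `≈` a congruence for
  -- products has to be tracked explicitly.
  record Bounded (u : ℕ → ℚ) : Set where
    constructor bounded
    field
      bound     : ℚ
      bound>0   : 0ℚ < bound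
      ≤bound    : Eventually (λ n → ∣ u n ∣ ≤ bound)

  ≈-eventually : ∀ {u v} → Eventually (λ n → u n ≡ v n) → u ≈ v
  ≈-eventually {u} {v} (N , h) = mk≈ λ {δ} 0<δ → N , λ {n} N≤n → begin
    ∣ u n - v n ∣ ≡⟨ cong (λ z → ∣ z - v n ∣) (h N≤n) ⟩
    ∣ v n - v n ∣ ≡⟨ cong ∣_∣ (+-inverseʳ (v n)) ⟩
    0ℚ           ≤⟨ <⇒≤ 0<δ ⟩
    δ            ∎
    where open ≤-Reasoning

  ≈-pointwise : ∀ {u v} → (∀ n → u n ≡ v n) → u ≈ v
  ≈-pointwise h = ≈-eventually (always h)

  ≈-refl : ∀ {u} → u ≈ u
  ≈-refl = ≈-pointwise (λ _ → refl)

  ≈-sym : ∀ {u v} → u ≈ v → v ≈ u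
  ≈-sym {u} {v} h = mk≈ λ 0<δ → ev-map (λ {n} → ≤-trans (≤-reflexive (∣∣-swap (v n) (u n)))) (close h 0<δ)

  ≈-trans : ∀ {u v w} → u ≈ v → v ≈ w → u ≈ w
  ≈-trans {u} {v} {w} h k = mk≈ λ {δ} 0<δ → ev-zip
    (λ {n} p q → ≤-trans (∣-∣-triangle (u n) (v n) (w n)) (≤-trans (+-mono-≤ p q) (≤-reflexive (half+half δ))))
    (close h (half-pos 0<δ)) (close k (half-pos 0<δ))

  ≈-+ : ∀ {u u′ v v′} → u ≈ u′ → v ≈ v′ → (λ n → u n + v n) ≈ (λ n → u′ n + v′ n)
  ≈-+ {u} {u′} {v} {v′} h k = mk≈ λ {δ} 0<δ → ev-zip
    (λ {n} p q → ≤-trans (≤-reflexive (cong ∣_∣ (sum-diff (u n) (v n) (u′ n) (v′ n))))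
      (≤-trans (∣p+q∣≤∣p∣+∣q∣ (u n - u′ n) (v n - v′ n)) (≤-trans (+-mono-≤ p q) (≤-reflexive (half+half δ)))))
    (close h (half-pos 0<δ)) (close k (half-pos 0<δ))

  ≈-neg : ∀ {u u′} → u ≈ u′ → (λ n → - u n) ≈ (λ n → - u′ n)
  ≈-neg {u} {u′} h = mk≈ λ 0<δ → ev-map
    (λ {n} → ≤-trans (≤-reflexive (trans (cong ∣_∣ (diff-neg (u n) (u′ n))) (∣∣-swap (u′ n) (u n))))) (close h 0<δ)

  ≈-* : ∀ {u u′ v v′} → Bounded u → Bounded v′ → u ≈ u′ → v ≈ v′ → (λ n → u n * v n) ≈ (λ n → u′ n * v′ n)
  ≈-* {u} {u′} {v} {v′} (bounded A 0<A hA) (bounded B 0<B hB) h k = mk≈ λ {δ} 0<δ →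
    let α , 0<α , Aα = shrink 0<A (half-pos 0<δ)
        β , 0<β , Bβ = shrink 0<B (half-pos 0<δ)
    in ev-zip (λ {n} (a , b) (p , q) → product-close {u n} {v n} {u′ n} {v′ n} 0<α 0<β a b q p Aα Bβ)
         (ev-zip _,_ hA hB) (ev-zip _,_ (close h 0<β) (close k 0<α))

  const-bounded : ∀ q → Bounded (λ _ → q)
  const-bounded q = bounded (∣ q ∣ + 1ℚ) (<-≤-trans (positive⁻¹ 1ℚ) (≤-trans (≤-reflexive (sym (+-identityˡ 1ℚ))) (+-monoˡ-≤ 1ℚ (0≤∣p∣ q))))
    (always (λ _ → ≤-trans (≤-reflexive (sym (+-identityʳ ∣ q ∣))) (+-monoʳ-≤ ∣ q ∣ (nonNegative⁻¹ 1ℚ))))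

  cauchy-bounded : ∀ {u} → Cauchy u → Bounded u
  cauchy-bounded {u} c = let B , 0<B , h = eventually-bounded {u} c in bounded B 0<B h

  ≈-bounded : ∀ {u v} → u ≈ v → Bounded v → Bounded u
  ≈-bounded {u} {v} h (bounded B 0<B hB) = bounded (1ℚ + B) (<-≤-trans 0<B (≤-trans (≤-reflexive (sym (+-identityˡ B))) (+-monoˡ-≤ B (nonNegative⁻¹ 1ℚ))))
    (ev-zip (λ {n} p q → begin
        ∣ u n ∣                   ≡⟨ cong ∣_∣ (add-sub (u n) (v n)) ⟩
        ∣ (u n - v n) + v n ∣     ≤⟨ ∣p+q∣≤∣p∣+∣q∣ (u n - v n) (v n) ⟩
        ∣ u n - v n ∣ + ∣ v n ∣   ≤⟨ +-mono-≤ p q ⟩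
        1ℚ + B                  ∎)
      (close h (positive⁻¹ 1ℚ)) hB)
    where open ≤-Reasoning

  bounded-+ : ∀ {u v} → Bounded u → Bounded v → Bounded (λ n → u n + v n)
  bounded-+ {u} {v} (bounded A 0<A hA) (bounded B 0<B hB) = bounded (A + B) (+-mono-< 0<A 0<B)
    (ev-zip (λ {n} p q → ≤-trans (∣p+q∣≤∣p∣+∣q∣ (u n) (v n)) (+-mono-≤ p q)) hA hB)

  bounded-neg : ∀ {u} → Bounded u → Bounded (λ n → - u n)
  bounded-neg {u} (bounded A 0<A hA) = bounded A 0<A (ev-map (λ {n} → ≤-trans (≤-reflexive (∣-p∣≡∣p∣ (u n)))) hA)

  bounded-* : ∀ {u v} → Bounded u → Bounded v → Bounded (λ n → u n * v n)
  bounded-* {u} {v} (bounded A 0<A hA) (bounded B 0<B hB) = bounded (A * B) (*-pos 0<A 0<B)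
    (ev-zip (λ {n} p q → ≤-trans (≤-reflexive (∣p*q∣≡∣p∣*∣q∣ (u n) (v n)))
      (mul-mono (0≤∣p∣ (u n)) (<⇒≤ 0<B) p q)) hA hB)

  ≈-squeeze : ∀ {u v w z} → Eventually (λ n → u n ≤ v n × v n ≤ w n) → u ≈ z → w ≈ z → v ≈ z
  ≈-squeeze {u} {v} {w} {z} s h k = mk≈ λ 0<δ → ev-zip
    (λ {n} (u≤v , v≤w) (p , q) → ∣p∣≤-intro
      (≤-trans (+-monoˡ-≤ (- z n) v≤w) (≤-trans (p≤∣p∣ (w n - z n)) q))
      (≤-trans (neg-antimono-≤ (+-monoˡ-≤ (- z n) u≤v)) (≤-trans (-p≤∣p∣ (u n - z n)) p)))
    s (ev-zip _,_ (close h 0<δ) (close k 0<δ))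

  -- Division by a sequence with limit a > 0, for a g not yet known to be bounded. Eventually |u| ≥
  -- a/2, so |g - z| a/2 is at most |g u - z u| = |w - z u|, which tends to 0.
  ≈-cancel : ∀ {g u w z a} → 0ℚ < a → Eventually (λ n → g n * u n ≡ w n) →
             u ≈ (λ _ → a) → w ≈ (λ n → a * z n) → Bounded z → g ≈ z
  ≈-cancel {g} {u} {w} {z} {a} 0<a gu≡w u≈a w≈az bz = mk≈ λ {δ} 0<δ →
    let a/2>0 = half-pos 0<a in
    ev-zip (λ {n} e (p , q) → *-cancelʳ-≤ {r = ½ * a} a/2>0 (begin
        ∣ g n - z n ∣ * (½ * a)   ≤⟨ *-monoˡ (0≤∣p∣ (g n - z n)) (a/2≤∣u∣ q) ⟩
        ∣ g n - z n ∣ * ∣ u n ∣   ≡⟨ sym (∣p*q∣≡∣p∣*∣q∣ (g n - z n) (u n)) ⟩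
        ∣ (g n - z n) * u n ∣     ≡⟨ cong ∣_∣ (trans (expand (g n) (z n) (u n)) (cong (_- z n * u n) e)) ⟩
        ∣ w n - z n * u n ∣       ≤⟨ p ⟩
        δ * (½ * a)             ∎))
      gu≡w (ev-zip _,_ (close w≈zu (*-pos 0<δ a/2>0)) (close u≈a a/2>0))
    where
    open ≤-Reasoning
    expand : ∀ g z u → (g - z) * u ≡ g * u - z * u
    expand = solve-∀ ℚ-ring
    w≈zu : w ≈ (λ n → z n * u n)
    w≈zu = ≈-trans w≈az (≈-trans (≈-pointwise (λ n → *-comm a (z n)))
      (≈-* bz (≈-bounded u≈a (const-bounded a)) ≈-refl (≈-sym u≈a)))
    a/2≤∣u∣ : ∀ {n} → ∣ u n - a ∣ ≤ ½ * a → ½ * a ≤ ∣ u n ∣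
    a/2≤∣u∣ {n} h = begin
      ½ * a           ≡⟨ sym (half-diff a) ⟩
      a - ½ * a       ≤⟨ +-monoʳ-≤ a (neg-antimono-≤ (≤-trans (≤-reflexive (∣∣-swap a (u n))) h)) ⟩
      a - ∣ a - u n ∣ ≤⟨ p≤∣p-q∣+q a (u n) ⟩
      u n             ≤⟨ p≤∣p∣ (u n) ⟩
      ∣ u n ∣         ∎

  recip≈0 : recip ≈ (λ _ → 0ℚ)
  recip≈0 = mk≈ λ {δ} 0<δ →
    let η , 0<η , δη≡1 = shrink 0<δ (positive⁻¹ 1ℚ)
        b , h = archimedean η
    in suc b , λ { {suc n} (s≤s b≤n) → begin
      ∣ recip (suc n) - 0ℚ ∣  ≡⟨ cong ∣_∣ (+-identityʳ (recip (suc n))) ⟩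
      ∣ recip (suc n) ∣       ≡⟨ 0≤p⇒∣p∣≡p (recip≥0 (suc n)) ⟩
      recip (suc n)           ≡⟨ trans (sym (*-identityˡ _)) (cong (_* recip (suc n)) (sym δη≡1)) ⟩
      δ * η * recip (suc n)   ≡⟨ *-assoc δ η (recip (suc n)) ⟩
      δ * (η * recip (suc n)) ≤⟨ *-monoˡ (<⇒≤ 0<δ) (h b≤n) ⟩
      δ * 1ℚ                  ≡⟨ *-identityʳ δ ⟩
      δ                       ∎ }
    where open ≤-Reasoning

  const*recip≈0 : ∀ a → (λ n → a * recip n) ≈ (λ _ → 0ℚ)
  const*recip≈0 a = ≈-trans (≈-* (const-bounded a) (const-bounded 0ℚ) (≈-refl {λ _ → a}) recip≈0) (≈-pointwise (λ _ → *-zeroʳ a))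

  -- Moments are computed on q + n vertices, of which n remain after q are removed; this avoids
  -- truncated subtraction, and the result is carried back here.
  unshift : ∀ q {P : ℕ → Set} → Eventually (λ n → P (q ℕ.+ n)) → Eventually P
  unshift q {P} (N , h) = q ℕ.+ N , λ {n} q+N≤n → subst P (ℕₚ.m+[n∸m]≡n (ℕₚ.m+n≤o⇒m≤o q q+N≤n))
    (h (ℕₚ.≤-trans (ℕₚ.≤-reflexive (sym (ℕₚ.m+n∸m≡n q N))) (ℕₚ.∸-monoˡ-≤ q q+N≤n)))

  shift : ∀ q {P : ℕ → Set} → Eventually P → Eventually (λ n → P (q ℕ.+ n))
  shift q (N , h) = N , λ {n} N≤n → h (ℕₚ.≤-trans N≤n (ℕₚ.m≤n+m n q))

  ≈-unshift : ∀ q {u v} → (λ n → u (q ℕ.+ n)) ≈ (λ n → v (q ℕ.+ n)) → u ≈ v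
  ≈-unshift q h = mk≈ λ 0<δ → unshift q (close h 0<δ)

  ≈-shift : ∀ q {u v} → u ≈ v → (λ n → u (q ℕ.+ n)) ≈ (λ n → v (q ℕ.+ n))
  ≈-shift q h = mk≈ λ 0<δ → shift q (close h 0<δ)

  -- The exponential as a limit of powers

  pow : ℚ → ℕ → ℚ
  pow h zero    = 1ℚ
  pow h (suc n) = h * pow h n

  pow-+ : ∀ h m n → pow h (m ℕ.+ n) ≡ pow h m * pow h n
  pow-+ h zero    n = sym (*-identityˡ (pow h n))
  pow-+ h (suc m) n = trans (cong (h *_) (pow-+ h m n)) (sym (*-assoc h (pow h m) (pow h n)))

  pow-* : ∀ g h n → pow (g * h) n ≡ pow g n * pow h n
  pow-* g h zero    = refl
  pow-* g h (suc n) = trans (cong (g * h *_) (pow-* g h n)) (rearrange g h (pow g n) (pow h n))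
    where
    rearrange : ∀ a b c d → a * b * (c * d) ≡ a * c * (b * d)
    rearrange = solve-∀ ℚ-ring

  binomialTerm : ℕ → ℚ → ℕ → ℚ
  binomialTerm D h i = ι (choose D i) * pow h i

  binomialPartial : ℕ → ℚ → ℕ → ℚ
  binomialPartial D h zero    = 1ℚ
  binomialPartial D h (suc k) = binomialPartial D h k + binomialTerm D h (suc k)

  binomialTerm-0 : ∀ D h → binomialTerm D h 0 ≡ 1ℚ
  binomialTerm-0 D h = trans (cong (_* 1ℚ) ι-1) (*-identityˡ 1ℚ)

  binomialTerm-pascal : ∀ D h i → binomialTerm (suc D) h (suc i) ≡ binomialTerm D h (suc i) + h * binomialTerm D h i
  binomialTerm-pascal D h i = trans (cong (_* (h * pow h i)) (ι-+ (choose D i) (choose D (suc i))))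
    (rearrange (ι (choose D i)) (ι (choose D (suc i))) h (pow h i))
    where
    rearrange : ∀ a b h p → (a + b) * (h * p) ≡ b * (h * p) + h * (a * p)
    rearrange = solve-∀ ℚ-ring

  binomialPartial-pascal : ∀ D h k →
    binomialPartial (suc D) h (suc k) ≡ binomialPartial D h (suc k) + h * binomialPartial D h k
  binomialPartial-pascal D h zero = trans (cong (_+_ 1ℚ) (trans (binomialTerm-pascal D h 0)
      (cong (λ z → binomialTerm D h 1 + h * z) (binomialTerm-0 D h))))
    (sym (+-assoc 1ℚ (binomialTerm D h 1) (h * 1ℚ)))
  binomialPartial-pascal D h (suc k) = trans
    (cong₂ _+_ (binomialPartial-pascal D h k) (binomialTerm-pascal D h (suc k)))
    (rearrange (binomialPartial D h (suc k)) h (binomialPartial D h k) (binomialTerm D h (suc (suc k))) (binomialTerm D h (suc k)))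
    where
    rearrange : ∀ a h b c d → a + h * b + (c + h * d) ≡ a + c + h * (b + d)
    rearrange = solve-∀ ℚ-ring

  binomial-theorem : ∀ D h → binomialPartial D h D ≡ pow (1ℚ + h) D
  binomial-theorem zero    h = refl
  binomial-theorem (suc D) h = begin
    binomialPartial (suc D) h (suc D)
      ≡⟨ binomialPartial-pascal D h D ⟩
    binomialPartial D h D + binomialTerm D h (suc D) + h * binomialPartial D h D
      ≡⟨ cong (λ z → binomialPartial D h D + z + h * binomialPartial D h D)
           (trans (cong (λ z → z * pow h (suc D)) (trans (cong ι (choose-> {D} ℕₚ.≤-refl)) ι-0)) (*-zeroˡ (pow h (suc D)))) ⟩
    binomialPartial D h D + 0ℚ + h * binomialPartial D h D
      ≡⟨ collect (binomialPartial D h D) h ⟩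
    (1ℚ + h) * binomialPartial D h D
      ≡⟨ cong ((1ℚ + h) *_) (binomial-theorem D h) ⟩
    pow (1ℚ + h) (suc D) ∎
    where
    open ≡-Reasoning
    collect : ∀ a h → a + 0ℚ + h * a ≡ (1ℚ + h) * a
    collect = solve-∀ ℚ-ring

  -- The recursion of `expTerm` with D h replaced by (D - i) h. The comparison of binomial and
  -- exponential terms rests on this common shape.
  binomialTerm-suc : ∀ D h i → binomialTerm D h (suc i) ≡ binomialTerm D h i * (h * ι (D ℕ.∸ i) * (+ 1 / suc i))
  binomialTerm-suc D h i = begin
    b * (h * p)                          ≡⟨ cong (_* (h * p)) b≡ ⟩
    ι (D ℕ.∸ i) * a * r * (h * p)        ≡⟨ rearrange (ι (D ℕ.∸ i)) a r h p ⟩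
    a * p * (h * ι (D ℕ.∸ i) * r)        ∎
    where
    open ≡-Reasoning
    a = ι (choose D i)
    b = ι (choose D (suc i))
    p = pow h i
    r = + 1 / suc i
    b≡ : b ≡ ι (D ℕ.∸ i) * a * r
    b≡ = begin
      b                          ≡⟨ sym (*-identityʳ b) ⟩
      b * 1ℚ                     ≡⟨ cong (b *_) (sym (ι*recip {suc i} (s≤s z≤n))) ⟩
      b * (ι (suc i) * r)        ≡⟨ regroup b (ι (suc i)) r ⟩
      ι (suc i) * b * r          ≡⟨ cong (_* r) (trans (sym (ι-* (suc i) (choose D (suc i))))
                                      (trans (cong ι (choose-step D i)) (ι-* (D ℕ.∸ i) (choose D i)))) ⟩
      ι (D ℕ.∸ i) * a * r        ∎
      where
      regroup : ∀ b s r → b * (s * r) ≡ s * b * r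
      regroup = solve-∀ ℚ-ring
    rearrange : ∀ d a r h p → d * a * r * (h * p) ≡ a * p * (h * d * r)
    rearrange = solve-∀ ℚ-ring

  module _ {B : ℚ} (0≤B : 0ℚ ≤ B) where
    open ≤-Reasoning

    -- Doubling B absorbs the factor i that each term of the binomial expansion loses against e^B.
    expTerm-*-suc : ∀ i → expTerm B i * ι (suc i) ≤ expTerm (B + B) i
    expTerm-*-suc zero = ≤-reflexive (trans (cong (1ℚ *_) ι-1) (*-identityˡ 1ℚ))
    expTerm-*-suc (suc i) = begin
      expTerm B i * (B * r) * ι (suc (suc i))
        ≤⟨ *-monoˡ (term-nonNeg 0≤B (suc i)) (≤-trans (ι-mono (s≤s (ℕₚ.m≤n+m (suc i) i))) (≤-reflexive (ι-+ (suc i) (suc i)))) ⟩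
      expTerm B i * (B * r) * (ι (suc i) + ι (suc i))
        ≡⟨ rearrange (expTerm B i) B r (ι (suc i)) ⟩
      expTerm B i * ι (suc i) * ((B + B) * r)
        ≤⟨ *-monoʳ (*-nonNeg (B + B) r (+-mono-≤ 0≤B 0≤B) (<⇒≤ (1/suc>0 i))) (expTerm-*-suc i) ⟩
      expTerm (B + B) i * ((B + B) * r) ∎
      where
      r = + 1 / suc i
      rearrange : ∀ t B r s → t * (B * r) * (s + s) ≡ t * s * ((B + B) * r)
      rearrange = solve-∀ ℚ-ring

    module _ {D : ℕ} {h : ℚ} (1≤D : 1 ℕ.≤ D) (Dh≤B : ∣ ι D * h ∣ ≤ B) where
      private
        ∣h∣ι≤B : ∀ i → ∣ h * ι (D ℕ.∸ i) ∣ ≤ B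
        ∣h∣ι≤B i = begin
          ∣ h * ι (D ℕ.∸ i) ∣   ≡⟨ trans (∣p*q∣≡∣p∣*∣q∣ h _) (cong (∣ h ∣ *_) (0≤p⇒∣p∣≡p (ι≥0 (D ℕ.∸ i)))) ⟩
          ∣ h ∣ * ι (D ℕ.∸ i)   ≤⟨ *-monoˡ (0≤∣p∣ h) (ι-mono (ℕₚ.m∸n≤m D i)) ⟩
          ∣ h ∣ * ι D           ≡⟨ trans (*-comm ∣ h ∣ (ι D)) (cong (_* ∣ h ∣) (sym (0≤p⇒∣p∣≡p (ι≥0 D)))) ⟩
          ∣ ι D ∣ * ∣ h ∣       ≡⟨ sym (∣p*q∣≡∣p∣*∣q∣ (ι D) h) ⟩
          ∣ ι D * h ∣           ≤⟨ Dh≤B ⟩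
          B                     ∎

        ∣h∣≤ : ∣ h ∣ ≤ B * recip D
        ∣h∣≤ = begin
          ∣ h ∣                       ≡⟨ trans (sym (*-identityʳ ∣ h ∣)) (cong (∣ h ∣ *_) (sym (ι*recip 1≤D))) ⟩
          ∣ h ∣ * (ι D * recip D)     ≡⟨ sym (*-assoc ∣ h ∣ (ι D) (recip D)) ⟩
          ∣ h ∣ * ι D * recip D       ≡⟨ cong (_* recip D) (trans (cong (∣ h ∣ *_) (sym (0≤p⇒∣p∣≡p (ι≥0 D)))) (sym (∣p*q∣≡∣p∣*∣q∣ h (ι D)))) ⟩
          ∣ h * ι D ∣ * recip D       ≤⟨ *-monoʳ (recip≥0 D) (∣h∣ι≤B 0) ⟩
          B * recip D                 ∎

        ∣ιD-ι[D∸i]∣≤ : ∀ i → ∣ ι D - ι (D ℕ.∸ i) ∣ ≤ ι i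
        ∣ιD-ι[D∸i]∣≤ i = ∣p∣≤-intro
          (≤-trans (+-monoʳ-≤ (ι D) (neg-antimono-≤ (ι-∸-≤ D i))) (≤-reflexive (cancel (ι D) (ι i))))
          (≤-trans (≤-reflexive (neg-diff (ι D) (ι (D ℕ.∸ i)))) (≤-trans
            (+-monoˡ-≤ (- ι D) (ι-mono (ℕₚ.m∸n≤m D i))) (≤-trans (≤-reflexive (+-inverseʳ (ι D))) (ι≥0 i))))
          where
          cancel : ∀ p q → p - (p - q) ≡ q
          cancel = solve-∀ ℚ-ring

      ∣binomialTerm∣≤ : ∀ i → ∣ binomialTerm D h i ∣ ≤ expTerm B i
      ∣binomialTerm∣≤ zero    = ≤-reflexive (cong ∣_∣ (binomialTerm-0 D h))
      ∣binomialTerm∣≤ (suc i) = begin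
        ∣ binomialTerm D h (suc i) ∣
          ≡⟨ cong ∣_∣ (binomialTerm-suc D h i) ⟩
        ∣ binomialTerm D h i * (h * ι (D ℕ.∸ i) * r) ∣
          ≡⟨ trans (∣p*q∣≡∣p∣*∣q∣ (binomialTerm D h i) _) (cong (∣ binomialTerm D h i ∣ *_)
               (trans (∣p*q∣≡∣p∣*∣q∣ (h * ι (D ℕ.∸ i)) r) (cong (∣ h * ι (D ℕ.∸ i) ∣ *_) (0≤p⇒∣p∣≡p 0≤r)))) ⟩
        ∣ binomialTerm D h i ∣ * (∣ h * ι (D ℕ.∸ i) ∣ * r)
          ≤⟨ mul-mono (0≤∣p∣ (binomialTerm D h i)) (*-nonNeg B r 0≤B 0≤r) (∣binomialTerm∣≤ i) (*-monoʳ 0≤r (∣h∣ι≤B i)) ⟩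
        expTerm B i * (B * r) ∎
        where
        r = + 1 / suc i
        0≤r = <⇒≤ (1/suc>0 i)

      -- The error at i + 1 has two parts: the error at i times D h/(i+1), and the binomial term at
      -- i times h (D - (D - i))/(i+1), in which |h| ≤ B/D. Each part uses up one of the two
      -- summands of B + B.
      expTerm-binomialTerm : ∀ i → ∣ expTerm (ι D * h) i - binomialTerm D h i ∣ ≤ expTerm (B + B) i * recip D
      expTerm-binomialTerm zero = begin
        ∣ 1ℚ - binomialTerm D h 0 ∣ ≡⟨ cong (λ z → ∣ 1ℚ - z ∣) (binomialTerm-0 D h) ⟩
        0ℚ                          ≤⟨ recip≥0 D ⟩
        recip D                     ≡⟨ sym (*-identityˡ (recip D)) ⟩
        1ℚ * recip D                ∎
      expTerm-binomialTerm (suc i) = begin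
        ∣ t * (ι D * h * r) - binomialTerm D h (suc i) ∣
          ≡⟨ cong ∣_∣ (trans (cong (λ z → t * (ι D * h * r) - z) (binomialTerm-suc D h i)) (split t (ι D) h r b (ι (D ℕ.∸ i)))) ⟩
        ∣ (t - b) * (ι D * h * r) + b * (h * (ι D - ι (D ℕ.∸ i)) * r) ∣
          ≤⟨ ∣p+q∣≤∣p∣+∣q∣ ((t - b) * (ι D * h * r)) _ ⟩
        ∣ (t - b) * (ι D * h * r) ∣ + ∣ b * (h * (ι D - ι (D ℕ.∸ i)) * r) ∣
          ≡⟨ cong₂ _+_ (abs₃ (t - b) (ι D * h))
               (trans (abs₃ b (h * (ι D - ι (D ℕ.∸ i)))) (cong (λ z → ∣ b ∣ * (z * r)) (∣p*q∣≡∣p∣*∣q∣ h _))) ⟩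
        ∣ t - b ∣ * (∣ ι D * h ∣ * r) + ∣ b ∣ * (∣ h ∣ * ∣ ι D - ι (D ℕ.∸ i) ∣ * r)
          ≤⟨ +-mono-≤
               (mul-mono (0≤∣p∣ (t - b)) 0≤Br (expTerm-binomialTerm i) (*-monoʳ 0≤r Dh≤B))
               (mul-mono (0≤∣p∣ b) (*-nonNeg (B * ν * ι i) r (*-nonNeg (B * ν) (ι i) 0≤Bν (ι≥0 i)) 0≤r) (∣binomialTerm∣≤ i)
                 (*-monoʳ 0≤r (mul-mono (0≤∣p∣ h) (ι≥0 i) ∣h∣≤ (∣ιD-ι[D∸i]∣≤ i)))) ⟩
        τ * ν * (B * r) + expTerm B i * (B * ν * ι i * r)
          ≡⟨ cong (_+_ (τ * ν * (B * r))) (regroup (expTerm B i) B ν (ι i) r) ⟩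
        τ * ν * (B * r) + expTerm B i * ι i * (B * ν * r)
          ≤⟨ +-monoʳ-≤ (τ * ν * (B * r)) (*-monoʳ (*-nonNeg (B * ν) r 0≤Bν 0≤r)
               (≤-trans (*-monoˡ (term-nonNeg 0≤B i) (ι-mono (ℕₚ.n≤1+n i))) (expTerm-*-suc i))) ⟩
        τ * ν * (B * r) + τ * (B * ν * r)
          ≡⟨ collect τ ν B r ⟩
        τ * ((B + B) * r) * ν ∎
        where
        t = expTerm (ι D * h) i
        b = binomialTerm D h i
        τ = expTerm (B + B) i
        ν = recip D
        r = + 1 / suc i
        0≤r = <⇒≤ (1/suc>0 i)
        0≤Br = *-nonNeg B r 0≤B 0≤r
        0≤Bν = *-nonNeg B ν 0≤B (recip≥0 D)
        split : ∀ t D h r b E → t * (D * h * r) - b * (h * E * r) ≡ (t - b) * (D * h * r) + b * (h * (D - E) * r)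
        split = solve-∀ ℚ-ring
        regroup : ∀ t B ν j r → t * (B * ν * j * r) ≡ t * j * (B * ν * r)
        regroup = solve-∀ ℚ-ring
        collect : ∀ τ ν B r → τ * ν * (B * r) + τ * (B * ν * r) ≡ τ * ((B + B) * r) * ν
        collect = solve-∀ ℚ-ring
        abs₃ : ∀ p q → ∣ p * (q * r) ∣ ≡ ∣ p ∣ * (∣ q ∣ * r)
        abs₃ p q = trans (∣p*q∣≡∣p∣*∣q∣ p (q * r)) (cong (∣ p ∣ *_)
          (trans (∣p*q∣≡∣p∣*∣q∣ q r) (cong (∣ q ∣ *_) (0≤p⇒∣p∣≡p 0≤r))))

      expSum-binomialPartial : ∀ k → ∣ expSum (ι D * h) k - binomialPartial D h k ∣ ≤ expSum (B + B) k * recip D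
      expSum-binomialPartial zero    = ≤-trans (recip≥0 D) (≤-reflexive (sym (*-identityˡ (recip D))))
      expSum-binomialPartial (suc k) = begin
        ∣ (s + t) - (p + b) ∣         ≡⟨ cong ∣_∣ (sum-diff s t p b) ⟩
        ∣ (s - p) + (t - b) ∣         ≤⟨ ∣p+q∣≤∣p∣+∣q∣ (s - p) (t - b) ⟩
        ∣ s - p ∣ + ∣ t - b ∣         ≤⟨ +-mono-≤ (expSum-binomialPartial k) (expTerm-binomialTerm (suc k)) ⟩
        expSum (B + B) k * recip D + expTerm (B + B) (suc k) * recip D
          ≡⟨ sym (*-distribʳ-+ (recip D) (expSum (B + B) k) _) ⟩
        expSum (B + B) (suc k) * recip D ∎
        where
        s = expSum (ι D * h) k
        t = expTerm (ι D * h) (suc k)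
        p = binomialPartial D h k
        b = binomialTerm D h (suc k)

  expTerm-≈ : ∀ {x y} → x ≈ y → Bounded y → ∀ k →
              (λ n → expTerm (x n) k) ≈ (λ n → expTerm (y n) k) × Bounded (λ n → expTerm (y n) k)
  expTerm-≈ x≈y by zero    = ≈-refl , const-bounded 1ℚ
  expTerm-≈ {x} {y} x≈y by (suc k) =
    let t≈ , bt = expTerm-≈ x≈y by k
        r = + 1 / suc k
        xr≈yr = ≈-* (≈-bounded x≈y by) (const-bounded r) x≈y (≈-refl {λ _ → r})
        byr = bounded-* by (const-bounded r)
    in ≈-* (≈-bounded t≈ bt) byr t≈ xr≈yr , bounded-* bt byr

  expSum-≈ : ∀ {x y} → x ≈ y → Bounded y → ∀ k → (λ n → expSum (x n) k) ≈ (λ n → expSum (y n) k)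
  expSum-≈ x≈y by zero    = ≈-refl
  expSum-≈ x≈y by (suc k) = ≈-+ (expSum-≈ x≈y by k) (proj₁ (expTerm-≈ x≈y by (suc k)))

  -- On a bounded set the tails are uniformly small, so both sums may be cut at one fixed K, where
  -- they are polynomials. This reconciles a power with exponent D, which expands into D + 1 terms,
  -- with the partial sums of `exp`, cut at n.
  expSum-index : ∀ {x y} {D : ℕ → ℕ} → x ≈ y → Bounded y → Eventually (λ n → n ℕ.≤ D n) →
                 (λ n → expSum (x n) (D n)) ≈ (λ n → expSum (y n) n)
  expSum-index {x} {y} {D} x≈y by@(bounded B 0<B hB) n≤D = mk≈ λ 0<δ →
    let bounded C 0<C hC = ≈-bounded x≈y by
        K , tail = expSum-tail {B + C} (+-mono-< 0<B 0<C) (half-pos (half-pos 0<δ))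
        B≤ = ≤-trans (≤-reflexive (sym (+-identityʳ B))) (+-monoʳ-≤ B (<⇒≤ 0<C))
        C≤ = ≤-trans (≤-reflexive (sym (+-identityˡ C))) (+-monoˡ-≤ C (<⇒≤ 0<B))
    in ev-zip (λ {n} (K≤n , n≤D) (xy , x≤ , y≤) →
         three-way {expSum (x n) (D n)} {expSum (x n) K} {expSum (y n) K} {expSum (y n) n}
           (tail (≤-trans x≤ C≤) (ℕₚ.≤-trans K≤n n≤D)) xy (tail (≤-trans y≤ B≤) K≤n))
       (ev-zip _,_ (ev-≥ K) n≤D)
       (ev-zip _,_ (close (expSum-≈ x≈y by K) (half-pos 0<δ)) (ev-zip _,_ hC hB))

  ∣expSum∣≤ : ∀ {q B} → ∣ q ∣ ≤ B → ∀ k → ∣ expSum q k ∣ ≤ expSum B k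
  ∣expSum∣≤ h zero    = ≤-refl
  ∣expSum∣≤ {q} {B} h (suc k) = ≤-trans (∣p+q∣≤∣p∣+∣q∣ (expSum q k) (expTerm q (suc k)))
    (+-mono-≤ (∣expSum∣≤ h k) (term-bound h (suc k)))

  exp-bounded : ∀ {y} → Bounded y → Bounded (λ n → expSum (y n) n)
  exp-bounded {y} (bounded B 0<B hB) =
    let bounded C 0<C hC = cauchy-bounded (exp-cauchy (const-cauchy B)) in
    bounded C 0<C (ev-zip (λ {n} p q → ≤-trans (∣expSum∣≤ p n) (≤-trans (p≤∣p∣ (expSum B n)) q)) hB hC)

  -- The binomial theorem turns the power into a sum of the same length as `expSum (ι D * h) D`.
  -- With A bounding |D h|, the two differ by at most `expSum (A + A) D * recip D`, and D ≥ n makes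
  -- this vanish.
  pow≈exp : (h : ℕ → ℚ) (D : ℕ → ℕ) {y : ℕ → ℚ} → Eventually (λ n → n ℕ.≤ D n) → (λ n → ι (D n) * h n) ≈ y → Bounded y →
            (λ n → pow (1ℚ + h n) (D n)) ≈ (λ n → expSum (y n) n)
  pow≈exp h D {y} n≤D x≈y by = ≈-trans pow≈ (expSum-index x≈y by n≤D)
    where
    bx = ≈-bounded x≈y by
    A = Bounded.bound bx
    0≤A = <⇒≤ (Bounded.bound>0 bx)
    bounded-2A : Bounded (λ n → expSum (A + A) n)
    bounded-2A = exp-bounded (const-bounded (A + A))
    error : (λ n → expSum (A + A) (D n) * recip (D n)) ≈ (λ _ → 0ℚ)
    error = ≈-trans (≈-* {u′ = λ n → expSum (A + A) n} {v′ = λ _ → 0ℚ}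
        (≈-bounded index bounded-2A) (const-bounded 0ℚ) index recipD≈0)
      (≈-pointwise (λ n → *-zeroʳ (expSum (A + A) n)))
      where
      index : (λ n → expSum (A + A) (D n)) ≈ (λ n → expSum (A + A) n)
      index = expSum-index ≈-refl (const-bounded (A + A)) n≤D
      recipD≈0 : (λ n → recip (D n)) ≈ (λ _ → 0ℚ)
      recipD≈0 = mk≈ λ 0<δ → let N , p = close recip≈0 0<δ ; M , q = n≤D in
        N ℕ.⊔ M , λ {n} h → p (ℕₚ.≤-trans (ℕₚ.m⊔n≤o⇒m≤o N M h) (q (ℕₚ.m⊔n≤o⇒n≤o N M h)))
    pow≈ : (λ n → pow (1ℚ + h n) (D n)) ≈ (λ n → expSum (ι (D n) * h n) (D n))
    pow≈ = ≈-sym (mk≈ λ 0<δ → ev-zip (λ {n} (1≤n , n≤D) (b , e) →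
        ≤-trans (≤-reflexive (cong (λ z → ∣ expSum (ι (D n) * h n) (D n) - z ∣) (sym (binomial-theorem (D n) (h n)))))
          (≤-trans (expSum-binomialPartial 0≤A (ℕₚ.≤-trans 1≤n n≤D) b (D n))
            (≤-trans (p≤∣p∣ _) (≤-trans (≤-reflexive (cong ∣_∣ (sym (+-identityʳ _)))) e))))
      (ev-zip _,_ (ev-≥ 1) n≤D) (ev-zip _,_ (Bounded.≤bound bx) (close error 0<δ)))

  ι*[y/n] : ∀ y {n} → 1 ℕ.≤ n → ι n * (y * recip n) ≡ y
  ι*[y/n] y {n} 1≤n = trans (mul-swap (ι n) y (recip n)) (trans (cong (y *_) (ι*recip 1≤n)) (*-identityʳ y))

  [1+y/n]^n≈exp : ∀ {y} → Bounded y → (λ n → pow (1ℚ + y n * recip n) n) ≈ (λ n → expSum (y n) n)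
  [1+y/n]^n≈exp {y} by = pow≈exp (λ n → y n * recip n) id (always (λ n → ℕₚ.≤-refl)) (≈-eventually (1 , ι*[y/n] (y _))) by

  -- (1 + y/n)^(2n) is read both as a power with exponent 2n and as a square.
  exp-double : ∀ {y} → Bounded y → (λ n → expSum (y n + y n) n) ≈ (λ n → expSum (y n) n * expSum (y n) n)
  exp-double {y} by = ≈-trans
    (≈-sym (pow≈exp h (λ n → n ℕ.+ n) (always (λ n → ℕₚ.m≤m+n n n))
      (≈-eventually (1 , λ {n} 1≤n → trans (cong (_* h n) (ι-+ n n)) (trans (*-distribʳ-+ (h n) (ι n) (ι n))
        (cong₂ _+_ (ι*[y/n] (y n) 1≤n) (ι*[y/n] (y n) 1≤n)))))
      (bounded-+ by by)))
    (≈-trans (≈-pointwise (λ n → pow-+ (1ℚ + h n) n n))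
      (≈-* (≈-bounded ([1+y/n]^n≈exp by) (exp-bounded by)) (exp-bounded by) ([1+y/n]^n≈exp by) ([1+y/n]^n≈exp by)))
    where
    h : ℕ → ℚ
    h n = y n * recip n

  expSum-0 : ∀ k → expSum 0ℚ k ≡ 1ℚ
  expSum-0 zero    = refl
  expSum-0 (suc k) = trans (cong₂ _+_ (expSum-0 k) (trans (cong (expTerm 0ℚ k *_) (*-zeroˡ (+ 1 / suc k))) (*-zeroʳ (expTerm 0ℚ k))))
    (+-identityʳ 1ℚ)

  -- (1 + y/n)^n (1 - y/n)^n = (1 - y²/n²)^n, and n y²/n² tends to 0, so the limit is e^0.
  exp-inverse : ∀ {y} → Bounded y → (λ n → expSum (y n) n * expSum (- y n) n) ≈ (λ _ → 1ℚ)
  exp-inverse {y} by = ≈-trans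
    (≈-sym (≈-* (≈-bounded ([1+y/n]^n≈exp by) (exp-bounded by)) (exp-bounded b-y) ([1+y/n]^n≈exp by) ([1+y/n]^n≈exp b-y)))
    (≈-trans (≈-pointwise (λ n → trans (sym (pow-* (1ℚ + h n) (1ℚ + - y n * recip n) n)) (cong (λ z → pow z n) (square (y n) (recip n)))))
    (≈-trans (pow≈exp (λ n → - (h n * h n)) id (always (λ n → ℕₚ.≤-refl)) small (const-bounded 0ℚ)) (≈-pointwise expSum-0)))
    where
    b-y = bounded-neg by
    h : ℕ → ℚ
    h n = y n * recip n
    square : ∀ y r → (1ℚ + y * r) * (1ℚ + - y * r) ≡ 1ℚ + - (y * r * (y * r))
    square = solve-∀ ℚ-ring
    rearrange : ∀ i y r → i * - (y * r * (y * r)) ≡ - (i * (y * r) * (y * r))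
    rearrange = solve-∀ ℚ-ring
    zero² : ∀ y → - (y * (y * 0ℚ)) ≡ 0ℚ
    zero² = solve-∀ ℚ-ring
    small : (λ n → ι n * - (h n * h n)) ≈ (λ _ → 0ℚ)
    small = ≈-trans (≈-eventually (1 , λ {n} 1≤n → trans (rearrange (ι n) (y n) (recip n)) (cong (λ z → - (z * (y n * recip n))) (ι*[y/n] (y n) 1≤n))))
      (≈-trans (≈-neg (≈-* by (bounded-* by (const-bounded 0ℚ)) (≈-refl {y}) (≈-* by (const-bounded 0ℚ) (≈-refl {y}) recip≈0)))
        (≈-pointwise (λ n → zero² (y n))))

  -- With E a bound for e^(-y/2) and a = 1/(2E), `exp-inverse` yields |e^(y/2)| ≥ a, with unknown
  -- sign. Squaring removes the sign: e^y is close to (e^(y/2))² ≥ a², and half of a² is given away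
  -- to the approximation.
  exp-positive : ∀ {y} → Bounded y → ∃[ a ] 0ℚ < a × Eventually (λ n → a ≤ expSum (y n) n)
  exp-positive {y} by = ½ * (a * a) , half-pos 0<a² , ev-zip (λ {n} (p , q) r → begin
        ½ * (a * a)                                ≡⟨ sym (half-diff (a * a)) ⟩
        a * a - ½ * (a * a)                        ≤⟨ +-mono-≤ (a²≤ n p q) (neg-antimono-≤ r) ⟩
        s n * s n - ∣ s n * s n - expSum (y n) n ∣ ≤⟨ p≤∣p-q∣+q (s n * s n) (expSum (y n) n) ⟩
        expSum (y n) n                             ∎)
      (ev-zip _,_ (close (exp-inverse bz) 0<½) (Bounded.≤bound bt)) (close (≈-sym y≈ss) (half-pos 0<a²))
    where
    open ≤-Reasoning
    0<½ = positive⁻¹ ½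
    z : ℕ → ℚ
    z n = ½ * y n
    bz : Bounded z
    bz = bounded-* (const-bounded ½) by
    s : ℕ → ℚ
    s n = expSum (z n) n
    t : ℕ → ℚ
    t n = expSum (- z n) n
    bt : Bounded t
    bt = exp-bounded (bounded-neg bz)
    E = Bounded.bound bt
    a-data = shrink (Bounded.bound>0 bt) 0<½
    a = proj₁ a-data
    0<a : 0ℚ < a
    0<a = proj₁ (proj₂ a-data)
    Ea≡½ : E * a ≡ ½
    Ea≡½ = proj₂ (proj₂ a-data)
    0<a² = *-pos 0<a 0<a
    y≈ss : (λ n → expSum (y n) n) ≈ (λ n → s n * s n)
    y≈ss = ≈-trans (≈-pointwise (λ n → cong (λ w → expSum w n) (sym (half+half (y n))))) (exp-double bz)
    a≤∣s∣ : ∀ n → ∣ s n * t n - 1ℚ ∣ ≤ ½ → ∣ t n ∣ ≤ E → a ≤ ∣ s n ∣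
    a≤∣s∣ n p q = *-cancelʳ-≤ (Bounded.bound>0 bt) (begin
      a * E                         ≡⟨ trans (*-comm a E) Ea≡½ ⟩
      1ℚ - ½                        ≤⟨ +-monoʳ-≤ 1ℚ (neg-antimono-≤ (≤-trans (≤-reflexive (∣∣-swap 1ℚ (s n * t n))) p)) ⟩
      1ℚ - ∣ 1ℚ - s n * t n ∣       ≤⟨ p≤∣p-q∣+q 1ℚ (s n * t n) ⟩
      s n * t n                     ≤⟨ p≤∣p∣ (s n * t n) ⟩
      ∣ s n * t n ∣                 ≡⟨ ∣p*q∣≡∣p∣*∣q∣ (s n) (t n) ⟩
      ∣ s n ∣ * ∣ t n ∣             ≤⟨ *-monoˡ (0≤∣p∣ (s n)) q ⟩
      ∣ s n ∣ * E                   ∎)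
    a²≤ : ∀ n → ∣ s n * t n - 1ℚ ∣ ≤ ½ → ∣ t n ∣ ≤ E → a * a ≤ s n * s n
    a²≤ n p q = begin
      a * a             ≤⟨ mul-mono (<⇒≤ 0<a) (0≤∣p∣ (s n)) (a≤∣s∣ n p q) (a≤∣s∣ n p q) ⟩
      ∣ s n ∣ * ∣ s n ∣ ≡⟨ sym (∣p*q∣≡∣p∣*∣q∣ (s n) (s n)) ⟩
      ∣ s n * s n ∣     ≡⟨ 0≤p⇒∣p∣≡p (square≥0 (s n)) ⟩
      s n * s n         ∎

  -- Ratios of binomial coefficients

  tri-double : ∀ n → tri n ℕ.+ tri n ℕ.+ n ≡ n ℕ.* n
  tri-double zero    = refl
  tri-double (suc n) = trans (rearrange n (tri n)) (trans (cong (ℕ._+ (n ℕ.+ suc n)) (tri-double n)) (square n))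
    where
    rearrange : ∀ n t → n ℕ.+ t ℕ.+ (n ℕ.+ t) ℕ.+ suc n ≡ t ℕ.+ t ℕ.+ n ℕ.+ (n ℕ.+ suc n)
    rearrange = ℕ-Solver.solve-∀
    square : ∀ n → n ℕ.* n ℕ.+ (n ℕ.+ suc n) ≡ suc n ℕ.* suc n
    square = ℕ-Solver.solve-∀

  -- The number of pairs of q + n vertices that meet a fixed set of q of them.
  lostPairs : ℕ → ℕ → ℕ
  lostPairs q n = q ℕ.* n ℕ.+ tri q

  tri-+ : ∀ q n → tri (q ℕ.+ n) ≡ lostPairs q n ℕ.+ tri n
  tri-+ zero    n = refl
  tri-+ (suc q) n = trans (cong ((q ℕ.+ n) ℕ.+_) (tri-+ q n)) (rearrange q n (q ℕ.* n) (tri q) (tri n))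
    where
    rearrange : ∀ q n p s t → q ℕ.+ n ℕ.+ (p ℕ.+ s ℕ.+ t) ≡ n ℕ.+ p ℕ.+ (q ℕ.+ s) ℕ.+ t
    rearrange = ℕ-Solver.solve-∀

  recip-antitone : ∀ {a b} → 1 ℕ.≤ a → a ℕ.≤ b → recip b ≤ recip a
  recip-antitone {a} {b} 1≤a a≤b = *-cancelʳ-≤ (ι>0 1≤b) (begin
    recip b * ι b         ≡⟨ trans (*-comm (recip b) (ι b)) (ι*recip 1≤b) ⟩
    1ℚ                    ≡⟨ sym (trans (*-comm (recip a) (ι a)) (ι*recip 1≤a)) ⟩
    recip a * ι a         ≤⟨ *-monoˡ (recip≥0 a) (ι-mono a≤b) ⟩
    recip a * ι b         ∎)
    where
    open ≤-Reasoning
    1≤b = ℕₚ.≤-trans 1≤a a≤b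

  pow≥0 : ∀ {a} → 0ℚ ≤ a → ∀ n → 0ℚ ≤ pow a n
  pow≥0 0≤a zero    = nonNegative⁻¹ 1ℚ
  pow≥0 {a} 0≤a (suc n) = *-nonNeg a (pow a n) 0≤a (pow≥0 0≤a n)

  pow-comm-suc : ∀ a n x → pow a (suc n) * x ≡ pow a n * (a * x)
  pow-comm-suc a n x = rearrange a (pow a n) x
    where
    rearrange : ∀ a p x → a * p * x ≡ p * (a * x)
    rearrange = solve-∀ ℚ-ring

  choose-factor : ∀ n M → ι (choose n M) ≡ (1ℚ + - (ι M * recip (suc n))) * ι (choose (suc n) M)
  choose-factor n M = begin
    x                                            ≡⟨ sym (*-identityʳ x) ⟩
    x * 1ℚ                                       ≡⟨ cong (x *_) (sym inv) ⟩
    x * (i * r)                                  ≡⟨ expand x i r (ι M) y ⟩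
    (i * x + ι M * y) * r - ι M * r * y          ≡⟨ cong (λ z → z * r - ι M * r * y) (sym upper) ⟩
    i * y * r - ι M * r * y                      ≡⟨ factor i y r (ι M) ⟩
    (i * r) * y - ι M * r * y                    ≡⟨ cong (λ z → z * y - ι M * r * y) inv ⟩
    1ℚ * y - ι M * r * y                         ≡⟨ collect y (ι M * r) ⟩
    (1ℚ + - (ι M * r)) * y                       ∎
    where
    open ≡-Reasoning
    x = ι (choose n M)
    y = ι (choose (suc n) M)
    i = ι (suc n)
    r = recip (suc n)
    inv : i * r ≡ 1ℚ
    inv = ι*recip {suc n} (s≤s z≤n)
    upper : i * y ≡ i * x + ι M * y
    upper = trans (sym (ι-* (suc n) (choose (suc n) M))) (trans (cong ι (choose-upper n M))
      (trans (ι-+ (suc n ℕ.* choose n M) (M ℕ.* choose (suc n) M)) (cong₂ _+_ (ι-* (suc n) (choose n M)) (ι-* M (choose (suc n) M)))))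
    expand : ∀ x i r m y → x * (i * r) ≡ (i * x + m * y) * r - m * r * y
    expand = solve-∀ ℚ-ring
    factor : ∀ i y r m → i * y * r - m * r * y ≡ (i * r) * y - m * r * y
    factor = solve-∀ ℚ-ring
    collect : ∀ y p → 1ℚ * y - p * y ≡ (1ℚ + - p) * y
    collect = solve-∀ ℚ-ring

  module _ {N M : ℕ} (1≤N : 1 ℕ.≤ N) (M≤N : M ℕ.≤ N) where
    open ≤-Reasoning

    1-M/N≥0 : ∀ {n} → N ℕ.≤ n → 0ℚ ≤ 1ℚ + - (ι M * recip n)
    1-M/N≥0 {n} N≤n = ≤-trans (≤-reflexive (sym (+-inverseʳ 1ℚ))) (+-monoʳ-≤ 1ℚ (neg-antimono-≤ (begin
      ι M * recip n ≤⟨ *-monoʳ (recip≥0 n) (ι-mono (ℕₚ.≤-trans M≤N N≤n)) ⟩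
      ι n * recip n ≡⟨ ι*recip (ℕₚ.≤-trans 1≤N N≤n) ⟩
      1ℚ            ∎)))

    1-M/-mono : ∀ {a b} → 1 ℕ.≤ a → a ℕ.≤ b → 1ℚ + - (ι M * recip a) ≤ 1ℚ + - (ι M * recip b)
    1-M/-mono 1≤a a≤b = +-monoʳ-≤ 1ℚ (neg-antimono-≤ (*-monoˡ (ι≥0 M) (recip-antitone 1≤a a≤b)))

    -- Iterating `choose-factor` produces d factors 1 - M/(N+i), each at least 1 - M/N; M ≤ N keeps
    -- them nonnegative, so the estimates multiply.
    choose-ratio-≥ : ∀ d → pow (1ℚ + - (ι M * recip N)) d * ι (choose (d ℕ.+ N) M) ≤ ι (choose N M)
    choose-ratio-≥ zero    = ≤-reflexive (*-identityˡ _)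
    choose-ratio-≥ (suc d) = begin
      pow a (suc d) * y               ≡⟨ pow-comm-suc a d y ⟩
      pow a d * (a * y)               ≤⟨ *-monoˡ (pow≥0 (1-M/N≥0 ℕₚ.≤-refl) d) (*-monoʳ (ι≥0 _)
                                           (1-M/-mono 1≤N (ℕₚ.≤-trans (ℕₚ.m≤n+m N d) (ℕₚ.n≤1+n (d ℕ.+ N))))) ⟩
      pow a d * ((1ℚ + - (ι M * recip (suc (d ℕ.+ N)))) * y) ≡⟨ cong (pow a d *_) (sym (choose-factor (d ℕ.+ N) M)) ⟩
      pow a d * ι (choose (d ℕ.+ N) M) ≤⟨ choose-ratio-≥ d ⟩
      ι (choose N M)                  ∎
      where
      a = 1ℚ + - (ι M * recip N)
      y = ι (choose (suc d ℕ.+ N) M)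

    -- N′ is free above d + N so that the base of the power stays fixed while d varies in the
    -- induction.
    choose-ratio-≤ : ∀ {N′} d → d ℕ.+ N ℕ.≤ N′ →
                     ι (choose N M) ≤ pow (1ℚ + - (ι M * recip N′)) d * ι (choose (d ℕ.+ N) M)
    choose-ratio-≤ zero    _ = ≤-reflexive (sym (*-identityˡ _))
    choose-ratio-≤ {N′} (suc d) h = begin
      ι (choose N M)                  ≤⟨ choose-ratio-≤ d (ℕₚ.≤-trans (ℕₚ.n≤1+n _) h) ⟩
      pow a d * ι (choose (d ℕ.+ N) M) ≡⟨ cong (pow a d *_) (choose-factor (d ℕ.+ N) M) ⟩
      pow a d * ((1ℚ + - (ι M * recip (suc (d ℕ.+ N)))) * y)
                                      ≤⟨ *-monoˡ (pow≥0 (1-M/N≥0 (ℕₚ.≤-trans (ℕₚ.m≤n+m N (suc d)) h)) d)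
                                           (*-monoʳ (ι≥0 _) (1-M/-mono (s≤s z≤n) h)) ⟩
      pow a d * (a * y)               ≡⟨ sym (pow-comm-suc a d y) ⟩
      pow a (suc d) * y               ∎
      where
      a = 1ℚ + - (ι M * recip N′)
      y = ι (choose (suc d ℕ.+ N) M)

  tri-≈ : (λ n → ι (tri n) * (recip n * recip n)) ≈ (λ _ → ½)
  tri-≈ = ≈-trans (≈-eventually (1 , formula))
    (≈-trans (≈-+ (≈-refl {λ _ → ½}) (≈-neg (const*recip≈0 ½))) (≈-pointwise (λ _ → refl)))
    where
    open ≡-Reasoning
    formula : ∀ {n} → 1 ℕ.≤ n → ι (tri n) * (recip n * recip n) ≡ ½ + - (½ * recip n)
    formula {n} 1≤n = begin
      T * (r * r)                                     ≡⟨ expand T r i ⟩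
      ½ * ((T + T + i) * (r * r) - (i * r) * r)       ≡⟨ cong (λ z → ½ * (z * (r * r) - (i * r) * r)) double ⟩
      ½ * (i * i * (r * r) - (i * r) * r)             ≡⟨ cong (½ *_) (regroup i r) ⟩
      ½ * ((i * r) * (i * r) - (i * r) * r)           ≡⟨ cong (λ z → ½ * (z * z - z * r)) (ι*recip 1≤n) ⟩
      ½ * (1ℚ * 1ℚ - 1ℚ * r)                          ≡⟨ collect r ⟩
      ½ + - (½ * r)                                   ∎
      where
      T = ι (tri n)
      r = recip n
      i = ι n
      double : T + T + i ≡ i * i
      double = trans (cong (_+ i) (sym (ι-+ (tri n) (tri n)))) (trans (sym (ι-+ (tri n ℕ.+ tri n) n))
        (trans (cong ι (tri-double n)) (ι-* n n)))
      expand : ∀ T r i → T * (r * r) ≡ ½ * ((T + T + i) * (r * r) - (i * r) * r)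
      expand = solve-∀ ℚ-ring
      regroup : ∀ i r → i * i * (r * r) - (i * r) * r ≡ (i * r) * (i * r) - (i * r) * r
      regroup = solve-∀ ℚ-ring
      collect : ∀ r → ½ * (1ℚ * 1ℚ - 1ℚ * r) ≡ ½ + - (½ * r)
      collect = solve-∀ ℚ-ring

  ι*recip≈1 : (λ n → ι n * recip n) ≈ (λ _ → 1ℚ)
  ι*recip≈1 = ≈-eventually (1 , ι*recip)

  bounded-recip : Bounded recip
  bounded-recip = ≈-bounded recip≈0 (const-bounded 0ℚ)

  linear-≈ : ∀ q s → (λ n → ι (q ℕ.* n ℕ.+ s) * recip n) ≈ (λ _ → ι q)
  linear-≈ q s = ≈-trans (≈-pointwise (λ n → trans (cong (_* recip n) (trans (ι-+ (q ℕ.* n) s) (cong (_+ ι s) (ι-* q n))))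
      (rearrange (ι q) (ι n) (ι s) (recip n))))
    (≈-trans (≈-+ (≈-* (const-bounded (ι q)) (const-bounded 1ℚ) (≈-refl {λ _ → ι q}) ι*recip≈1)
                  (const*recip≈0 (ι s)))
      (≈-pointwise (λ _ → simplify (ι q))))
    where
    rearrange : ∀ q n s r → (q * n + s) * r ≡ q * (n * r) + s * r
    rearrange = solve-∀ ℚ-ring
    simplify : ∀ q → q * 1ℚ + 0ℚ ≡ q
    simplify = solve-∀ ℚ-ring

  tri-+-≈ : ∀ q → (λ n → ι (tri (q ℕ.+ n)) * (recip n * recip n)) ≈ (λ _ → ½)
  tri-+-≈ q = ≈-trans (≈-pointwise (λ n → trans (cong (_* (recip n * recip n)) (trans (cong ι (tri-+ q n)) (ι-+ (lostPairs q n) (tri n))))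
      (rearrange (ι (lostPairs q n)) (ι (tri n)) (recip n))))
    (≈-trans (≈-+ (≈-* (≈-bounded (linear-≈ q (tri q)) (const-bounded (ι q))) (const-bounded 0ℚ) (linear-≈ q (tri q)) recip≈0) tri-≈)
      (≈-pointwise (λ _ → simplify (ι q))))
    where
    rearrange : ∀ a b r → (a + b) * (r * r) ≡ a * r * r + b * (r * r)
    rearrange = solve-∀ ℚ-ring
    simplify : ∀ q → q * 0ℚ + ½ ≡ ½
    simplify = solve-∀ ℚ-ring

  -- If W n were 0, the product would be 0 and thus at distance a from its limit.
  eventually-positive : ∀ {u : ℕ → ℚ} {W : ℕ → ℕ} {a} → 0ℚ < a → (λ n → ι (W n) * u n) ≈ (λ _ → a) →
                        Eventually (λ n → 1 ℕ.≤ W n)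
  eventually-positive {u} {W} {a} 0<a h = ev-map (λ {n} → step n) (close h (half-pos 0<a))
    where
    step : ∀ n → ∣ ι (W n) * u n - a ∣ ≤ ½ * a → 1 ℕ.≤ W n
    step n p with W n
    ... | suc w = s≤s z≤n
    ... | zero  = ⊥-elim (<⇒≢ {0ℚ} {½ * a} (half-pos 0<a) (≤-antisym (<⇒≤ (half-pos 0<a)) (begin
      ½ * a                         ≡⟨ sym (half-diff a) ⟩
      a - ½ * a                     ≤⟨ +-monoʳ-≤ a (neg-antimono-≤ p) ⟩
      a - ∣ ι 0 * u n - a ∣         ≡⟨ cong (λ z → a - ∣ z - a ∣) (trans (cong (_* u n) ι-0) (*-zeroˡ (u n))) ⟩
      a - ∣ 0ℚ - a ∣                ≡⟨ cong (λ z → a - z) (trans (cong ∣_∣ (+-identityˡ (- a))) (trans (∣-p∣≡∣p∣ a) (0≤p⇒∣p∣≡p (<⇒≤ 0<a)))) ⟩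
      a - a                         ≡⟨ +-inverseʳ a ⟩
      0ℚ                            ∎)))
      where
      open ≤-Reasoning

  quotient-≈ : ∀ {W : ℕ → ℕ} {A z : ℕ → ℚ} → (λ n → ι (W n) * (recip n * recip n)) ≈ (λ _ → ½) →
               (λ n → A n * (recip n * recip n)) ≈ (λ n → ½ * z n) → Bounded z →
               (λ n → A n * recip (W n)) ≈ z
  quotient-≈ {W} {A} W≈ A≈ bz = ≈-cancel (positive⁻¹ ½)
    (ev-map (λ {n} 1≤W → trans (rearrange (A n) (recip (W n)) (ι (W n)) (recip n * recip n))
        (trans (cong (A n * (recip n * recip n) *_) (ι*recip 1≤W)) (*-identityʳ _)))
      (eventually-positive {u = λ n → recip n * recip n} {W} (positive⁻¹ ½) W≈))
    W≈ A≈ bz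
    where
    rearrange : ∀ a r w s → a * r * (w * s) ≡ a * s * (w * r)
    rearrange = solve-∀ ℚ-ring

  ∸-bounds : ∀ (f : ℕ → ℕ) k n → ι (f n) * recip n + - (ι k * recip n) ≤ ι (f n ℕ.∸ k) * recip n ×
                                   ι (f n ℕ.∸ k) * recip n ≤ ι (f n) * recip n
  ∸-bounds f k n = lower , *-monoʳ (recip≥0 n) (ι-mono (ℕₚ.m∸n≤m (f n) k))
    where
    open ≤-Reasoning
    expand : ∀ t m s → t * s + - (m * s) ≡ (t - m) * s
    expand = solve-∀ ℚ-ring
    lower : ι (f n) * recip n + - (ι k * recip n) ≤ ι (f n ℕ.∸ k) * recip n
    lower = begin
      ι (f n) * recip n + - (ι k * recip n) ≡⟨ expand (ι (f n)) (ι k) (recip n) ⟩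
      (ι (f n) - ι k) * recip n             ≤⟨ *-monoʳ (recip≥0 n) (ι-∸-≤ (f n) k) ⟩
      ι (f n ℕ.∸ k) * recip n               ∎

  ι[q+n]/n≈1 : ∀ q → (λ n → ι (q ℕ.+ n) * recip n) ≈ (λ _ → 1ℚ)
  ι[q+n]/n≈1 q = ≈-trans (≈-pointwise (λ n → cong (λ z → ι z * recip n) (trans (ℕₚ.+-comm q n) (cong (ℕ._+ q) (sym (ℕₚ.*-identityˡ n))))))
    (≈-trans (linear-≈ 1 q) (≈-pointwise (λ _ → ι-1)))

  invFactorial : ℕ → ℚ
  invFactorial zero    = 1ℚ
  invFactorial (suc k) = invFactorial k * (+ 1 / suc k)

  choose-≈ : ∀ q k → (λ n → ι (choose (q ℕ.+ n) k) * pow (recip n) k) ≈ (λ _ → invFactorial k)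
  choose-≈ q zero    = ≈-pointwise (λ n → trans (cong (_* 1ℚ) ι-1) (*-identityʳ 1ℚ))
  choose-≈ q (suc k) = ≈-trans (≈-pointwise formula) (≈-trans
    (≈-* (≈-bounded (choose-≈ q k) (const-bounded (invFactorial k))) (bounded-* (const-bounded 1ℚ) (const-bounded r))
      (choose-≈ q k) (≈-* (≈-bounded top (const-bounded 1ℚ)) (const-bounded r) top (≈-refl {λ _ → r})))
    (≈-pointwise (λ _ → cong (invFactorial k *_) (*-identityˡ r))))
    where
    r = + 1 / suc k
    top : (λ n → ι ((q ℕ.+ n) ℕ.∸ k) * recip n) ≈ (λ _ → 1ℚ)
    top = ≈-squeeze (always (∸-bounds (q ℕ.+_) k))
      (≈-trans (≈-+ (ι[q+n]/n≈1 q) (≈-neg (const*recip≈0 (ι k)))) (≈-pointwise (λ _ → +-identityʳ 1ℚ)))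
      (ι[q+n]/n≈1 q)
    formula : ∀ n → ι (choose (q ℕ.+ n) (suc k)) * (recip n * pow (recip n) k) ≡
              ι (choose (q ℕ.+ n) k) * pow (recip n) k * (ι ((q ℕ.+ n) ℕ.∸ k) * recip n * r)
    formula n = begin
      b * (ν * p)                ≡⟨ cong (_* (ν * p)) (sym (*-identityˡ b)) ⟩
      1ℚ * b * (ν * p)           ≡⟨ cong (λ z → z * b * (ν * p)) (sym (ι*recip {suc k} (s≤s z≤n))) ⟩
      s * r * b * (ν * p)        ≡⟨ regroup s r b ν p ⟩
      s * b * (r * ν * p)        ≡⟨ cong (_* (r * ν * p)) (trans (sym (ι-* (suc k) (choose (q ℕ.+ n) (suc k))))
                                      (trans (cong ι (choose-step (q ℕ.+ n) k)) (ι-* ((q ℕ.+ n) ℕ.∸ k) (choose (q ℕ.+ n) k)))) ⟩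
      d * a * (r * ν * p)        ≡⟨ regroup′ d a r ν p ⟩
      a * p * (d * ν * r)        ∎
      where
      open ≡-Reasoning
      ν = recip n
      p = pow (recip n) k
      s = ι (suc k)
      a = ι (choose (q ℕ.+ n) k)
      b = ι (choose (q ℕ.+ n) (suc k))
      d = ι ((q ℕ.+ n) ℕ.∸ k)
      regroup : ∀ s r b ν p → s * r * b * (ν * p) ≡ s * b * (r * ν * p)
      regroup = solve-∀ ℚ-ring
      regroup′ : ∀ d a r ν p → d * a * (r * ν * p) ≡ a * p * (d * ν * r)
      regroup′ = solve-∀ ℚ-ring

  -- Here c is the sequence of approximations of the real density. The uniform lower bound `c₀` is
  -- what forces M to grow beyond every constant and keeps the predicted counts away from zero.
  record Density (M : ℕ → ℕ) (c : ℕ → ℚ) : Set where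
    field
      density   : (λ n → ι (M n) * recip n) ≈ c
      c-bounded : Bounded c
      c₀        : ℚ
      c₀>0      : 0ℚ < c₀
      c₀≤c      : Eventually (λ n → c₀ ≤ c n)

  -- Counting graphs after the deletion of vertices and edges

  exponent : (ℕ → ℚ) → ℕ → ℕ → ℚ
  exponent c q n = - (ι (2 ℕ.* q) * c n)

  pow-bounded : ∀ {c} → Bounded c → ∀ e → Bounded (λ n → pow (c n) e)
  pow-bounded bc zero    = const-bounded 1ℚ
  pow-bounded bc (suc e) = bounded-* bc (pow-bounded bc e)

  module _ {M : ℕ → ℕ} {c : ℕ → ℚ} (dens : Density M c) where
    open Density dens

    exponent-bounded : ∀ q → Bounded (exponent c q)
    exponent-bounded q = bounded-neg (bounded-* (const-bounded (ι (2 ℕ.* q))) c-bounded)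

    M/n-bounded : Bounded (λ n → ι (M n) * recip n)
    M/n-bounded = ≈-bounded density c-bounded

    M/n²≈0 : (λ n → ι (M n) * (recip n * recip n)) ≈ (λ _ → 0ℚ)
    M/n²≈0 = ≈-trans (≈-pointwise (λ n → sym (*-assoc (ι (M n)) (recip n) (recip n))))
      (≈-trans (≈-* M/n-bounded (const-bounded 0ℚ) density recip≈0) (≈-pointwise (λ n → *-zeroʳ (c n))))

    -- A linear number of edges is negligible beside n²/2. The sequence j is general because
    -- `edges-≈` subtracts M - e - 1, while j = M shows that M edges eventually fit.
    tri∸-≈ : ∀ (j : ℕ → ℕ) → (∀ n → j n ℕ.≤ M n) → (λ n → ι (tri n ℕ.∸ j n) * (recip n * recip n)) ≈ (λ _ → ½)
    tri∸-≈ j j≤M = ≈-squeeze (always bounds)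
      (≈-trans (≈-+ tri-≈ (≈-neg M/n²≈0)) (≈-pointwise (λ _ → +-identityʳ ½)))
      tri-≈
      where
      r²≥0 : ∀ n → 0ℚ ≤ recip n * recip n
      r²≥0 n = *-nonNeg (recip n) (recip n) (recip≥0 n) (recip≥0 n)
      expand : ∀ t m s → t * s + - (m * s) ≡ (t - m) * s
      expand = solve-∀ ℚ-ring
      bounds : ∀ n → ι (tri n) * (recip n * recip n) + - (ι (M n) * (recip n * recip n)) ≤ ι (tri n ℕ.∸ j n) * (recip n * recip n) ×
                     ι (tri n ℕ.∸ j n) * (recip n * recip n) ≤ ι (tri n) * (recip n * recip n)
      bounds n = lower , *-monoʳ (r²≥0 n) (ι-mono (ℕₚ.m∸n≤m (tri n) (j n)))
        where
        open ≤-Reasoning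
        lower : ι (tri n) * (recip n * recip n) + - (ι (M n) * (recip n * recip n)) ≤ ι (tri n ℕ.∸ j n) * (recip n * recip n)
        lower = begin
          ι (tri n) * (recip n * recip n) + - (ι (M n) * (recip n * recip n)) ≡⟨ expand (ι (tri n)) (ι (M n)) (recip n * recip n) ⟩
          (ι (tri n) - ι (M n)) * (recip n * recip n)                         ≤⟨ *-monoʳ (r²≥0 n) (+-monoʳ-≤ (ι (tri n)) (neg-antimono-≤ (ι-mono (j≤M n)))) ⟩
          (ι (tri n) - ι (j n)) * (recip n * recip n)                         ≤⟨ *-monoʳ (r²≥0 n) (ι-∸-≤ (tri n) (j n)) ⟩
          ι (tri n ℕ.∸ j n) * (recip n * recip n)                             ∎

    1≤tri : Eventually (λ n → 1 ℕ.≤ tri n)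
    1≤tri = eventually-positive {u = λ n → recip n * recip n} (positive⁻¹ ½) tri-≈

    M≤tri : Eventually (λ n → M n ℕ.≤ tri n)
    M≤tri = ev-map (λ {n} h → ℕₚ.<⇒≤ (ℕₚ.m∸n≢0⇒n<m {tri n} {M n} (λ e → ℕₚ.<-irrefl (sym e) h)))
      (eventually-positive {u = λ n → recip n * recip n} (positive⁻¹ ½) (tri∸-≈ M (λ _ → ℕₚ.≤-refl)))

    M-unbounded : ∀ K → Eventually (λ n → K ℕ.≤ M n)
    M-unbounded K = ev-zip (λ {n} (p , q) r → step n p q r)
      (ev-zip _,_ (close density (half-pos c₀>0)) c₀≤c) (close (const*recip≈0 (ι K)) (half-pos (half-pos c₀>0)))
      where
      open ≤-Reasoning
      step : ∀ n → ∣ ι (M n) * recip n - c n ∣ ≤ ½ * c₀ → c₀ ≤ c n → ∣ ι K * recip n - 0ℚ ∣ ≤ ½ * (½ * c₀) → K ℕ.≤ M n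
      step n p q r with ℕₚ.≤-total K (M n)
      ... | inj₁ K≤M = K≤M
      ... | inj₂ M≤K = ⊥-elim (<-irrefl {½ * c₀} refl (begin-strict
        ½ * c₀                            ≡⟨ sym (half-diff c₀) ⟩
        c₀ - ½ * c₀                       ≤⟨ +-mono-≤ q (neg-antimono-≤ (≤-trans (≤-reflexive (∣∣-swap (c n) _)) p)) ⟩
        c n - ∣ c n - ι (M n) * recip n ∣ ≤⟨ p≤∣p-q∣+q (c n) _ ⟩
        ι (M n) * recip n                 ≤⟨ *-monoʳ (recip≥0 n) (ι-mono M≤K) ⟩
        ι K * recip n                     ≤⟨ p≤q+∣p-q∣ (ι K * recip n) 0ℚ ⟩
        0ℚ + ∣ ι K * recip n - 0ℚ ∣       ≡⟨ +-identityˡ _ ⟩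
        ∣ ι K * recip n - 0ℚ ∣            ≤⟨ r ⟩
        ½ * (½ * c₀)                      ≡⟨ sym (+-identityʳ _) ⟩
        ½ * (½ * c₀) + 0ℚ                 <⟨ +-monoʳ-< (½ * (½ * c₀)) (half-pos (half-pos c₀>0)) ⟩
        ½ * (½ * c₀) + ½ * (½ * c₀)       ≡⟨ half+half (½ * c₀) ⟩
        ½ * c₀                            ∎))

    -- The ratio lies between (1 - M/W)^D for W = `tri n` and for W = `tri (q + n)`. In both cases D
    -- is about q n, M about c n and W about n²/2, so D M/W approaches 2 q c.
    deletion-≈ : ∀ {q} → 1 ℕ.≤ q →
      (λ n → ι (choose (tri n) (M n)) * recip (choose (tri (q ℕ.+ n)) (M n))) ≈ (λ n → expSum (exponent c q n) n)
    deletion-≈ {q} 1≤q = ≈-squeeze (ev-zip (λ {n} 1≤N M≤N → squeeze n 1≤N M≤N) 1≤tri M≤tri)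
        (power tri tri-≈) (power (λ n → tri (q ℕ.+ n)) (tri-+-≈ q))
      where
      D : ℕ → ℕ
      D = lostPairs q
      n≤D : ∀ n → n ℕ.≤ D n
      n≤D n = ℕₚ.≤-trans (ℕₚ.≤-trans (ℕₚ.≤-reflexive (sym (ℕₚ.*-identityˡ n))) (ℕₚ.*-monoˡ-≤ n 1≤q)) (ℕₚ.m≤m+n (q ℕ.* n) (tri q))
      power : ∀ (W : ℕ → ℕ) → (λ n → ι (W n) * (recip n * recip n)) ≈ (λ _ → ½) →
              (λ n → pow (1ℚ + - (ι (M n) * recip (W n))) (D n)) ≈ (λ n → expSum (exponent c q n) n)
      power W W≈ = pow≈exp (λ n → - (ι (M n) * recip (W n))) D (always n≤D)
        (≈-trans (≈-pointwise (λ n → rearrange (ι (D n)) (ι (M n)) (recip (W n))))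
          (≈-neg (quotient-≈ {W} {λ n → ι (D n) * ι (M n)} W≈ A≈ (bounded-* (const-bounded (ι (2 ℕ.* q))) c-bounded))))
        (exponent-bounded q)
        where
        rearrange : ∀ d m r → d * - (m * r) ≡ - (d * m * r)
        rearrange = solve-∀ ℚ-ring
        regroup : ∀ d m r → d * m * (r * r) ≡ (d * r) * (m * r)
        regroup = solve-∀ ℚ-ring
        half-double : ∀ p x → p * x ≡ ½ * ((p + p) * x)
        half-double = solve-∀ ℚ-ring
        ι-double : ι q + ι q ≡ ι (2 ℕ.* q)
        ι-double = trans (sym (ι-+ q q)) (cong (λ z → ι (q ℕ.+ z)) (sym (ℕₚ.+-identityʳ q)))
        A≈ : (λ n → ι (D n) * ι (M n) * (recip n * recip n)) ≈ (λ n → ½ * (ι (2 ℕ.* q) * c n))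
        A≈ = ≈-trans (≈-pointwise (λ n → regroup (ι (D n)) (ι (M n)) (recip n)))
          (≈-trans (≈-* (≈-bounded (linear-≈ q (tri q)) (const-bounded (ι q))) c-bounded (linear-≈ q (tri q)) density)
            (≈-pointwise (λ n → trans (half-double (ι q) (c n)) (cong (λ z → ½ * (z * c n)) ι-double))))
      squeeze : ∀ n → 1 ℕ.≤ tri n → M n ℕ.≤ tri n →
        pow (1ℚ + - (ι (M n) * recip (tri n))) (D n) ≤ ι (choose (tri n) (M n)) * recip (choose (tri (q ℕ.+ n)) (M n)) ×
        ι (choose (tri n) (M n)) * recip (choose (tri (q ℕ.+ n)) (M n)) ≤ pow (1ℚ + - (ι (M n) * recip (tri (q ℕ.+ n)))) (D n)
      squeeze n 1≤N M≤N =
        subst (_≤ r) (cancel lo) (*-monoʳ (recip≥0 C) (subst (λ z → lo * ι (choose z (M n)) ≤ ι (choose (tri n) (M n)))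
          (sym (tri-+ q n)) (choose-ratio-≥ 1≤N M≤N (D n)))) ,
        subst (r ≤_) (cancel hi) (*-monoʳ (recip≥0 C) (subst (λ z → ι (choose (tri n) (M n)) ≤ hi * ι (choose z (M n)))
          (sym (tri-+ q n)) (choose-ratio-≤ 1≤N M≤N (D n) (ℕₚ.≤-reflexive (sym (tri-+ q n))))))
        where
        C = choose (tri (q ℕ.+ n)) (M n)
        r = ι (choose (tri n) (M n)) * recip C
        lo = pow (1ℚ + - (ι (M n) * recip (tri n))) (D n)
        hi = pow (1ℚ + - (ι (M n) * recip (tri (q ℕ.+ n)))) (D n)
        1≤C : 1 ℕ.≤ C
        1≤C = choose>0 (ℕₚ.≤-trans M≤N (ℕₚ.≤-trans (ℕₚ.m≤n+m (tri n) (D n)) (ℕₚ.≤-reflexive (sym (tri-+ q n)))))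
        cancel : ∀ p → p * ι C * recip C ≡ p
        cancel p = trans (*-assoc p (ι C) (recip C)) (trans (cong (p *_) (ι*recip 1≤C)) (*-identityʳ p))

    -- Induction on e. With j = M - e - 1, `choose-step` gives (T - j) C(T, j) = (M - e) C(T, j+1)
    -- for T = `tri n`; divided by n², the left factor tends to ½, and (M - e)/n to c, so one edge
    -- fewer contributes 2c/n.
    edges-≈ : ∀ {q} → 1 ℕ.≤ q → ∀ e →
      (λ n → pow (ι n) e * (ι (choose (tri n) (M n ℕ.∸ e)) * recip (choose (tri (q ℕ.+ n)) (M n)))) ≈
      (λ n → pow (ι 2 * c n) e * expSum (exponent c q n) n)
    edges-≈ {q} 1≤q zero = ≈-trans (≈-pointwise (λ n → *-identityˡ _))
      (≈-trans (deletion-≈ 1≤q) (≈-pointwise (λ n → sym (*-identityˡ _))))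
    edges-≈ {q} 1≤q (suc e) = ≈-cancel (positive⁻¹ ½)
      (ev-zip (λ {n} e<M 1≤n → formula n e<M 1≤n) (M-unbounded (suc e)) (ev-≥ 1))
      (tri∸-≈ (λ n → M n ℕ.∸ suc e) (λ n → ℕₚ.m∸n≤m (M n) (suc e)))
      (≈-trans (≈-* (≈-bounded (edges-≈ 1≤q e) limit-bounded) c-bounded (edges-≈ 1≤q e) M∸e≈)
        (≈-pointwise (λ n → half-double (pow (ι 2 * c n) e) (expSum (exponent c q n) n) (c n))))
      (bounded-* (pow-bounded 2c-bounded (suc e)) (exp-bounded (exponent-bounded q)))
      where
      2c-bounded : Bounded (λ n → ι 2 * c n)
      2c-bounded = bounded-* (const-bounded (ι 2)) c-bounded
      limit-bounded : Bounded (λ n → pow (ι 2 * c n) e * expSum (exponent c q n) n)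
      limit-bounded = bounded-* (pow-bounded 2c-bounded e) (exp-bounded (exponent-bounded q))
      ι-2 : ι 2 ≡ 1ℚ + 1ℚ
      ι-2 = trans (ι-+ 1 1) (cong₂ _+_ ι-1 ι-1)
      half-double : ∀ p x c → p * x * c ≡ ½ * (ι 2 * c * p * x)
      half-double p x c = trans (ring p x c) (cong (λ z → ½ * (z * c * p * x)) (sym ι-2))
        where
        ring : ∀ p x c → p * x * c ≡ ½ * ((1ℚ + 1ℚ) * c * p * x)
        ring = solve-∀ ℚ-ring
      M∸e≈ : (λ n → ι (M n ℕ.∸ e) * recip n) ≈ c
      M∸e≈ = ≈-squeeze (always (∸-bounds M e))
        (≈-trans (≈-+ density (≈-neg (const*recip≈0 (ι e)))) (≈-pointwise (λ n → +-identityʳ (c n))))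
        density
      formula : ∀ n → suc e ℕ.≤ M n → 1 ℕ.≤ n →
        pow (ι n) (suc e) * (ι (choose (tri n) (M n ℕ.∸ suc e)) * recip (choose (tri (q ℕ.+ n)) (M n))) *
          (ι (tri n ℕ.∸ (M n ℕ.∸ suc e)) * (recip n * recip n)) ≡
        pow (ι n) e * (ι (choose (tri n) (M n ℕ.∸ e)) * recip (choose (tri (q ℕ.+ n)) (M n))) * (ι (M n ℕ.∸ e) * recip n)
      formula n e<M 1≤n = begin
        i * p * (a * r) * (d * (ν * ν))    ≡⟨ regroup i p a r d ν ⟩
        d * a * (p * r * ((i * ν) * ν))    ≡⟨ cong₂ (λ x y → x * (p * r * (y * ν))) step (ι*recip 1≤n) ⟩
        s * b * (p * r * (1ℚ * ν))         ≡⟨ regroup′ s b p r ν ⟩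
        p * (b * r) * (s * ν)              ∎
        where
        open ≡-Reasoning
        i = ι n
        ν = recip n
        p = pow (ι n) e
        j = M n ℕ.∸ suc e
        a = ι (choose (tri n) j)
        b = ι (choose (tri n) (M n ℕ.∸ e))
        r = recip (choose (tri (q ℕ.+ n)) (M n))
        d = ι (tri n ℕ.∸ j)
        s = ι (M n ℕ.∸ e)
        M∸e≡ : suc j ≡ M n ℕ.∸ e
        M∸e≡ = sym (ℕₚ.+-∸-assoc 1 e<M)
        step : d * a ≡ s * b
        step = trans (sym (ι-* (tri n ℕ.∸ j) (choose (tri n) j))) (trans (cong ι (sym (choose-step (tri n) j)))
          (trans (ι-* (suc j) (choose (tri n) (suc j))) (cong (λ z → ι z * ι (choose (tri n) z)) M∸e≡)))
        regroup : ∀ i p a r d ν → i * p * (a * r) * (d * (ν * ν)) ≡ d * a * (p * r * ((i * ν) * ν))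
        regroup = solve-∀ ℚ-ring
        regroup′ : ∀ s b p r ν → s * b * (p * r * (1ℚ * ν)) ≡ p * (b * r) * (s * ν)
        regroup′ = solve-∀ ℚ-ring

  -- Limits of the moments

  ∑ℚ : {A : Set} → List A → (A → ℚ) → ℚ
  ∑ℚ []       f = 0ℚ
  ∑ℚ (x ∷ xs) f = f x + ∑ℚ xs f

  module _ {A : Set} where

    ι-∑ : ∀ (xs : List A) f → ι (∑ xs f) ≡ ∑ℚ xs (λ x → ι (f x))
    ι-∑ []       f = ι-0
    ι-∑ (x ∷ xs) f = trans (ι-+ (f x) (∑ xs f)) (cong (_+_ (ι (f x))) (ι-∑ xs f))

    ∑ℚ-cong : ∀ (xs : List A) {f g : A → ℚ} → (∀ x → f x ≡ g x) → ∑ℚ xs f ≡ ∑ℚ xs g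
    ∑ℚ-cong []       h = refl
    ∑ℚ-cong (x ∷ xs) h = cong₂ _+_ (h x) (∑ℚ-cong xs h)

    ∑ℚ-*ˡ : ∀ (xs : List A) c f → ∑ℚ xs (λ x → c * f x) ≡ c * ∑ℚ xs f
    ∑ℚ-*ˡ []       c f = sym (*-zeroʳ c)
    ∑ℚ-*ˡ (x ∷ xs) c f = trans (cong (_+_ (c * f x)) (∑ℚ-*ˡ xs c f)) (sym (*-distribˡ-+ c (f x) (∑ℚ xs f)))

    ∑ℚ-*ʳ : ∀ (xs : List A) c f → ∑ℚ xs (λ x → f x * c) ≡ ∑ℚ xs f * c
    ∑ℚ-*ʳ xs c f = trans (∑ℚ-cong xs (λ x → *-comm (f x) c)) (trans (∑ℚ-*ˡ xs c f) (*-comm c (∑ℚ xs f)))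

    ∑ℚ-≈ : ∀ {P : A → Set} {xs : List A} (f g : A → ℕ → ℚ) → All P xs → (∀ {x} → P x → f x ≈ g x) →
           (λ n → ∑ℚ xs (λ x → f x n)) ≈ (λ n → ∑ℚ xs (λ x → g x n))
    ∑ℚ-≈ f g []       h = ≈-refl
    ∑ℚ-≈ f g (p ∷ ps) h = ≈-+ (h p) (∑ℚ-≈ f g ps h)

    ∑ℚ-bounded : ∀ (xs : List A) (f : A → ℕ → ℚ) → (∀ x → Bounded (f x)) → Bounded (λ n → ∑ℚ xs (λ x → f x n))
    ∑ℚ-bounded []       f h = const-bounded 0ℚ
    ∑ℚ-bounded (x ∷ xs) f h = bounded-+ (h x) (∑ℚ-bounded xs f h)

  infix 4 _≈ᵇ_

  record _≈ᵇ_ (u v : ℕ → ℚ) : Set where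
    constructor _,ᵇ_
    field
      ≈ᵇ⇒≈    : u ≈ v
      ≈ᵇ-bound : Bounded v
  open _≈ᵇ_ public

  infixl 7 _*ᵇ_

  _*ᵇ_ : ∀ {u u′ v v′} → u ≈ᵇ u′ → v ≈ᵇ v′ → (λ n → u n * v n) ≈ᵇ (λ n → u′ n * v′ n)
  (h ,ᵇ bu′) *ᵇ (k ,ᵇ bv′) = ≈-* (≈-bounded h bu′) bv′ h k ,ᵇ bounded-* bu′ bv′

  pow-1 : ∀ n → pow 1ℚ n ≡ 1ℚ
  pow-1 zero    = refl
  pow-1 (suc n) = trans (*-identityˡ (pow 1ℚ n)) (pow-1 n)

  pow-ι*recip : ∀ {n} → 1 ℕ.≤ n → ∀ k → pow (ι n) k * pow (recip n) k ≡ 1ℚ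
  pow-ι*recip {n} 1≤n k = trans (sym (pow-* (ι n) (recip n) k)) (trans (cong (λ z → pow z k) (ι*recip 1≤n)) (pow-1 k))

  -- n^k · n^-(a+1) picks out the trees among the connected graphs with k vertices and a edges.
  weight-≈ : ∀ {k a} → k ℕ.≤ suc a →
             (λ n → pow (ι n) k * pow (recip n) (suc a)) ≈ᵇ (λ _ → ι (𝟙 (suc a ℕₚ.≟ k)))
  weight-≈ {k} {a} k≤ = ≈-trans (≈-eventually (1 , λ {n} 1≤n → trans
      (cong (λ z → pow (ι n) k * pow (recip n) z) (sym (ℕₚ.m+[n∸m]≡n k≤)))
      (trans (cong (pow (ι n) k *_) (pow-+ (recip n) k d)) (trans (sym (*-assoc (pow (ι n) k) (pow (recip n) k) (pow (recip n) d)))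
        (trans (cong (_* pow (recip n) d) (pow-ι*recip 1≤n k)) (*-identityˡ _)))))) (rest d refl) ,ᵇ const-bounded _
    where
    d = suc a ℕ.∸ k
    rest : ∀ d′ → d′ ≡ suc a ℕ.∸ k → (λ n → pow (recip n) d′) ≈ (λ _ → ι (𝟙 (suc a ℕₚ.≟ k)))
    rest zero     e = ≈-pointwise (λ _ → sym (trans (cong ι (𝟙-yes (suc a ℕₚ.≟ k) (ℕₚ.≤-antisym (ℕₚ.m∸n≡0⇒m≤n (sym e)) k≤))) ι-1))
    rest (suc d′) e = ≈-trans (≈-* bounded-recip (pow-bounded bounded-recip d′)
        recip≈0 (≈-refl {λ n → pow (recip n) d′}))
      (≈-pointwise (λ n → trans (*-zeroˡ (pow (recip n) d′))
        (sym (trans (cong ι (𝟙-no (suc a ℕₚ.≟ k) (λ eq → 0≢suc (trans (sym (ℕₚ.n∸n≡0 (suc a))) (trans (cong (suc a ℕ.∸_) eq) (sym e)))))) ι-0))))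
      where
      0≢suc : 0 ≢ suc d′
      0≢suc ()

  module _ {M : ℕ → ℕ} {c : ℕ → ℚ} (dens : Density M c) {k : ℕ} (1≤k : 1 ℕ.≤ k) where
    open Density dens

    private
      L = connectedEdges k
      f = invFactorial k

    -- the asymptotic density of components of order k with a edges
    part : ℕ → ℕ → ℚ
    part a n = f * ι (𝟙 (suc a ℕₚ.≟ k)) * (pow (ι 2 * c n) a * expSum (exponent c k n) n)

    parts : ℕ → ℚ
    parts n = ∑ℚ L (λ a → part a n)

    private
      exp-bound : Bounded (λ n → expSum (exponent c k n) n)
      exp-bound = exp-bounded (exponent-bounded dens k)

      2c-bound : ∀ a → Bounded (λ n → pow (ι 2 * c n) a)
      2c-bound = pow-bounded (bounded-* (const-bounded (ι 2)) c-bounded)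

    part-bounded : ∀ a → Bounded (part a)
    part-bounded a = bounded-* (const-bounded (f * ι (𝟙 (suc a ℕₚ.≟ k)))) (bounded-* (2c-bound a) exp-bound)

    -- Each summand is a product of three convergent factors: C(k+n, k)/n^k, the weight n^k/n^(a+1),
    -- and n^a times the ratio of graph counts treated in `edges-≈`.
    firstMoment-≈ : (λ n → ι (firstMoment k (k ℕ.+ n) 0 (M n)) * (recip n * recip (choose (tri (k ℕ.+ n)) (M n)))) ≈ parts
    firstMoment-≈ = ≈-trans (≈-pointwise expand) (∑ℚ-≈ term part (connectedEdges-≥ k) (λ {a} k≤ →
        ≈-trans (≈-eventually (formula a)) (≈ᵇ⇒≈ ((choose-≈ k k ,ᵇ const-bounded f) *ᵇ weight-≈ k≤ *ᵇ
          (edges-≈ dens 1≤k a ,ᵇ bounded-* (2c-bound a) exp-bound)))))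
      where
      term : ℕ → ℕ → ℚ
      term a n = ι (choose (k ℕ.+ n) k) * (ι (graphCount n a (M n)) * (recip n * recip (choose (tri (k ℕ.+ n)) (M n))))
      expand : ∀ n → ι (firstMoment k (k ℕ.+ n) 0 (M n)) * (recip n * recip (choose (tri (k ℕ.+ n)) (M n))) ≡ ∑ℚ L (λ a → term a n)
      expand n = begin
        ι (firstMoment k (k ℕ.+ n) 0 (M n)) * R
          ≡⟨ cong (λ z → ι z * R) (trans (firstMoment≡ (k ℕ.+ n) 0 (M n) 1≤k)
               (cong (λ z → choose (k ℕ.+ n) k ℕ.* ∑ L (λ a → graphCount z a (M n))) (ℕₚ.m+n∸m≡n k n))) ⟩
        ι (choose (k ℕ.+ n) k ℕ.* ∑ L (λ a → graphCount n a (M n))) * R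
          ≡⟨ cong (_* R) (trans (ι-* (choose (k ℕ.+ n) k) _) (cong (ι (choose (k ℕ.+ n) k) *_) (ι-∑ L _))) ⟩
        ι (choose (k ℕ.+ n) k) * ∑ℚ L (λ a → ι (graphCount n a (M n))) * R
          ≡⟨ *-assoc (ι (choose (k ℕ.+ n) k)) _ R ⟩
        ι (choose (k ℕ.+ n) k) * (∑ℚ L (λ a → ι (graphCount n a (M n))) * R)
          ≡⟨ cong (ι (choose (k ℕ.+ n) k) *_) (sym (∑ℚ-*ʳ L R _)) ⟩
        ι (choose (k ℕ.+ n) k) * ∑ℚ L (λ a → ι (graphCount n a (M n)) * R)
          ≡⟨ sym (∑ℚ-*ˡ L (ι (choose (k ℕ.+ n) k)) _) ⟩
        ∑ℚ L (λ a → term a n) ∎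
        where
        open ≡-Reasoning
        R = recip n * recip (choose (tri (k ℕ.+ n)) (M n))
      formula : ∀ a → Eventually (λ n → term a n ≡
        ι (choose (k ℕ.+ n) k) * pow (recip n) k * (pow (ι n) k * pow (recip n) (suc a)) *
        (pow (ι n) a * (ι (choose (tri n) (M n ℕ.∸ a)) * recip (choose (tri (k ℕ.+ n)) (M n)))))
      formula a = ev-zip (λ {n} a≤M 1≤n → step n a≤M 1≤n) (M-unbounded dens a) (ev-≥ 1)
        where
        step : ∀ n → a ℕ.≤ M n → 1 ℕ.≤ n → _
        step n a≤M 1≤n = begin
          C * (ι (graphCount n a (M n)) * (ν * r))   ≡⟨ cong (λ z → C * (ι z * (ν * r))) (graphCount≡choose n a≤M) ⟩
          C * (g * (ν * r))                          ≡⟨ insert-1s C g ν r ⟩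
          -- The two ones become n^k n^(-k) and n^a n^(-a), which hand each factor the power of n
          -- that makes it converge.
          C * (1ℚ * 1ℚ) * (g * (ν * r))              ≡⟨ cong₂ (λ x y → C * (x * y) * (g * (ν * r))) (sym (pow-ι*recip 1≤n k)) (sym (pow-ι*recip 1≤n a)) ⟩
          C * (pow i k * pow ν k * (pow i a * pow ν a)) * (g * (ν * r))
                                                     ≡⟨ regroup C (pow i k) (pow ν k) (pow i a) (pow ν a) g ν r ⟩
          C * pow ν k * (pow i k * (ν * pow ν a)) * (pow i a * (g * r)) ∎
          where
          open ≡-Reasoning
          C = ι (choose (k ℕ.+ n) k)
          g = ι (choose (tri n) (M n ℕ.∸ a))
          r = recip (choose (tri (k ℕ.+ n)) (M n))
          ν = recip n
          i = ι n
          insert-1s : ∀ C g ν r → C * (g * (ν * r)) ≡ C * (1ℚ * 1ℚ) * (g * (ν * r))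
          insert-1s = solve-∀ ℚ-ring
          regroup : ∀ C ik νk ia νa g ν r →
            C * (ik * νk * (ia * νa)) * (g * (ν * r)) ≡ C * νk * (ik * (ν * νa)) * (ia * (g * r))
          regroup = solve-∀ ℚ-ring

    -- the sum over ordered pairs of distinct components
    pairMoment : ℕ → ℕ → ℕ
    pairMoment t m = choose t k ℕ.* ∑ L (λ a → firstMoment k (t ℕ.∸ k) a m)

    -- Removing both components deletes 2k vertices, and e^(-4kc) is the square of e^(-2kc) by
    -- `exp-double`, while (2c)^(a+b) factors by `pow-+`. The double sum therefore separates:
    -- distinct components are asymptotically independent.
    pairMoment-≈ : (λ n → ι (pairMoment (k ℕ.+ k ℕ.+ n) (M n)) * (recip n * recip n * recip (choose (tri (k ℕ.+ k ℕ.+ n)) (M n))))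
                   ≈ (λ n → parts n * parts n)
    pairMoment-≈ = ≈-trans (≈-pointwise expand) (≈-trans
      (∑ℚ-≈ (λ a n → ∑ℚ L (λ b → term a b n)) (λ a n → ∑ℚ L (λ b → part a n * part b n)) (connectedEdges-≥ k) (λ {a} k≤a →
        ∑ℚ-≈ (λ b → term a b) (λ b n → part a n * part b n) (connectedEdges-≥ k) (λ {b} k≤b →
          ≈-trans (≈-eventually (formula a b)) (≈-trans
            (≈ᵇ⇒≈ ((choose-≈ (k ℕ.+ k) k ,ᵇ const-bounded f) *ᵇ (choose-≈ k k ,ᵇ const-bounded f) *ᵇ
              (weight-≈ k≤a *ᵇ weight-≈ k≤b) *ᵇ ((≈-trans (edges-≈ dens 1≤k+k (a ℕ.+ b))
                (≈-* (2c-bound (a ℕ.+ b)) (bounded-* exp-bound exp-bound) (≈-refl {λ n → pow (ι 2 * c n) (a ℕ.+ b)}) exp-2k))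
                ,ᵇ bounded-* (2c-bound (a ℕ.+ b)) (bounded-* exp-bound exp-bound))))
            (≈-pointwise (λ n → trans (cong (λ z → f * f * (ι (𝟙 (suc a ℕₚ.≟ k)) * ι (𝟙 (suc b ℕₚ.≟ k))) *
                (z * (expSum (exponent c k n) n * expSum (exponent c k n) n))) (pow-+ (ι 2 * c n) a b))
              (separate f (ι (𝟙 (suc a ℕₚ.≟ k))) (ι (𝟙 (suc b ℕₚ.≟ k))) (pow (ι 2 * c n) a) (pow (ι 2 * c n) b) (expSum (exponent c k n) n))))))))
      (≈-pointwise (λ n → trans (∑ℚ-cong L (λ a → ∑ℚ-*ˡ L (part a n) (λ b → part b n))) (∑ℚ-*ʳ L (parts n) (λ a → part a n)))))
      where
      1≤k+k : 1 ℕ.≤ k ℕ.+ k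
      1≤k+k = ℕₚ.≤-trans 1≤k (ℕₚ.m≤m+n k k)
      separate : ∀ f s t x y e → f * f * (s * t) * (x * y * (e * e)) ≡ f * s * (x * e) * (f * t * (y * e))
      separate = solve-∀ ℚ-ring
      exp-2k : (λ n → expSum (exponent c (k ℕ.+ k) n) n) ≈ (λ n → expSum (exponent c k n) n * expSum (exponent c k n) n)
      exp-2k = ≈-trans (≈-pointwise (λ n → cong (λ z → expSum z n) (exponent-double n))) (exp-double (exponent-bounded dens k))
        where
        double : ∀ q c → - ((q + q) * c) ≡ - (q * c) + - (q * c)
        double = solve-∀ ℚ-ring
        exponent-double : ∀ n → exponent c (k ℕ.+ k) n ≡ exponent c k n + exponent c k n
        exponent-double n = trans (cong (λ z → - (z * c n)) (trans (cong ι (ℕₚ.*-distribˡ-+ 2 k k)) (ι-+ (2 ℕ.* k) (2 ℕ.* k)))) (double (ι (2 ℕ.* k)) (c n))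
      term : ℕ → ℕ → ℕ → ℚ
      term a b n = ι (choose (k ℕ.+ k ℕ.+ n) k) * ι (choose (k ℕ.+ n) k) *
        (ι (graphCount n (a ℕ.+ b) (M n)) * (recip n * recip n * recip (choose (tri (k ℕ.+ k ℕ.+ n)) (M n))))
      expand : ∀ n → ι (pairMoment (k ℕ.+ k ℕ.+ n) (M n)) * (recip n * recip n * recip (choose (tri (k ℕ.+ k ℕ.+ n)) (M n)))
               ≡ ∑ℚ L (λ a → ∑ℚ L (λ b → term a b n))
      expand n = begin
        ι (C ℕ.* ∑ L (λ a → firstMoment k (t ℕ.∸ k) a (M n))) * R
          ≡⟨ cong (_* R) (trans (ι-* C _) (cong (ι C *_) (ι-∑ L _))) ⟩
        ι C * ∑ℚ L (λ a → ι (firstMoment k (t ℕ.∸ k) a (M n))) * R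
          ≡⟨ cong (λ z → ι C * z * R) (∑ℚ-cong L (λ a → inner a)) ⟩
        ι C * ∑ℚ L (λ a → ι C′ * ∑ℚ L (λ b → ι (graphCount n (a ℕ.+ b) (M n)))) * R
          ≡⟨ cong (λ z → ι C * z * R) (∑ℚ-*ˡ L (ι C′) _) ⟩
        ι C * (ι C′ * ∑ℚ L (λ a → ∑ℚ L (λ b → ι (graphCount n (a ℕ.+ b) (M n))))) * R
          ≡⟨ regroup (ι C) (ι C′) _ R ⟩
        ι C * ι C′ * (∑ℚ L (λ a → ∑ℚ L (λ b → ι (graphCount n (a ℕ.+ b) (M n)))) * R)
          ≡⟨ cong (ι C * ι C′ *_) (trans (sym (∑ℚ-*ʳ L R _)) (∑ℚ-cong L (λ a → sym (∑ℚ-*ʳ L R _)))) ⟩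
        ι C * ι C′ * ∑ℚ L (λ a → ∑ℚ L (λ b → ι (graphCount n (a ℕ.+ b) (M n)) * R))
          ≡⟨ trans (sym (∑ℚ-*ˡ L (ι C * ι C′) _)) (∑ℚ-cong L (λ a → sym (∑ℚ-*ˡ L (ι C * ι C′) _))) ⟩
        ∑ℚ L (λ a → ∑ℚ L (λ b → term a b n)) ∎
        where
        open ≡-Reasoning
        t = k ℕ.+ k ℕ.+ n
        C = choose t k
        C′ = choose (k ℕ.+ n) k
        R = recip n * recip n * recip (choose (tri t) (M n))
        regroup : ∀ a b s r → a * (b * s) * r ≡ a * b * (s * r)
        regroup = solve-∀ ℚ-ring
        t∸k : t ℕ.∸ k ≡ k ℕ.+ n
        t∸k = trans (cong (ℕ._∸ k) (ℕₚ.+-assoc k k n)) (ℕₚ.m+n∸m≡n k (k ℕ.+ n))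
        inner : ∀ a → ι (firstMoment k (t ℕ.∸ k) a (M n)) ≡ ι C′ * ∑ℚ L (λ b → ι (graphCount n (a ℕ.+ b) (M n)))
        inner a = trans (cong ι (trans (cong (λ z → firstMoment k z a (M n)) t∸k) (trans (firstMoment≡ (k ℕ.+ n) a (M n) 1≤k)
            (cong (λ z → C′ ℕ.* ∑ L (λ b → graphCount z (a ℕ.+ b) (M n))) (ℕₚ.m+n∸m≡n k n)))))
          (trans (ι-* C′ _) (cong (ι C′ *_) (ι-∑ L _)))
      formula : ∀ a b → Eventually (λ n → term a b n ≡
        ι (choose (k ℕ.+ k ℕ.+ n) k) * pow (recip n) k * (ι (choose (k ℕ.+ n) k) * pow (recip n) k) *
        (pow (ι n) k * pow (recip n) (suc a) * (pow (ι n) k * pow (recip n) (suc b))) *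
        (pow (ι n) (a ℕ.+ b) * (ι (choose (tri n) (M n ℕ.∸ (a ℕ.+ b))) * recip (choose (tri (k ℕ.+ k ℕ.+ n)) (M n)))))
      formula a b = ev-zip (λ {n} h 1≤n → step n h 1≤n) (M-unbounded dens (a ℕ.+ b)) (ev-≥ 1)
        where
        step : ∀ n → a ℕ.+ b ℕ.≤ M n → 1 ℕ.≤ n → _
        step n a+b≤M 1≤n = begin
          C * C′ * (ι (graphCount n (a ℕ.+ b) (M n)) * (ν * ν * r))
            ≡⟨ cong (λ z → C * C′ * (ι z * (ν * ν * r))) (graphCount≡choose n a+b≤M) ⟩
          C * C′ * (g * (ν * ν * r))
            ≡⟨ insert-1s C C′ g ν r ⟩
          C * C′ * (1ℚ * 1ℚ * 1ℚ) * (g * (ν * ν * r))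
            ≡⟨ cong₂ (λ x y → C * C′ * (x * x * y) * (g * (ν * ν * r))) (sym (pow-ι*recip 1≤n k))
                 (sym (trans (cong (pow i (a ℕ.+ b) *_) (sym (pow-+ ν a b))) (pow-ι*recip 1≤n (a ℕ.+ b)))) ⟩
          C * C′ * (pow i k * pow ν k * (pow i k * pow ν k) * (pow i (a ℕ.+ b) * (pow ν a * pow ν b))) * (g * (ν * ν * r))
            ≡⟨ regroup C C′ (pow i k) (pow ν k) (pow i (a ℕ.+ b)) (pow ν a) (pow ν b) g ν r ⟩
          C * pow ν k * (C′ * pow ν k) * (pow i k * (ν * pow ν a) * (pow i k * (ν * pow ν b))) * (pow i (a ℕ.+ b) * (g * r)) ∎
          where
          open ≡-Reasoning
          C = ι (choose (k ℕ.+ k ℕ.+ n) k)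
          C′ = ι (choose (k ℕ.+ n) k)
          g = ι (choose (tri n) (M n ℕ.∸ (a ℕ.+ b)))
          r = recip (choose (tri (k ℕ.+ k ℕ.+ n)) (M n))
          ν = recip n
          i = ι n
          insert-1s : ∀ C C′ g ν r → C * C′ * (g * (ν * ν * r)) ≡ C * C′ * (1ℚ * 1ℚ * 1ℚ) * (g * (ν * ν * r))
          insert-1s = solve-∀ ℚ-ring
          regroup : ∀ C C′ ik νk iab νa νb g ν r →
            C * C′ * (ik * νk * (ik * νk) * (iab * (νa * νb))) * (g * (ν * ν * r)) ≡
            C * νk * (C′ * νk) * (ik * (ν * νa) * (ik * (ν * νb))) * (iab * (g * r))
          regroup = solve-∀ ℚ-ring

  -- From n remaining vertices to q + n vertices in all

  ιn/[q+n]≈1 : ∀ q → (λ n → ι n * recip (q ℕ.+ n)) ≈ (λ _ → 1ℚ)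
  ιn/[q+n]≈1 q = ≈-trans (≈-eventually (1 , λ {n} 1≤n → trans (expand (ι q) (ι n) (recip (q ℕ.+ n)))
      (cong (_- ι q * recip (q ℕ.+ n)) (trans (cong (_* recip (q ℕ.+ n)) (sym (ι-+ q n))) (ι*recip (ℕₚ.≤-trans 1≤n (ℕₚ.m≤n+m n q)))))))
    (≈-trans (≈-+ (≈-refl {λ _ → 1ℚ}) (≈-neg q/[q+n]≈0)) (≈-pointwise (λ _ → +-identityʳ 1ℚ)))
    where
    q/[q+n]≈0 : (λ n → ι q * recip (q ℕ.+ n)) ≈ (λ _ → 0ℚ)
    q/[q+n]≈0 = ≈-shift q {λ n → ι q * recip n} {λ _ → 0ℚ} (const*recip≈0 (ι q))
    expand : ∀ q n r → n * r ≡ (q + n) * r - q * r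
    expand = solve-∀ ℚ-ring

  -- The moments on q + n vertices measure the edges against the n remaining vertices; the ratio of
  -- the two vertex numbers tends to 1.
  density-shift : ∀ {m c} → Density m c → ∀ q → Density (λ n → m (q ℕ.+ n)) (λ n → c (q ℕ.+ n))
  density-shift {m} {c} dens q = record
    { density   = ≈-trans (≈-eventually (1 , λ {n} 1≤n → trans
        (sym (*-identityʳ (ι (m (q ℕ.+ n)) * recip n)))
        (trans (cong (ι (m (q ℕ.+ n)) * recip n *_) (sym (ι*recip (ℕₚ.≤-trans 1≤n (ℕₚ.m≤n+m n q)))))
          (regroup (ι (m (q ℕ.+ n))) (recip n) (ι (q ℕ.+ n)) (recip (q ℕ.+ n))))))
        (≈-trans (≈-* (≈-bounded (≈-shift q density) bc) (const-bounded 1ℚ) (≈-shift q density) (ι[q+n]/n≈1 q))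
          (≈-pointwise (λ n → *-identityʳ (c (q ℕ.+ n)))))
    ; c-bounded = bc
    ; c₀        = c₀
    ; c₀>0      = c₀>0
    ; c₀≤c      = shift q c₀≤c }
    where
    open Density dens
    open Bounded c-bounded
    bc : Bounded (λ n → c (q ℕ.+ n))
    bc = bounded bound bound>0 (shift q ≤bound)
    regroup : ∀ m r i s → m * r * (i * s) ≡ m * s * (i * r)
    regroup = solve-∀ ℚ-ring

  -- The predicted count per vertex, at the t-th approximation of c. By `seq-limitℝ` it is also the
  -- t-th approximation of the corresponding real constant.
  limit : (ℕ → ℚ) → ℕ → ℕ → ℚ
  limit c k t = ι (k ℕ.^ (k ℕ.∸ 2)) * invFactorial k * (pow (ι 2 * c t) (k ℕ.∸ 1) * expSum (exponent c k t) t)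

  limit-bounded : ∀ {c} → Bounded c → ∀ k → Bounded (limit c k)
  limit-bounded bc k = bounded-* (const-bounded (ι (k ℕ.^ (k ℕ.∸ 2)) * invFactorial k))
    (bounded-* (pow-bounded (bounded-* (const-bounded (ι 2)) bc) (k ℕ.∸ 1))
      (exp-bounded (bounded-neg (bounded-* (const-bounded (ι (2 ℕ.* k))) bc))))

  -- The indicator leaves only a = k - 1, so the power of 2c comes out of the sum, and `cayley`
  -- evaluates what remains.
  parts≡ : ∀ {M c} (dens : Density M c) {k} (1≤k : 1 ℕ.≤ k) n → parts dens 1≤k n ≡
    ι (k ℕ.^ (k ℕ.∸ 2)) * invFactorial k * (pow (ι 2 * c n) (k ℕ.∸ 1) * expSum (exponent c k n) n)
  parts≡ {M} {c} dens {k} 1≤k n = begin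
    ∑ℚ L (λ a → f * ι (𝟙 (suc a ℕₚ.≟ k)) * (pow x a * e))
      ≡⟨ ∑ℚ-cong L (λ a → trans (regroup f (ι (𝟙 (suc a ℕₚ.≟ k))) (pow x a) e) (cong (λ z → f * e * z) (tree a))) ⟩
    ∑ℚ L (λ a → f * e * (ι (𝟙 (suc a ℕₚ.≟ k)) * pow x (k ℕ.∸ 1)))
      ≡⟨ trans (∑ℚ-*ˡ L (f * e) _) (cong (f * e *_) (∑ℚ-*ʳ L (pow x (k ℕ.∸ 1)) _)) ⟩
    f * e * (∑ℚ L (λ a → ι (𝟙 (suc a ℕₚ.≟ k))) * pow x (k ℕ.∸ 1))
      ≡⟨ cong (λ z → f * e * (z * pow x (k ℕ.∸ 1))) (trans (sym (ι-∑ L _)) (cong ι (cayley 1≤k))) ⟩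
    f * e * (ι (k ℕ.^ (k ℕ.∸ 2)) * pow x (k ℕ.∸ 1))
      ≡⟨ regroup′ f e (ι (k ℕ.^ (k ℕ.∸ 2))) (pow x (k ℕ.∸ 1)) ⟩
    ι (k ℕ.^ (k ℕ.∸ 2)) * f * (pow x (k ℕ.∸ 1) * e) ∎
    where
    open ≡-Reasoning
    L = connectedEdges k
    f = invFactorial k
    x = ι 2 * c n
    e = expSum (exponent c k n) n
    regroup : ∀ f i p e → f * i * (p * e) ≡ f * e * (i * p)
    regroup = solve-∀ ℚ-ring
    regroup′ : ∀ f e t p → f * e * (t * p) ≡ t * f * (p * e)
    regroup′ = solve-∀ ℚ-ring
    tree : ∀ a → ι (𝟙 (suc a ℕₚ.≟ k)) * pow x a ≡ ι (𝟙 (suc a ℕₚ.≟ k)) * pow x (k ℕ.∸ 1)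
    tree a with suc a ℕₚ.≟ k
    ... | yes refl = refl
    ... | no _     = trans (cong (_* pow x a) ι-0) (trans (*-zeroˡ (pow x a)) (sym (trans (cong (_* pow x (k ℕ.∸ 1)) ι-0) (*-zeroˡ (pow x (k ℕ.∸ 1))))))

  module _ {m : ℕ → ℕ} {c : ℕ → ℚ} (dens : Density m c) {k : ℕ} (1≤k : 1 ℕ.≤ k) where
    open Density dens using (c-bounded)

    parts-≈ : ∀ q → parts (density-shift dens q) 1≤k ≈ (λ n → limit c k (q ℕ.+ n))
    parts-≈ q = ≈-trans (≈-pointwise (parts≡ (density-shift dens q) 1≤k))
      (≈-* (const-bounded a) (bounded-* pb (≈-bounded (≈-sym index) eb)) (≈-refl {λ _ → a})
        (≈-* pb (≈-bounded (≈-sym index) eb) (≈-refl {λ n → pow (ι 2 * c (q ℕ.+ n)) (k ℕ.∸ 1)}) index))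
      where
      module D = Density (density-shift dens q)
      a = ι (k ℕ.^ (k ℕ.∸ 2)) * invFactorial k
      pb : Bounded (λ n → pow (ι 2 * c (q ℕ.+ n)) (k ℕ.∸ 1))
      pb = pow-bounded (bounded-* (const-bounded (ι 2)) D.c-bounded) (k ℕ.∸ 1)
      yb : Bounded (λ n → exponent c k (q ℕ.+ n))
      yb = exponent-bounded (density-shift dens q) k
      eb : Bounded (λ n → expSum (exponent c k (q ℕ.+ n)) n)
      eb = exp-bounded yb
      -- The argument is already taken at q + n; only the cut-off of the partial sum has to move
      -- from n to q + n.
      index : (λ n → expSum (exponent c k (q ℕ.+ n)) n) ≈ (λ n → expSum (exponent c k (q ℕ.+ n)) (q ℕ.+ n))
      index = ≈-sym (expSum-index ≈-refl yb (always (λ n → ℕₚ.m≤n+m n q)))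

    count : ℕ → ℕ
    count t = choose (tri t) (m t)

    mean-≈ : (λ t → ι (firstMoment k t 0 (m t)) * (recip t * recip (count t))) ≈ limit c k
    mean-≈ = ≈-unshift k (≈-trans
      -- The inserted 1 = n (1/n) exchanges the normalisation 1/(k+n) for 1/n, at the price of the
      -- factor n/(k+n), which tends to 1.
      (≈-eventually (1 , λ {n} 1≤n → trans (sym (*-identityʳ _)) (trans
        (cong (ι (firstMoment k (k ℕ.+ n) 0 (m (k ℕ.+ n))) * (recip (k ℕ.+ n) * recip (count (k ℕ.+ n))) *_) (sym (ι*recip 1≤n)))
        (regroup (ι (firstMoment k (k ℕ.+ n) 0 (m (k ℕ.+ n)))) (recip (k ℕ.+ n)) (recip (count (k ℕ.+ n))) (ι n) (recip n)))))
      (≈-trans (≈-* (≈-bounded (firstMoment-≈ (density-shift dens k) 1≤k) parts-bounded) (const-bounded 1ℚ)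
          (firstMoment-≈ (density-shift dens k) 1≤k) (ιn/[q+n]≈1 k))
        (≈-trans (≈-pointwise (λ n → *-identityʳ _)) (parts-≈ k))))
      where
      parts-bounded : Bounded (parts (density-shift dens k) 1≤k)
      parts-bounded = ∑ℚ-bounded (connectedEdges k) _ (part-bounded (density-shift dens k) 1≤k)
      regroup : ∀ F r C i ν → F * (r * C) * (i * ν) ≡ F * (ν * C) * (i * r)
      regroup = solve-∀ ℚ-ring

    pairs-≈ : (λ t → ι (pairMoment dens 1≤k t (m t)) * (recip t * recip t * recip (count t))) ≈ (λ t → limit c k t * limit c k t)
    pairs-≈ = ≈-unshift q (≈-trans
      (≈-eventually (1 , λ {n} 1≤n → trans (trans (sym (*-identityʳ _)) (sym (*-identityʳ _))) (trans
        (cong (λ z → F n * (recip (q ℕ.+ n) * recip (q ℕ.+ n) * recip (count (q ℕ.+ n))) * z * z) (sym (ι*recip 1≤n)))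
        (regroup (F n) (recip (q ℕ.+ n)) (recip (count (q ℕ.+ n))) (ι n) (recip n)))))
      (≈-trans (≈-* (≈-bounded P≈ (bounded-* parts-bounded parts-bounded)) (bounded-* (const-bounded 1ℚ) (const-bounded 1ℚ))
          P≈ (≈-* (≈-bounded (ιn/[q+n]≈1 q) (const-bounded 1ℚ)) (const-bounded 1ℚ) (ιn/[q+n]≈1 q) (ιn/[q+n]≈1 q)))
        (≈-trans (≈-pointwise (λ n → *-identityʳ _))
          (≈-* parts-bounded (≈-bounded (≈-sym (parts-≈ q)) parts-bounded) (parts-≈ q) (parts-≈ q)))))
      where
      q = k ℕ.+ k
      F : ℕ → ℚ
      F n = ι (pairMoment dens 1≤k (q ℕ.+ n) (m (q ℕ.+ n)))
      P≈ = pairMoment-≈ (density-shift dens q) 1≤k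
      parts-bounded : Bounded (parts (density-shift dens q) 1≤k)
      parts-bounded = ∑ℚ-bounded (connectedEdges k) _ (part-bounded (density-shift dens q) 1≤k)
      regroup : ∀ F r C i ν → F * (r * r * C) * (i * ν) * (i * ν) ≡ F * (ν * ν * C) * (i * r * (i * r))
      regroup = solve-∀ ℚ-ring

    -- Variance of the component count per vertex

    deviation : ∀ t → Graph t → ℚ
    deviation t G = ι (componentsOfOrder k G) * recip t - limit c k t

    secondMoment-bound : ∀ t → ∑ (𝔾 t (m t)) (λ G → componentsOfOrder k G ℕ.* componentsOfOrder k G) ℕ.≤
                         firstMoment k t 0 (m t) ℕ.+ pairMoment dens 1≤k t (m t)
    secondMoment-bound t = ℕₚ.≤-trans
      (ℕₚ.≤-reflexive (∑-filter (λ G → edges G ℕₚ.≟ m t) (graphs t) _))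
      (ℕₚ.≤-trans (secondMoment-≤ t (m t) 1≤k) (ℕₚ.≤-reflexive (trans
        (cong (choose t k ℕ.*_) (∑-+ (connectedEdges k) _ _))
        (trans (ℕₚ.*-distribˡ-+ (choose t k) _ _) (cong (ℕ._+ pairMoment dens 1≤k t (m t)) (sym (firstMoment≡ t 0 (m t) 1≤k)))))))

    ∑-deviation² : ∀ {t} (Ω : List (Graph t)) → ∑ℚ Ω (λ G → deviation t G * deviation t G) ≡
      ι (∑ Ω (λ G → componentsOfOrder k G ℕ.* componentsOfOrder k G)) * (recip t * recip t)
      - (limit c k t + limit c k t) * (ι (∑ Ω (componentsOfOrder k)) * recip t) + limit c k t * limit c k t * ι (length Ω)
    ∑-deviation² {t} [] = sym (trans (cong₂ (λ x y → x * (r * r) - (l + l) * (y * r) + l * l * x) ι-0 ι-0) (ring r l))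
      where
      r = recip t
      l = limit c k t
      ring : ∀ r l → 0ℚ * (r * r) - (l + l) * (0ℚ * r) + l * l * 0ℚ ≡ 0ℚ
      ring = solve-∀ ℚ-ring
    ∑-deviation² {t} (G ∷ Ω) = trans (cong (_+_ (deviation t G * deviation t G)) (∑-deviation² Ω))
      (trans (ring (ι X) r l (ι S₂) (ι S₁) (ι (length Ω)))
        (cong₂ (λ p q → p * (r * r) - (l + l) * (proj₁ q * r) + l * l * proj₂ q)
          (sym (trans (ι-+ (X ℕ.* X) S₂) (cong (_+ ι S₂) (ι-* X X))))
          (cong₂ _,_ (sym (ι-+ X S₁)) (sym (ι-suc (length Ω))))))
      where
      X = componentsOfOrder k G
      S₁ = ∑ Ω (componentsOfOrder k)
      S₂ = ∑ Ω (λ G → componentsOfOrder k G ℕ.* componentsOfOrder k G)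
      r = recip t
      l = limit c k t
      ring : ∀ x r l s₂ s₁ n → (x * r - l) * (x * r - l) + (s₂ * (r * r) - (l + l) * (s₁ * r) + l * l * n) ≡
             (x * x + s₂) * (r * r) - (l + l) * ((x + s₁) * r) + l * l * (1ℚ + n)
      ring = solve-∀ ℚ-ring

    count>0 : Eventually (λ t → 1 ℕ.≤ count t)
    count>0 = ev-map choose>0 (M≤tri dens)

    -- W bounds the mean squared deviation from l, the value of `limit`. Its term `recip t * mean t`
    -- stems from the diagonal and vanishes, and the others approach l² - 2l² + l² = 0.
    variance-small : ∀ {η} → 0ℚ < η →
      Eventually (λ t → ∑ℚ (𝔾 t (m t)) (λ G → deviation t G * deviation t G) ≤ η * ι (length (𝔾 t (m t))))
    variance-small {η} 0<η = ev-zip (λ {t} w 1≤C → bound t w 1≤C) (close W≈0 0<η) count>0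
      where
      open ≤-Reasoning
      lb = limit-bounded c-bounded k
      mean : ℕ → ℚ
      mean t = ι (firstMoment k t 0 (m t)) * (recip t * recip (count t))
      pairs : ℕ → ℚ
      pairs t = ι (pairMoment dens 1≤k t (m t)) * (recip t * recip t * recip (count t))
      W : ℕ → ℚ
      W t = recip t * mean t + pairs t - (limit c k t + limit c k t) * mean t + limit c k t * limit c k t
      W≈0 : W ≈ (λ _ → 0ℚ)
      W≈0 = ≈-trans (≈-+ (≈-+ (≈-+ (≈-* bounded-recip lb recip≈0 mean-≈) pairs-≈)
          (≈-neg (≈-* (bounded-+ lb lb) lb (≈-refl {λ t → limit c k t + limit c k t}) mean-≈)))
          (≈-refl {λ t → limit c k t * limit c k t}))
        (≈-pointwise (λ t → ring (limit c k t)))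
        where
        ring : ∀ l → 0ℚ * l + l * l + - ((l + l) * l) + l * l ≡ 0ℚ
        ring = solve-∀ ℚ-ring
      bound : ∀ t → ∣ W t - 0ℚ ∣ ≤ η → 1 ℕ.≤ count t →
              ∑ℚ (𝔾 t (m t)) (λ G → deviation t G * deviation t G) ≤ η * ι (length (𝔾 t (m t)))
      bound t w 1≤C = begin
        ∑ℚ (𝔾 t (m t)) (λ G → deviation t G * deviation t G)
          ≡⟨ ∑-deviation² (𝔾 t (m t)) ⟩
        ι S₂ * (r * r) - (l + l) * (ι S₁ * r) + l * l * ι (length (𝔾 t (m t)))
          ≤⟨ +-monoˡ-≤ (l * l * ι (length (𝔾 t (m t)))) (+-monoˡ-≤ (- ((l + l) * (ι S₁ * r)))
               (*-monoʳ (*-nonNeg r r (recip≥0 t) (recip≥0 t)) (ι-mono (secondMoment-bound t)))) ⟩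
        ι (F ℕ.+ P) * (r * r) - (l + l) * (ι S₁ * r) + l * l * ι (length (𝔾 t (m t)))
          ≡⟨ cong₂ (λ x y → x * (r * r) - (l + l) * (ι y * r) + l * l * ι (length (𝔾 t (m t)))) (ι-+ F P)
               (∑-filter (λ G → edges G ℕₚ.≟ m t) (graphs t) (componentsOfOrder k)) ⟩
        (ι F + ι P) * (r * r) - (l + l) * (ι F * r) + l * l * ι (length (𝔾 t (m t)))
          ≡⟨ cong (λ z → (ι F + ι P) * (r * r) - (l + l) * (ι F * r) + l * l * ι z) (length-𝔾 t (m t)) ⟩
        (ι F + ι P) * (r * r) - (l + l) * (ι F * r) + l * l * ι C
          ≡⟨ expand ⟩
        W t * ι C
          ≤⟨ *-monoʳ (ι≥0 C) (≤-trans (p≤∣p∣ (W t)) (≤-trans (≤-reflexive (cong ∣_∣ (sym (+-identityʳ (W t))))) w)) ⟩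
        η * ι C
          ≡⟨ cong (λ z → η * ι z) (sym (length-𝔾 t (m t))) ⟩
        η * ι (length (𝔾 t (m t))) ∎
        where
        r = recip t
        l = limit c k t
        C = count t
        F = firstMoment k t 0 (m t)
        P = pairMoment dens 1≤k t (m t)
        S₁ = ∑ (𝔾 t (m t)) (componentsOfOrder k)
        S₂ = ∑ (𝔾 t (m t)) (λ G → componentsOfOrder k G ℕ.* componentsOfOrder k G)
        expand : (ι F + ι P) * (r * r) - (l + l) * (ι F * r) + l * l * ι C ≡ W t * ι C
        expand = trans (cong₂ (λ x y → x - y + l * l * ι C) (insert ((ι F + ι P) * (r * r))) (insert ((l + l) * (ι F * r))))
          (ring (ι F) (ι P) r l (ι C) (recip C))
          where
          insert : ∀ p → p ≡ p * (ι C * recip C)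
          insert p = trans (sym (*-identityʳ p)) (cong (p *_) (sym (ι*recip 1≤C)))
          ring : ∀ F P r l C R → (F + P) * (r * r) * (C * R) - (l + l) * (F * r) * (C * R) + l * l * C ≡
                 (r * (F * (r * R)) + P * (r * r * R) - (l + l) * (F * (r * R)) + l * l) * C
          ring = solve-∀ ℚ-ring

  -- From the moments to concentration

  -- The floor condition concerns the limit of `seq c`, so it is read at an index i beyond its own
  -- witnesses for n: there m n is within 1 of n times `seq c i`. The index i depends on n, and the
  -- Cauchy property leads back to `seq c n`.
  floor-density : ∀ (c : ℝ) (m : ℕ → ℕ) → (∀ n → IsFloor (c *ℝ fromℕ n) (m n)) →
                  (λ n → ι (m n) * recip n) ≈ seq c
  floor-density c m floor = mk≈ λ {δ} 0<δ →
    let N , cc = cauchy c (half-pos 0<δ) in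
    ev-zip (λ {n} (N≤n , 1≤n) p → near cc N≤n 1≤n (≤-trans (≤-reflexive (cong ∣_∣ (sym (+-identityʳ (recip n))))) p))
      (ev-zip _,_ (ev-≥ N) (ev-≥ 1)) (close recip≈0 (half-pos 0<δ))
    where
    open ≤-Reasoning
    near : ∀ {N δ} → (∀ {i j} → N ℕ.≤ i → N ℕ.≤ j → ∣ seq c i - seq c j ∣ ≤ ½ * δ) →
           ∀ {n} → N ℕ.≤ n → 1 ℕ.≤ n → ∣ recip n ∣ ≤ ½ * δ → ∣ ι (m n) * recip n - seq c n ∣ ≤ δ
    near {N} {δ} cc {n} N≤n 1≤n p = begin
      ∣ ι (m n) * ν - seq c n ∣                         ≤⟨ ∣-∣-triangle (ι (m n) * ν) (seq c i) (seq c n) ⟩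
      ∣ ι (m n) * ν - seq c i ∣ + ∣ seq c i - seq c n ∣ ≤⟨ +-mono-≤ (∣p∣≤-intro upper lower) (cc N≤i N≤n) ⟩
      ½ * δ + ½ * δ                                     ≡⟨ half+half δ ⟩
      δ                                                 ∎
      where
      ν = recip n
      A = proj₁ (floor n) (positive⁻¹ 1ℚ)
      B = proj₂ (floor n)
      i = N ℕ.⊔ (proj₁ A ℕ.⊔ proj₁ (proj₂ (proj₂ B)))
      N≤i = ℕₚ.m≤m⊔n N (proj₁ A ℕ.⊔ proj₁ (proj₂ (proj₂ B)))
      below : ι (m n) ≤ seq c i * ι n + 1ℚ
      below = subst₂ (λ x y → x ≤ seq c i * y + 1ℚ) (sym (ι≡ (m n))) (sym (ι≡ n))
        (proj₂ A (ℕₚ.≤-trans (ℕₚ.m≤m⊔n (proj₁ A) _) (ℕₚ.m≤n⊔m N _)))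
      above : seq c i * ι n ≤ ι (m n) + 1ℚ
      above = begin
        seq c i * ι n               ≡⟨ sym (+-identityʳ _) ⟩
        seq c i * ι n + 0ℚ          ≤⟨ +-monoʳ-≤ (seq c i * ι n) (<⇒≤ (proj₁ (proj₂ B))) ⟩
        seq c i * ι n + proj₁ B     ≤⟨ subst₂ (λ x y → seq c i * x + proj₁ B ≤ y) (sym (ι≡ n)) (sym (ι≡ (suc (m n))))
                                         (proj₂ (proj₂ (proj₂ B)) (ℕₚ.≤-trans (ℕₚ.m≤n⊔m (proj₁ A) _) (ℕₚ.m≤n⊔m N _))) ⟩
        ι (suc (m n))               ≡⟨ trans (ι-suc (m n)) (+-comm 1ℚ (ι (m n))) ⟩
        ι (m n) + 1ℚ                ∎
      simplify : ∀ c i r → (c * i + 1ℚ) * r - c * (i * r) ≡ r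
      simplify = solve-∀ ℚ-ring
      simplify′ : ∀ M r → (M + 1ℚ) * r - M * r ≡ r
      simplify′ = solve-∀ ℚ-ring
      c≡ : seq c i ≡ seq c i * (ι n * ν)
      c≡ = trans (sym (*-identityʳ (seq c i))) (cong (seq c i *_) (sym (ι*recip 1≤n)))
      ν≤ : ν ≤ ½ * δ
      ν≤ = ≤-trans (p≤∣p∣ ν) p
      upper : ι (m n) * ν - seq c i ≤ ½ * δ
      upper = begin
        ι (m n) * ν - seq c i                             ≡⟨ cong (λ z → ι (m n) * ν - z) c≡ ⟩
        ι (m n) * ν - seq c i * (ι n * ν)                 ≤⟨ +-monoˡ-≤ (- (seq c i * (ι n * ν))) (*-monoʳ (recip≥0 n) below) ⟩
        (seq c i * ι n + 1ℚ) * ν - seq c i * (ι n * ν)    ≡⟨ simplify (seq c i) (ι n) ν ⟩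
        ν                                                 ≤⟨ ν≤ ⟩
        ½ * δ                                             ∎
      lower : - (ι (m n) * ν - seq c i) ≤ ½ * δ
      lower = begin
        - (ι (m n) * ν - seq c i)                         ≡⟨ neg-diff (ι (m n) * ν) (seq c i) ⟩
        seq c i - ι (m n) * ν                             ≡⟨ cong (λ z → z - ι (m n) * ν) (trans c≡ (sym (*-assoc (seq c i) (ι n) ν))) ⟩
        seq c i * ι n * ν - ι (m n) * ν                   ≤⟨ +-monoˡ-≤ (- (ι (m n) * ν)) (*-monoʳ (recip≥0 n) above) ⟩
        (ι (m n) + 1ℚ) * ν - ι (m n) * ν                  ≡⟨ simplify′ (ι (m n)) ν ⟩
        ν                                                 ≤⟨ ν≤ ⟩
        ½ * δ                                             ∎

  floor⇒Density : ∀ (c : ℝ) → fromℕ 0 <ℝ c → (m : ℕ → ℕ) → (∀ n → IsFloor (c *ℝ fromℕ n) (m n)) → Density m (seq c)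
  floor⇒Density c (c₀ , c₀>0 , c₀≤) m floor = record
    { density   = floor-density c m floor
    ; c-bounded = cauchy-bounded (cauchy c)
    ; c₀        = c₀
    ; c₀>0      = c₀>0
    ; c₀≤c      = ev-map (λ {n} → subst (_≤ seq c n) (trans (cong (_+ c₀) (sym (ι≡ 0))) (trans (cong (_+ c₀) ι-0) (+-identityˡ c₀)))) c₀≤ }

  limitℝ : ℝ → ℕ → ℝ
  limitℝ c k = fromℚ (_/_ (+ (k ℕ.^ (k ℕ.∸ 2))) (k !) {{ℕₚ._!≢0 k}})
    *ℝ (fromℕ 2 *ℝ c) ^ℝ (k ℕ.∸ 1) *ℝ exp (-ℝ (fromℕ (2 ℕ.* k) *ℝ c))

  /*ι : ∀ a d .{{_ : ℕ.NonZero d}} → (+ a / d) * ι d ≡ ι a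
  /*ι a (suc d) = toℚᵘ-injective (ℚᵘₚ.≃-trans (toℚᵘ-homo-* (+ a / suc d) (ι (suc d)))
    (ℚᵘₚ.≃-trans (ℚᵘₚ.*-cong (toℚᵘ-fromℚᵘ (ℚᵘ.mkℚᵘ (+ a) d)) (toℚᵘ-ι (suc d)))
    (ℚᵘₚ.≃-trans (ℚᵘ.*≡* (trans (ℤₚ.*-identityʳ _) (cong (λ z → + a ℤ.* + suc z) (sym (ℕₚ.*-identityʳ d)))))
      (ℚᵘₚ.≃-sym (toℚᵘ-ι a)))))

  invFactorial-! : ∀ k → ι (k !) * invFactorial k ≡ 1ℚ
  invFactorial-! zero    = trans (cong (_* 1ℚ) ι-1) (*-identityˡ 1ℚ)
  invFactorial-! (suc k) = begin
    ι (suc k ℕ.* k !) * (f * r)     ≡⟨ cong (_* (f * r)) (ι-* (suc k) (k !)) ⟩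
    ι (suc k) * ι (k !) * (f * r)   ≡⟨ regroup (ι (suc k)) (ι (k !)) f r ⟩
    ι (k !) * f * (ι (suc k) * r)   ≡⟨ cong₂ _*_ (invFactorial-! k) (ι*recip {suc k} (s≤s z≤n)) ⟩
    1ℚ * 1ℚ                         ≡⟨ *-identityˡ 1ℚ ⟩
    1ℚ                              ∎
    where
    open ≡-Reasoning
    f = invFactorial k
    r = + 1 / suc k
    regroup : ∀ s i f r → s * i * (f * r) ≡ i * f * (s * r)
    regroup = solve-∀ ℚ-ring

  seq-^ℝ : ∀ x k i → seq (x ^ℝ k) i ≡ pow (seq x i) k
  seq-^ℝ x zero    i = refl
  seq-^ℝ x (suc k) i = cong (seq x i *_) (seq-^ℝ x k i)

  seq-limitℝ : ∀ c k i → seq (limitℝ c k) i ≡ limit (seq c) k i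
  seq-limitℝ c k i = begin
    q * seq ((fromℕ 2 *ℝ c) ^ℝ (k ℕ.∸ 1)) i * expSum (- ((+ (2 ℕ.* k) / 1) * seq c i)) i
      ≡⟨ cong₂ (λ x y → q * x * expSum (- (y * seq c i)) i)
           (trans (seq-^ℝ (fromℕ 2 *ℝ c) (k ℕ.∸ 1) i) (cong (λ z → pow (z * seq c i) (k ℕ.∸ 1)) (sym (ι≡ 2))))
           (sym (ι≡ (2 ℕ.* k))) ⟩
    q * p * e
      ≡⟨ cong (λ z → z * p * e) q≡ ⟩
    ι (k ℕ.^ (k ℕ.∸ 2)) * invFactorial k * p * e
      ≡⟨ *-assoc (ι (k ℕ.^ (k ℕ.∸ 2)) * invFactorial k) p e ⟩
    limit (seq c) k i ∎
    where
    open ≡-Reasoning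
    q = _/_ (+ (k ℕ.^ (k ℕ.∸ 2))) (k !) {{ℕₚ._!≢0 k}}
    p = pow (ι 2 * seq c i) (k ℕ.∸ 1)
    e = expSum (exponent (seq c) k i) i
    q≡ : q ≡ ι (k ℕ.^ (k ℕ.∸ 2)) * invFactorial k
    q≡ = trans (sym (*-identityʳ q)) (trans (cong (q *_) (sym (invFactorial-! k)))
      (trans (sym (*-assoc q (ι (k !)) (invFactorial k))) (cong (_* invFactorial k) (/*ι (k ℕ.^ (k ℕ.∸ 2)) (k !) {{ℕₚ._!≢0 k}}))))

  -- These are the approximations of a real built from the arithmetic of `ℝ`, which already carries
  -- the modulus.
  limit-cauchy : ∀ c k → Cauchy (limit (seq c) k)
  limit-cauchy c k 0<δ = let N , h = cauchy (limitℝ c k) 0<δ in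
    N , λ {i} {j} hi hj → subst₂ (λ x y → ∣ x - y ∣ ≤ _) (seq-limitℝ c k i) (seq-limitℝ c k j) (h hi hj)

  pow-≥ : ∀ {a x} → 0ℚ ≤ a → a ≤ x → ∀ n → pow a n ≤ pow x n
  pow-≥ 0≤a a≤x zero    = ≤-refl
  pow-≥ 0≤a a≤x (suc n) = mul-mono 0≤a (pow≥0 (≤-trans 0≤a a≤x) n) a≤x (pow-≥ 0≤a a≤x n)

  pow>0 : ∀ {a} → 0ℚ < a → ∀ n → 0ℚ < pow a n
  pow>0 0<a zero    = positive⁻¹ 1ℚ
  pow>0 0<a (suc n) = *-pos 0<a (pow>0 0<a n)

  invFactorial>0 : ∀ k → 0ℚ < invFactorial k
  invFactorial>0 zero    = positive⁻¹ 1ℚ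
  invFactorial>0 (suc k) = *-pos (invFactorial>0 k) (1/suc>0 k)

  -- A lower bound independent of t is what converts an absolute error into a relative one; it comes
  -- from `c₀` and `exp-positive`.
  limit-positive : ∀ {m c} → Density m c → ∀ {k} → 1 ℕ.≤ k → ∃[ l ] 0ℚ < l × Eventually (λ t → l ≤ limit c k t)
  limit-positive {m} {c} dens {suc k} _ =
    a * (pow (ι 2 * c₀) k * e) , *-pos 0<a (*-pos (pow>0 0<2c₀ k) 0<e) ,
    ev-zip (λ {t} c₀≤c e≤ → *-monoˡ (<⇒≤ 0<a) (mul-mono (<⇒≤ (pow>0 0<2c₀ k)) (≤-trans (<⇒≤ 0<e) e≤)
      (pow-≥ (<⇒≤ 0<2c₀) (*-monoˡ (ι≥0 2) c₀≤c) k) e≤)) c₀≤c (proj₂ (proj₂ E))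
    where
    open Density dens
    a = ι (suc k ℕ.^ (suc k ℕ.∸ 2)) * invFactorial (suc k)
    E = exp-positive (exponent-bounded dens (suc k))
    e = proj₁ E
    0<e : 0ℚ < e
    0<e = proj₁ (proj₂ E)
    0<2c₀ : 0ℚ < ι 2 * c₀
    0<2c₀ = *-pos (ι>0 (s≤s z≤n)) c₀>0
    0<a : 0ℚ < a
    0<a = *-pos (ι>0 (ℕₚ.m^n>0 (suc k) (suc k ℕ.∸ 2))) (invFactorial>0 (suc k))

  -- All orders up to κ at once

  AllOrders : ℕ → (ℕ → Set) → Set
  AllOrders κ P = ∀ k → 1 ℕ.≤ k → k ℕ.≤ κ → P k

  allOrders-suc : ∀ {κ P} → AllOrders κ P → P (suc κ) → AllOrders (suc κ) P
  allOrders-suc {κ} {P} h p k 1≤k k≤ with ℕₚ.m≤n⇒m<n∨m≡n k≤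
  ... | inj₁ k<suc = h k 1≤k (ℕₚ.≤-pred k<suc)
  ... | inj₂ refl  = p

  ev-allOrders : ∀ κ {P : ℕ → ℕ → Set} → (∀ k → 1 ℕ.≤ k → Eventually (P k)) → Eventually (λ t → AllOrders κ (λ k → P k t))
  ev-allOrders zero    h = always (λ t k 1≤k k≤0 → ⊥-elim (ℕₚ.<⇒≱ 1≤k k≤0))
  ev-allOrders (suc κ) h = ev-zip (λ {t} → allOrders-suc) (ev-allOrders κ h) (h (suc κ) (s≤s z≤n))

  limits-positive : ∀ {m c} → Density m c → ∀ κ → ∃[ l ] 0ℚ < l × Eventually (λ t → AllOrders κ (λ k → l ≤ limit c k t))
  limits-positive dens zero = 1ℚ , positive⁻¹ 1ℚ , always (λ t k 1≤k k≤0 → ⊥-elim (ℕₚ.<⇒≱ 1≤k k≤0))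
  limits-positive {c = c} dens (suc κ) = combine (limits-positive dens κ) (limit-positive dens {suc κ} (s≤s z≤n))
    where
    Positive : (ℚ → ℕ → Set) → Set
    Positive P = ∃[ l ] 0ℚ < l × Eventually (P l)
    combine : Positive (λ l t → AllOrders κ (λ k → l ≤ limit c k t)) → Positive (λ l t → l ≤ limit c (suc κ) t) →
              Positive (λ l t → AllOrders (suc κ) (λ k → l ≤ limit c k t))
    combine (l , 0<l , h) (l′ , 0<l′ , h′) = choice (≤-total l l′)
      where
      choice : l ≤ l′ ⊎ l′ ≤ l → Positive (λ l t → AllOrders (suc κ) (λ k → l ≤ limit c k t))
      choice (inj₁ l≤l′) = l , 0<l , ev-zip (λ p q → allOrders-suc p (≤-trans l≤l′ q)) h h′
      choice (inj₂ l′≤l) = l′ , 0<l′ , ev-zip (λ p q → allOrders-suc (λ k a b → ≤-trans l′≤l (p k a b)) q) h h′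

  square-≤⇒∣∣≤ : ∀ {p q} → 0ℚ < q → p * p ≤ q * q → ∣ p ∣ ≤ q
  square-≤⇒∣∣≤ {p} {q} 0<q h with ≤-total ∣ p ∣ q
  ... | inj₁ le = le
  ... | inj₂ q≤∣p∣ = *-cancelʳ-≤ 0<q (begin
    ∣ p ∣ * q     ≤⟨ *-monoˡ (0≤∣p∣ p) q≤∣p∣ ⟩
    ∣ p ∣ * ∣ p ∣ ≡⟨ trans (sym (∣p*q∣≡∣p∣*∣q∣ p p)) (0≤p⇒∣p∣≡p (square≥0 p)) ⟩
    p * p         ≤⟨ h ⟩
    q * q         ∎)
    where open ≤-Reasoning

  -- Every outcome outside P adds at least θ to the sum of g, which `bad` records along the list.
  -- The good outcomes are counted directly because the probability statement asks for a sublist of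
  -- them.
  markov : ∀ {A : Set} {P : A → Set} (P? : ∀ x → Dec (P x)) (Ω : List A) (g : A → ℚ) {θ δ} →
           (∀ x → 0ℚ ≤ g x) → (∀ x → ¬ P x → θ ≤ g x) → 0ℚ < θ →
           ∑ℚ Ω g ≤ δ * θ * ι (length Ω) → (1ℚ - δ) * ι (length Ω) ≤ ι (length (filter P? Ω))
  markov P? Ω g {θ} {δ} g≥0 g≥θ 0<θ h = *-cancelʳ-≤ 0<θ (begin
    (1ℚ - δ) * ι (length Ω) * θ                   ≡⟨ expand δ (ι (length Ω)) θ ⟩
    ι (length Ω) * θ - δ * θ * ι (length Ω)       ≤⟨ +-monoʳ-≤ (ι (length Ω) * θ) (neg-antimono-≤ h) ⟩
    ι (length Ω) * θ - ∑ℚ Ω g                     ≤⟨ +-monoˡ-≤ (- ∑ℚ Ω g) (bad Ω) ⟩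
    b Ω * θ + ∑ℚ Ω g - ∑ℚ Ω g                     ≡⟨ cancel (b Ω * θ) (∑ℚ Ω g) ⟩
    b Ω * θ                                       ∎)
    where
    open ≤-Reasoning
    b : List _ → ℚ
    b Ω = ι (length (filter P? Ω))
    expand : ∀ δ n θ → (1ℚ - δ) * n * θ ≡ n * θ - δ * θ * n
    expand = solve-∀ ℚ-ring
    cancel : ∀ p q → p + q - q ≡ p
    cancel = solve-∀ ℚ-ring
    step : ∀ n θ → (1ℚ + n) * θ ≡ θ + n * θ
    step = solve-∀ ℚ-ring
    bad : ∀ Ω → ι (length Ω) * θ ≤ b Ω * θ + ∑ℚ Ω g
    bad [] = ≤-reflexive (sym (+-identityʳ (ι 0 * θ)))
    bad (x ∷ Ω) with P? x
    ... | yes _ = begin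
      ι (suc (length Ω)) * θ        ≡⟨ trans (cong (_* θ) (ι-suc (length Ω))) (step (ι (length Ω)) θ) ⟩
      θ + ι (length Ω) * θ          ≤⟨ +-mono-≤ (≤-trans (≤-reflexive (sym (+-identityʳ θ))) (+-monoʳ-≤ θ (g≥0 x))) (bad Ω) ⟩
      θ + g x + (b Ω * θ + ∑ℚ Ω g)  ≡⟨ rearrange θ (g x) (b Ω) (∑ℚ Ω g) ⟩
      (1ℚ + b Ω) * θ + (g x + ∑ℚ Ω g) ≡⟨ cong (λ z → z * θ + (g x + ∑ℚ Ω g)) (sym (ι-suc _)) ⟩
      ι (suc (length (filter P? Ω))) * θ + (g x + ∑ℚ Ω g) ∎
      where
      rearrange : ∀ θ g b s → θ + g + (b * θ + s) ≡ (1ℚ + b) * θ + (g + s)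
      rearrange = solve-∀ ℚ-ring
    ... | no ¬p = begin
      ι (suc (length Ω)) * θ        ≡⟨ trans (cong (_* θ) (ι-suc (length Ω))) (step (ι (length Ω)) θ) ⟩
      θ + ι (length Ω) * θ          ≤⟨ +-mono-≤ (g≥θ x ¬p) (bad Ω) ⟩
      g x + (b Ω * θ + ∑ℚ Ω g)      ≡⟨ rearrange (g x) (b Ω * θ) (∑ℚ Ω g) ⟩
      b Ω * θ + (g x + ∑ℚ Ω g)      ∎
      where
      rearrange : ∀ g b s → g + (b + s) ≡ b + (g + s)
      rearrange = solve-∀ ℚ-ring

  ∑ℚ-+ : ∀ {A : Set} (xs : List A) (f g : A → ℚ) → ∑ℚ xs (λ x → f x + g x) ≡ ∑ℚ xs f + ∑ℚ xs g
  ∑ℚ-+ []       f g = sym (+-identityʳ 0ℚ)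
  ∑ℚ-+ (x ∷ xs) f g = trans (cong (_+_ (f x + g x)) (∑ℚ-+ xs f g)) (rearrange (f x) (g x) (∑ℚ xs f) (∑ℚ xs g))
    where
    rearrange : ∀ a b c d → a + b + (c + d) ≡ a + c + (b + d)
    rearrange = solve-∀ ℚ-ring

  module _ {m : ℕ → ℕ} {c : ℕ → ℚ} (dens : Density m c) where

    -- A single rational bounds the deviations of all orders, so one sublist serves for every k. A
    -- comparison of rationals can be decided and filtered by, unlike the inequalities between reals
    -- that make up the event.
    deviations² : ℕ → ∀ t → Graph t → ℚ
    deviations² zero    t G = 0ℚ
    deviations² (suc κ) t G = deviations² κ t G + deviation dens {suc κ} (s≤s z≤n) t G * deviation dens {suc κ} (s≤s z≤n) t G

    deviations²≥0 : ∀ κ t G → 0ℚ ≤ deviations² κ t G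
    deviations²≥0 zero    t G = ≤-refl
    deviations²≥0 (suc κ) t G = +-mono-≤ (deviations²≥0 κ t G) (square≥0 (deviation dens {suc κ} (s≤s z≤n) t G))

    deviation²≤ : ∀ κ t G → AllOrders κ (λ k → (ι (componentsOfOrder k G) * recip t - limit c k t) *
                                               (ι (componentsOfOrder k G) * recip t - limit c k t) ≤ deviations² κ t G)
    deviation²≤ zero    t G k 1≤k k≤0 = ⊥-elim (ℕₚ.<⇒≱ 1≤k k≤0)
    deviation²≤ (suc κ) t G = allOrders-suc
      (λ k 1≤k k≤κ → ≤-trans (deviation²≤ κ t G k 1≤k k≤κ)
        (≤-trans (≤-reflexive (sym (+-identityʳ (deviations² κ t G)))) (+-monoʳ-≤ (deviations² κ t G) (square≥0 d))))
      (≤-trans (≤-reflexive (sym (+-identityˡ (d * d)))) (+-monoˡ-≤ (d * d) (deviations²≥0 κ t G)))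
      where
      d = deviation dens {suc κ} (s≤s z≤n) t G

    variances-small : ∀ κ {η} → 0ℚ < η →
      Eventually (λ t → ∑ℚ (𝔾 t (m t)) (deviations² κ t) ≤ η * ι (length (𝔾 t (m t))))
    variances-small zero {η} 0<η = always (λ t → ≤-trans (≤-reflexive (zeros (𝔾 t (m t))))
      (*-nonNeg η _ (<⇒≤ 0<η) (ι≥0 _)))
      where
      zeros : ∀ {A : Set} (xs : List A) → ∑ℚ xs (λ _ → 0ℚ) ≡ 0ℚ
      zeros []       = refl
      zeros (x ∷ xs) = trans (+-identityˡ _) (zeros xs)
    variances-small (suc κ) {η} 0<η = ev-zip (λ {t} → step t)
      (variances-small κ (half-pos 0<η)) (variance-small dens {suc κ} (s≤s z≤n) (half-pos 0<η))
      where
      open ≤-Reasoning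
      d² : ∀ t → Graph t → ℚ
      d² t G = deviation dens {suc κ} (s≤s z≤n) t G * deviation dens {suc κ} (s≤s z≤n) t G
      step : ∀ t → let Ω = 𝔾 t (m t) ; N = ι (length Ω) in
             ∑ℚ Ω (deviations² κ t) ≤ ½ * η * N → ∑ℚ Ω (d² t) ≤ ½ * η * N → ∑ℚ Ω (deviations² (suc κ) t) ≤ η * N
      step t p q = begin
        ∑ℚ Ω (deviations² (suc κ) t)              ≡⟨ ∑ℚ-+ Ω (deviations² κ t) (d² t) ⟩
        ∑ℚ Ω (deviations² κ t) + ∑ℚ Ω (d² t)      ≤⟨ +-mono-≤ p q ⟩
        ½ * η * N + ½ * η * N                     ≡⟨ sym (*-distribʳ-+ N (½ * η) (½ * η)) ⟩
        (½ * η + ½ * η) * N                       ≡⟨ cong (_* N) (half+half η) ⟩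
        η * N                                     ∎
        where
        Ω = 𝔾 t (m t)
        N = ι (length Ω)

  diagonal : {Q : ℕ → ℕ → Set} → (∀ j → Eventually (Q j)) →
             ∃[ f ] (∀ J → Eventually (λ t → J ℕ.≤ f t)) × Eventually (λ t → Q (f t) t)
  diagonal {Q} h = (λ t → largest t t) ,
      (λ J → J ℕ.⊔ N J , λ {t} le → largest-≥ t t (ℕₚ.m⊔n≤o⇒m≤o J (N J) le) (ℕₚ.m⊔n≤o⇒n≤o J (N J) le)) ,
      (N 0 , λ {t} N₀≤t → proj₂ (h (largest t t)) (largest-ok t t N₀≤t))
    where
    N : ℕ → ℕ
    N j = proj₁ (h j)
    largest : ℕ → ℕ → ℕ
    largest t zero    = 0
    largest t (suc s) with N (suc s) ℕₚ.≤? t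
    ... | yes _ = suc s
    ... | no _  = largest t s
    largest-ok : ∀ t s → N 0 ℕ.≤ t → N (largest t s) ℕ.≤ t
    largest-ok t zero    N₀≤t = N₀≤t
    largest-ok t (suc s) N₀≤t with N (suc s) ℕₚ.≤? t
    ... | yes p = p
    ... | no _  = largest-ok t s N₀≤t
    largest-≥ : ∀ t s {J} → J ℕ.≤ s → N J ℕ.≤ t → J ℕ.≤ largest t s
    largest-≥ t zero    J≤s p = J≤s
    largest-≥ t (suc s) J≤s p with N (suc s) ℕₚ.≤? t
    ... | yes _ = J≤s
    ... | no ¬q with ℕₚ.m≤n⇒m<n∨m≡n J≤s
    ...   | inj₁ J<suc = largest-≥ t s (ℕₚ.≤-pred J<suc) p
    ...   | inj₂ refl  = ⊥-elim (¬q p)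

  -- From absolute to relative error

  eventually-≤⇒≤ℝ : ∀ {x y} → Eventually (λ i → seq x i ≤ seq y i) → x ≤ℝ y
  eventually-≤⇒≤ℝ {x} {y} h 0<δ = ev-map (λ {i} p → ≤-trans p
    (≤-trans (≤-reflexive (sym (+-identityʳ (seq y i)))) (+-monoʳ-≤ (seq y i) (<⇒≤ 0<δ)))) h

  fromℚ-mono : ∀ {p q} → p ≤ q → fromℚ p ≤ℝ fromℚ q
  fromℚ-mono {p} {q} p≤q = eventually-≤⇒≤ℝ {fromℚ p} {fromℚ q} (always (λ _ → p≤q))

  module _ {x λₜ λᵢ e l θ : ℚ} {t : ℕ} (1≤t : 1 ℕ.≤ t) (0≤e : 0ℚ ≤ e) (2θ≡el : θ + θ ≡ e * l)
           (x≈λₜ : ∣ x * recip t - λₜ ∣ ≤ θ) (λᵢ≈λₜ : ∣ λᵢ - λₜ ∣ ≤ θ) (l≤λᵢ : l ≤ λᵢ) where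
    open ≤-Reasoning
    private
      x≡ : x ≡ x * recip t * ι t
      x≡ = trans (sym (*-identityʳ x)) (trans (cong (x *_) (sym (trans (*-comm (recip t) (ι t)) (ι*recip 1≤t)))) (sym (*-assoc x (recip t) (ι t))))
      2θ≤eλᵢ : θ + θ ≤ e * λᵢ
      2θ≤eλᵢ = ≤-trans (≤-reflexive 2θ≡el) (*-monoˡ 0≤e l≤λᵢ)

    -- Two errors of size θ occur: the deviation of x/t from λₜ, and the passage from λₜ to λᵢ,
    -- since the real inequality is tested at an index i other than t. Together they are e l, which
    -- is at most e λᵢ.
    relative-lower : (1ℚ - e) * (λᵢ * ι t) ≤ x
    relative-lower = begin
      (1ℚ - e) * (λᵢ * ι t)         ≡⟨ expand e λᵢ (ι t) ⟩
      (λᵢ - e * λᵢ) * ι t           ≤⟨ *-monoʳ (ι≥0 t) (begin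
        λᵢ - e * λᵢ                 ≤⟨ +-monoʳ-≤ λᵢ (neg-antimono-≤ 2θ≤eλᵢ) ⟩
        λᵢ - (θ + θ)                ≡⟨ split λᵢ θ ⟩
        (λᵢ - θ) - θ                ≤⟨ +-monoˡ-≤ (- θ) (≤-trans (+-monoʳ-≤ λᵢ (neg-antimono-≤ λᵢ≈λₜ)) (p≤∣p-q∣+q λᵢ λₜ)) ⟩
        λₜ - θ                      ≤⟨ +-monoʳ-≤ λₜ (neg-antimono-≤ (≤-trans (≤-reflexive (∣∣-swap λₜ (x * recip t))) x≈λₜ)) ⟩
        λₜ - ∣ λₜ - x * recip t ∣   ≤⟨ p≤∣p-q∣+q λₜ (x * recip t) ⟩
        x * recip t                 ∎) ⟩
      x * recip t * ι t             ≡⟨ sym x≡ ⟩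
      x                             ∎
      where
      expand : ∀ e λ′ t → (1ℚ - e) * (λ′ * t) ≡ (λ′ - e * λ′) * t
      expand = solve-∀ ℚ-ring
      split : ∀ p θ → p - (θ + θ) ≡ (p - θ) - θ
      split = solve-∀ ℚ-ring

    relative-upper : x ≤ (1ℚ + e) * (λᵢ * ι t)
    relative-upper = begin
      x                             ≡⟨ x≡ ⟩
      x * recip t * ι t             ≤⟨ *-monoʳ (ι≥0 t) (begin
        x * recip t                 ≤⟨ p≤q+∣p-q∣ (x * recip t) λₜ ⟩
        λₜ + ∣ x * recip t - λₜ ∣   ≤⟨ +-monoʳ-≤ λₜ x≈λₜ ⟩
        λₜ + θ                      ≤⟨ +-monoˡ-≤ θ (≤-trans (p≤q+∣p-q∣ λₜ λᵢ)
                                         (+-monoʳ-≤ λᵢ (≤-trans (≤-reflexive (∣∣-swap λₜ λᵢ)) λᵢ≈λₜ))) ⟩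
        λᵢ + θ + θ                  ≡⟨ +-assoc λᵢ θ θ ⟩
        λᵢ + (θ + θ)                ≤⟨ +-monoʳ-≤ λᵢ 2θ≤eλᵢ ⟩
        λᵢ + e * λᵢ                 ∎) ⟩
      (λᵢ + e * λᵢ) * ι t           ≡⟨ collect e λᵢ (ι t) ⟩
      (1ℚ + e) * (λᵢ * ι t)         ∎
      where
      collect : ∀ e λ′ t → (λ′ + e * λ′) * t ≡ (1ℚ + e) * (λ′ * t)
      collect = solve-∀ ℚ-ring

  CountsWithin : ℝ → ℝ → ℕ → (n : ℕ) → Graph n → Set
  CountsWithin c ε κ n G = ∀ k → 1 ℕ.≤ k → k ℕ.≤ κ →
    (fromℕ 1 -ℝ ε) *ℝ asymptoticCount c k n ≤ℝ fromℕ (componentsOfOrder k G)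
    × fromℕ (componentsOfOrder k G) ≤ℝ (fromℕ 1 +ℝ ε) *ℝ asymptoticCount c k n

  module _ (κ : ℕ) (c : ℝ) (m : ℕ → ℕ) (dens : Density m (seq c)) where

    counts-within : ∀ {e l θ t} → 1 ℕ.≤ t → 0ℚ ≤ e → 0ℚ < θ → θ + θ ≡ e * l →
      AllOrders κ (λ k → Eventually (λ i → ∣ limit (seq c) k i - limit (seq c) k t ∣ ≤ θ)) →
      Eventually (λ i → AllOrders κ (λ k → l ≤ limit (seq c) k i)) →
      ∀ {G : Graph t} → deviations² dens κ t G ≤ θ * θ → CountsWithin c (fromℚ e) κ t G
    counts-within {e} {l} {θ} {t} 1≤t 0≤e 0<θ 2θ≡el near lower {G} small k 1≤k k≤κ =
      eventually-≤⇒≤ℝ {(fromℕ 1 -ℝ fromℚ e) *ℝ asymptoticCount c k t} {fromℕ X}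
        (ev-zip (λ {i} p q → subst₂ _≤_ (cong ((1ℚ - e) *_) (sym (count≡ i))) (ι≡ X)
          (relative-lower 1≤t 0≤e 2θ≡el dev p (q k 1≤k k≤κ))) (near k 1≤k k≤κ) lower) ,
      eventually-≤⇒≤ℝ {fromℕ X} {(fromℕ 1 +ℝ fromℚ e) *ℝ asymptoticCount c k t}
        (ev-zip (λ {i} p q → subst₂ _≤_ (ι≡ X) (cong ((1ℚ + e) *_) (sym (count≡ i)))
          (relative-upper 1≤t 0≤e 2θ≡el dev p (q k 1≤k k≤κ))) (near k 1≤k k≤κ) lower)
      where
      X = componentsOfOrder k G
      count≡ : ∀ i → seq (asymptoticCount c k t) i ≡ limit (seq c) k i * ι t
      count≡ i = cong₂ _*_ (seq-limitℝ c k i) (sym (ι≡ t))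
      dev : ∣ ι X * recip t - limit (seq c) k t ∣ ≤ θ
      dev = square-≤⇒∣∣≤ 0<θ (≤-trans (deviation²≤ dens κ t G k 1≤k k≤κ) small)

    -- One e serves as relative tolerance and as failure probability. The choice θ = e l/2 makes 2θ
    -- = e l, and requiring mean squared deviation at most e θ² lets Markov's inequality at the
    -- threshold θ² lose at most the fraction e.
    concentration : ∀ {e} → 0ℚ < e → Eventually (λ t → Pr[ CountsWithin c (fromℚ e) κ t ]from 𝔾 t (m t) ≥ (1ℚ - e))
    concentration {e} 0<e = ev-zip (λ {t} (1≤t , near) V → event t 1≤t near V)
      (ev-zip _,_ (ev-≥ 1) (ev-allOrders κ nearby)) (variances-small dens κ (*-pos 0<e (*-pos 0<θ 0<θ)))
      where
      positivity = limits-positive dens κ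
      l = proj₁ positivity
      θ = ½ * (e * l)
      0<θ : 0ℚ < θ
      0<θ = half-pos (*-pos 0<e (proj₁ (proj₂ positivity)))
      nearby : ∀ k → 1 ℕ.≤ k → Eventually (λ t → Eventually (λ i → ∣ limit (seq c) k i - limit (seq c) k t ∣ ≤ θ))
      nearby k _ = let N , h = limit-cauchy c k 0<θ in N , λ N≤t → N , λ N≤i → h N≤i N≤t
      event : ∀ t → 1 ℕ.≤ t → AllOrders κ (λ k → Eventually (λ i → ∣ limit (seq c) k i - limit (seq c) k t ∣ ≤ θ)) →
              ∑ℚ (𝔾 t (m t)) (deviations² dens κ t) ≤ e * (θ * θ) * ι (length (𝔾 t (m t))) →
              Pr[ CountsWithin c (fromℚ e) κ t ]from 𝔾 t (m t) ≥ (1ℚ - e)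
      event t 1≤t near V = filter P? Ω , filter-⊆ P? Ω ,
        All.map (λ {G} → counts-within 1≤t (<⇒≤ 0<e) 0<θ (half+half (e * l)) near (proj₂ (proj₂ positivity)) {G}) (all-filter P? Ω) ,
        subst₂ (λ x y → (1ℚ - e) * x ≤ y) (ι≡ (length Ω)) (ι≡ (length (filter P? Ω)))
          (markov P? Ω (deviations² dens κ t) {δ = e} (deviations²≥0 dens κ t) (λ G ¬p → <⇒≤ (≰⇒> ¬p)) (*-pos 0<θ 0<θ) V)
        where
        Ω = 𝔾 t (m t)
        P? : ∀ (G : Graph t) → Dec (deviations² dens κ t G ≤ θ * θ)
        P? G = deviations² dens κ t G ≤? θ * θ

  -- `concentration` with e = 1/(j+1) holds for large n depending on j; `diagonal` lets j = f n grow
  -- slowly enough. Then ε n = 1/(f n + 1) bounds both tolerance and failure probability, and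
  -- `weaken` passes to any fixed δ.
  component-counts : ∀ κ (c : ℝ) → fromℕ 0 <ℝ c → (m : ℕ → ℕ) → (∀ n → IsFloor (c *ℝ fromℕ n) (m n)) →
    ∃[ ε ] (ε ⟶0) × AlmostSurely (λ n → 𝔾 n (m n)) (λ n → CountsWithin c (ε n) κ n)
  component-counts κ c 0<c m floor = (λ n → fromℚ (e (f n))) ,
      (λ {δ} 0<δ → ev-map {P = λ n → e (f n) ≤ δ} {Q = λ n → fromℚ (- δ) ≤ℝ fromℚ (e (f n)) × fromℚ (e (f n)) ≤ℝ fromℚ δ}
        (λ {n} e≤δ → fromℚ-mono (≤-trans (neg-antimono-≤ (<⇒≤ 0<δ)) (<⇒≤ (1/suc>0 (f n)))) , fromℚ-mono e≤δ) (e-small 0<δ)) ,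
      (λ {δ} 0<δ → ev-zip (λ {n} e≤δ → weaken e≤δ) (e-small 0<δ) (proj₂ (proj₂ choice)))
    where
    e : ℕ → ℚ
    e j = + 1 / suc j
    choice = diagonal (λ j → concentration κ c m (floor⇒Density c 0<c m floor) (1/suc>0 j))
    f : ℕ → ℕ
    f = proj₁ choice
    e-small : ∀ {δ} → 0ℚ < δ → Eventually (λ n → e (f n) ≤ δ)
    e-small {δ} 0<δ =
      let J , h = close recip≈0 0<δ
      in ev-map (λ {n} J≤f → ≤-trans (p≤∣p∣ (e (f n))) (≤-trans (≤-reflexive (cong ∣_∣ (sym (+-identityʳ (e (f n))))))
           (h (ℕₚ.≤-trans J≤f (ℕₚ.n≤1+n (f n)))))) (proj₁ (proj₂ choice) J)
    weaken : ∀ {A : Set} {E : A → Set} {Ω : List A} {p δ} → p ≤ δ → Pr[ E ]from Ω ≥ (1ℚ - p) → Pr[ E ]from Ω ≥ (1ℚ - δ)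
    weaken {Ω = Ω} {p} {δ} p≤δ (B , B⊆Ω , all , bound) = B , B⊆Ω , all ,
      ≤-trans (*-monoʳ (subst (0ℚ ≤_) (ι≡ (length Ω)) (ι≥0 (length Ω))) (+-monoʳ-≤ 1ℚ (neg-antimono-≤ p≤δ))) bound

open import Data.Nat.Base using (ℕ; _≤_)

theorem1p2 : (κ : ℕ) → 1 ≤ κ →
    (c : ℝ) → fromℕ 0 <ℝ c →
    (m : ℕ → ℕ) → (∀ n → IsFloor (c *ℝ fromℕ n) (m n)) →
    ∃[ ε ] (ε ⟶0) ×
    AlmostSurely (λ n → 𝔾 n (m n)) (λ n G →
    ∀ k → 1 ≤ k → k ≤ κ →
    (fromℕ 1 -ℝ ε n) *ℝ asymptoticCount c k n ≤ℝ fromℕ (componentsOfOrder k G)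
    × fromℕ (componentsOfOrder k G) ≤ℝ (fromℕ 1 +ℝ ε n) *ℝ asymptoticCount c k n)
theorem1p2 κ _ = Limits.component-counts κ
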